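{- For infinitely many odd prime powers $q$, the CAP bound for $\Gamma_{q^+}$ is strictly smaller than the Delsarte bound for $\Gamma_{q^+}$.
   Context: Let $q$ be an odd prime power, $\mathcal{O}$ a non-degenerate conic in the Desarguesian projective plane $\mathrm{PG}(2,q)$, and $\perp$ the polarity induced by $\mathcal{O}$. A line is secant if it meets $\mathcal{O}$ in exactly two points. The graph $\Gamma_{q^+}$ has as vertices the secant lines of $\mathcal{O}$, with two distinct secant lines $a,b$ adjacent if and only if they are polar conjugates with respect to $\perp$, i.e. the pole $a^\perp$ lies on $b$ (equivalently $b^\perp$ lies on $a$). It is an orbital graph (a single relation of the Schurian association scheme) of the generously transitive action of $\mathrm{PGL}(2,q)\le\mathrm{PGL}(3,q)$, the stabiliser of $\mathcal{O}$, on secant lines; it is edge-regular, with $v=q(q+1)/2$ vertices and valency $k=(q-1)/2$. A graph is $(v,k,\lambda)$ edge-regular if it has $v$ vertices, every vertex has degree $k$, and every two adjacent vertices have exactly $\lambda$ common neighbours. For such a graph $\Gamma$ the clique adjacency polynomial is $$\mathrm{CA}_\Gamma(x,s):=x(x+1)(v-s)-2xs(k-s+1)+s(s-1)(\lambda-s+2).$$ If $\mathrm{CA}_\Gamma(x,s)<0$ for some integer $x$, then $\Gamma$ has no $s$-clique; the CAP bound for $\Gamma$ is the least value of $s-1$ over all integers $s\ge2$ for which there is an integer $x$ with $\mathrm{CA}_\Gamma(x,s)<0$. The Delsarte bound for a graph $\Gamma$ that is a single relation of an association scheme is the real number $1-k/\gamma_v$, where $k$ is the valency and $\gamma_v$ the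 minimum eigenvalue of the adjacency matrix of $\Gamma$. -}

module Defs where

open import Algebra.Apartness.Bundles using (HeytingCommutativeRing; HeytingField)
import Algebra.Apartness.Properties.HeytingCommutativeRing as AP
open import Algebra.Bundles using (CommutativeRing)
open import Algebra.Bundles.Raw using (RawMonoid)
import Algebra.Definitions.RawMonoid as RawMonoidDefinitions
import Algebra.Properties.Ring as RingProperties
import Algebra.Properties.Semiring.Mult as Mult
import Algebra.Solver.Ring as RingSolver
import Algebra.Solver.Ring.AlmostCommutativeRing as ACR
open import Data.Bool.Base using (if_then_else_)
open import Data.Fin.Base using (Fin)
import Data.Fin.Properties as Fin
import Data.Integer.Base as ℤ
import Data.Integer.Properties as ℤ
open import Data.List.Base
  using (List; []; _∷_; map; filter; length; lookup; allFin; deduplicate; cartesianProduct)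
open import Data.List.Membership.Propositional.Properties using (∈-allFin)
open import Data.List.Relation.Unary.Any as Any using (Any; here; there)
import Data.List.Relation.Unary.Any.Properties as Any
open import Data.List.Relation.Unary.Enumerates.Setoid using (IsEnumeration)
import Data.List.Relation.Unary.Enumerates.Setoid.Properties as Enumerates
open import Data.List.Relation.Unary.Unique.DecSetoid using (Unique)
open import Data.List.Relation.Unary.Unique.DecSetoid.Properties using (deduplicate-!)
import Data.Maybe.Base as Maybe
open import Data.Nat.Base as ℕ using (ℕ; zero; suc; _⊔_)
open import Data.Nat.Divisibility using (_∤_)
open import Data.Nat.Primality using (Prime)
import Data.Nat.Properties as ℕ
open import Data.Product.Base using (Σ; ∃; ∃₂; ∃-syntax; Σ-syntax; _×_; _,_; proj₁; proj₂)
open import Data.Product.Relation.Binary.Pointwise.NonDependent using (_×ₛ_)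
open import Data.Rational.Base as ℚ using (ℚ; 0ℚ; 1ℚ; ½)
import Data.Rational.Properties as ℚ
open import Data.Rational.Solver using (module +-*-Solver)
open import Data.Sum.Base as Sum using (_⊎_; inj₁; inj₂)
open import Data.Vec.Functional using (Vector)
open import Function.Base using (_∘_; _on_)
open import Function.Bundles using (Inverse)
open import Function.Properties.Inverse using (Inverse⇒Injection)
open import Level using (0ℓ)
open import Relation.Binary.Bundles using (Setoid; DecSetoid)
import Relation.Binary.Construct.On as On
open import Relation.Binary.Core using (Rel)
open import Relation.Binary.Definitions using (Decidable; Symmetric; Irreflexive)
open import Relation.Binary.PropositionalEquality
  using (_≡_; _≢_; refl; sym; trans; cong; cong₂; subst)
import Relation.Binary.PropositionalEquality.Properties as ≡
open import Relation.Nullary using (¬_; Dec; yes; no; does; contradiction)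
open import Relation.Nullary.Decidable
  using (map′; via-injection; decidable-stable; dec⇒maybe; ¬?; _×-dec_; _⊎-dec_; _→-dec_)
open import Relation.Unary using (Pred) renaming (Decidable to Decidable₁)

½*ε+½*ε≡ε : ∀ ε → ½ ℚ.* ε ℚ.+ ½ ℚ.* ε ≡ ε
½*ε+½*ε≡ε ε = trans (sym (ℚ.*-distribʳ-+ ε ½ ½)) (ℚ.*-identityˡ ε)

*-pos : ∀ {p q} → 0ℚ ℚ.< p → 0ℚ ℚ.< q → 0ℚ ℚ.< p ℚ.* q
*-pos {p} {q} 0<p 0<q =
  ℚ.positive⁻¹ _ {{ℚ.pos*pos⇒pos p {{ℚ.positive 0<p}} q {{ℚ.positive 0<q}}}}

½-pos : ∀ {ε} → 0ℚ ℚ.< ε → 0ℚ ℚ.< ½ ℚ.* ε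
½-pos = *-pos (ℚ.positive⁻¹ ½)

*-mono-≤-nonNeg : ∀ {p q r s} → 0ℚ ℚ.≤ r → 0ℚ ℚ.≤ q → p ℚ.≤ q → r ℚ.≤ s →
                  p ℚ.* r ℚ.≤ q ℚ.* s
*-mono-≤-nonNeg {p} {q} {r} {s} 0≤r 0≤q p≤q r≤s = ℚ.≤-trans
  (ℚ.*-monoʳ-≤-nonNeg r {{ℚ.nonNegative 0≤r}} p≤q)
  (ℚ.*-monoˡ-≤-nonNeg q {{ℚ.nonNegative 0≤q}} r≤s)

Eventually : Pred ℕ 0ℓ → Set
Eventually P = ∃[ N ] (∀ n → N ℕ.≤ n → P n)

-- Cauchy sequences of rationals, identified by _≃_.  As usual constructively, x ≤ y is the
-- negation of y < x.
record ℝ : Set where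
  constructor mkℝ
  field
    seq    : ℕ → ℚ
    cauchy : ∀ {ε} → 0ℚ ℚ.< ε →
             ∃[ N ] (∀ m n → N ℕ.≤ m → N ℕ.≤ n → ℚ.∣ seq m ℚ.- seq n ∣ ℚ.≤ ε)

open ℝ public

infix 4 _≃_ _<ᴿ_ _≤ᴿ_ _#ᴿ_

_≃_ : Rel ℝ 0ℓ
x ≃ y = ∀ {ε} → 0ℚ ℚ.< ε → Eventually λ n → ℚ.∣ seq x n ℚ.- seq y n ∣ ℚ.≤ ε

_<ᴿ_ : Rel ℝ 0ℓ
x <ᴿ y = ∃[ ε ] 0ℚ ℚ.< ε × Eventually (λ n → seq x n ℚ.+ ε ℚ.≤ seq y n)

_≤ᴿ_ : Rel ℝ 0ℓ
x ≤ᴿ y = ¬ (y <ᴿ x)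

_#ᴿ_ : Rel ℝ 0ℓ
x #ᴿ y = x <ᴿ y ⊎ y <ᴿ x

fromℚ : ℚ → ℝ
fromℚ p = mkℝ (λ _ → p) λ {ε} 0<ε → 0 , λ _ _ _ _ →
  subst (λ d → ℚ.∣ d ∣ ℚ.≤ ε) (sym (ℚ.+-inverseʳ p)) (ℚ.<⇒≤ 0<ε)

fromℕ : ℕ → ℝ
fromℕ n = fromℚ (ℤ.+ n ℚ./ 1)

0ᴿ 1ᴿ : ℝ
0ᴿ = fromℚ 0ℚ
1ᴿ = fromℚ 1ℚ

infixl 6 _+ᴿ_ _-ᴿ_
infixl 7 _*ᴿ_
infix  8 -ᴿ_

_+ᴿ_ : ℝ → ℝ → ℝ
x +ᴿ y = mkℝ (λ n → seq x n ℚ.+ seq y n) λ {ε} 0<ε →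
  let (M , p) = cauchy x (½-pos 0<ε)
      (N , q) = cauchy y (½-pos 0<ε)
  in M ⊔ N , λ m n M⊔N≤m M⊔N≤n → begin
    ℚ.∣ (seq x m ℚ.+ seq y m) ℚ.- (seq x n ℚ.+ seq y n) ∣
      ≡⟨ cong ℚ.∣_∣ (solve 4 (λ a b c d → (a :+ b) :- (c :+ d) := (a :- c) :+ (b :- d))
                      refl (seq x m) (seq y m) (seq x n) (seq y n)) ⟩
    ℚ.∣ (seq x m ℚ.- seq x n) ℚ.+ (seq y m ℚ.- seq y n) ∣
      ≤⟨ ℚ.∣p+q∣≤∣p∣+∣q∣ (seq x m ℚ.- seq x n) (seq y m ℚ.- seq y n) ⟩
    ℚ.∣ seq x m ℚ.- seq x n ∣ ℚ.+ ℚ.∣ seq y m ℚ.- seq y n ∣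
      ≤⟨ ℚ.+-mono-≤ (p m n (ℕ.m⊔n≤o⇒m≤o M N M⊔N≤m) (ℕ.m⊔n≤o⇒m≤o M N M⊔N≤n))
                    (q m n (ℕ.m⊔n≤o⇒n≤o M N M⊔N≤m) (ℕ.m⊔n≤o⇒n≤o M N M⊔N≤n)) ⟩
    ½ ℚ.* ε ℚ.+ ½ ℚ.* ε ≡⟨ ½*ε+½*ε≡ε ε ⟩
    ε ∎
  where open ℚ.≤-Reasoning
        open +-*-Solver

-ᴿ_ : ℝ → ℝ
-ᴿ x = mkℝ (λ n → ℚ.- seq x n) λ {ε} 0<ε →
  let (N , p) = cauchy x 0<ε
  in N , λ m n N≤m N≤n →
    subst (ℚ._≤ ε) (trans (sym (ℚ.∣-p∣≡∣p∣ _)) (cong ℚ.∣_∣ (ℚ.neg-distrib-+ (seq x m) (ℚ.- seq x n))))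
      (p m n N≤m N≤n)

_-ᴿ_ : ℝ → ℝ → ℝ
x -ᴿ y = x +ᴿ (-ᴿ y)

eventually-bounded : ∀ x → ∃[ B ] 0ℚ ℚ.< B × Eventually (λ n → ℚ.∣ seq x n ∣ ℚ.≤ B)
eventually-bounded x = let (N , p) = cauchy x {1ℚ} (ℚ.positive⁻¹ 1ℚ) in
  1ℚ ℚ.+ ℚ.∣ seq x N ∣ ,
  ℚ.<-≤-trans (ℚ.positive⁻¹ 1ℚ) (subst (ℚ._≤ 1ℚ ℚ.+ ℚ.∣ seq x N ∣) (ℚ.+-identityʳ 1ℚ)
                                  (ℚ.+-monoʳ-≤ 1ℚ (ℚ.0≤∣p∣ (seq x N)))) ,
  N , λ n N≤n → begin
    ℚ.∣ seq x n ∣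
      ≡⟨ cong ℚ.∣_∣ (solve 2 (λ a b → a := (a :- b) :+ b) refl (seq x n) (seq x N)) ⟩
    ℚ.∣ (seq x n ℚ.- seq x N) ℚ.+ seq x N ∣
      ≤⟨ ℚ.∣p+q∣≤∣p∣+∣q∣ (seq x n ℚ.- seq x N) (seq x N) ⟩
    ℚ.∣ seq x n ℚ.- seq x N ∣ ℚ.+ ℚ.∣ seq x N ∣
      ≤⟨ ℚ.+-monoˡ-≤ ℚ.∣ seq x N ∣ (p n N N≤n ℕ.≤-refl) ⟩
    1ℚ ℚ.+ ℚ.∣ seq x N ∣ ∎
  where open ℚ.≤-Reasoning
        open +-*-Solver

-- The reciprocal extended by 0 ↦ 0, so that it can be applied to every term of a sequence.
reciprocal : ℚ → ℚ
reciprocal p with p ℚ.≟ 0ℚ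
... | yes _   = 0ℚ
... | no p≢0 = (ℚ.1/ p) {{ℚ.≢-nonZero p≢0}}

reciprocal-inverseʳ : ∀ {p} → p ≢ 0ℚ → p ℚ.* reciprocal p ≡ 1ℚ
reciprocal-inverseʳ {p} p≢0 with p ℚ.≟ 0ℚ
... | yes p≡0  = contradiction p≡0 p≢0
... | no  p≢0′ = ℚ.*-inverseʳ p {{ℚ.≢-nonZero p≢0′}}

reciprocal-pos : ∀ {p} → 0ℚ ℚ.< p → 0ℚ ℚ.< reciprocal p
reciprocal-pos {p} 0<p with p ℚ.≟ 0ℚ
... | yes p≡0 = contradiction (sym p≡0) (ℚ.<⇒≢ 0<p)
... | no  p≢0 = ℚ.positive⁻¹ _ {{ℚ.1/pos⇒pos p {{ℚ.positive 0<p}}}}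

_*ᴿ_ : ℝ → ℝ → ℝ
x *ᴿ y = mkℝ (λ n → seq x n ℚ.* seq y n) λ {ε} 0<ε →
  let (A , 0<A , K , a) = eventually-bounded x
      (B , 0<B , L , b) = eventually-bounded y
      (M , p) = cauchy x (*-pos (½-pos 0<ε) (reciprocal-pos 0<B))
      (N , q) = cauchy y (*-pos (½-pos 0<ε) (reciprocal-pos 0<A))
      cancel : ∀ {C} → 0ℚ ℚ.< C → C ℚ.* ((½ ℚ.* ε) ℚ.* reciprocal C) ≡ ½ ℚ.* ε
      cancel {C} 0<C = trans
        (solve 3 (λ c e r → c :* (e :* r) := e :* (c :* r)) refl C (½ ℚ.* ε) (reciprocal C))
        (trans (cong ((½ ℚ.* ε) ℚ.*_) (reciprocal-inverseʳ (ℚ.<⇒≢ 0<C ∘ sym))) (ℚ.*-identityʳ _))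
  in (K ⊔ L) ⊔ (M ⊔ N) , λ m n N≤m N≤n →
    let KL≤m = ℕ.m⊔n≤o⇒m≤o (K ⊔ L) (M ⊔ N) N≤m
        KL≤n = ℕ.m⊔n≤o⇒m≤o (K ⊔ L) (M ⊔ N) N≤n
        MN≤m = ℕ.m⊔n≤o⇒n≤o (K ⊔ L) (M ⊔ N) N≤m
        MN≤n = ℕ.m⊔n≤o⇒n≤o (K ⊔ L) (M ⊔ N) N≤n
    in begin
    ℚ.∣ seq x m ℚ.* seq y m ℚ.- seq x n ℚ.* seq y n ∣
      ≡⟨ cong ℚ.∣_∣ (solve 4 (λ s t u v → s :* t :- u :* v := s :* (t :- v) :+ v :* (s :- u))
                      refl (seq x m) (seq y m) (seq x n) (seq y n)) ⟩
    ℚ.∣ seq x m ℚ.* (seq y m ℚ.- seq y n) ℚ.+ seq y n ℚ.* (seq x m ℚ.- seq x n) ∣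
      ≤⟨ ℚ.∣p+q∣≤∣p∣+∣q∣ (seq x m ℚ.* (seq y m ℚ.- seq y n)) (seq y n ℚ.* (seq x m ℚ.- seq x n)) ⟩
    ℚ.∣ seq x m ℚ.* (seq y m ℚ.- seq y n) ∣ ℚ.+ ℚ.∣ seq y n ℚ.* (seq x m ℚ.- seq x n) ∣
      ≡⟨ cong₂ ℚ._+_ (ℚ.∣p*q∣≡∣p∣*∣q∣ (seq x m) (seq y m ℚ.- seq y n))
                     (ℚ.∣p*q∣≡∣p∣*∣q∣ (seq y n) (seq x m ℚ.- seq x n)) ⟩
    ℚ.∣ seq x m ∣ ℚ.* ℚ.∣ seq y m ℚ.- seq y n ∣ ℚ.+ ℚ.∣ seq y n ∣ ℚ.* ℚ.∣ seq x m ℚ.- seq x n ∣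
      ≤⟨ ℚ.+-mono-≤
           (*-mono-≤-nonNeg (ℚ.0≤∣p∣ (seq y m ℚ.- seq y n)) (ℚ.<⇒≤ 0<A)
             (a m (ℕ.m⊔n≤o⇒m≤o K L KL≤m))
             (q m n (ℕ.m⊔n≤o⇒n≤o M N MN≤m) (ℕ.m⊔n≤o⇒n≤o M N MN≤n)))
           (*-mono-≤-nonNeg (ℚ.0≤∣p∣ (seq x m ℚ.- seq x n)) (ℚ.<⇒≤ 0<B)
             (b n (ℕ.m⊔n≤o⇒n≤o K L KL≤n))
             (p m n (ℕ.m⊔n≤o⇒m≤o M N MN≤m) (ℕ.m⊔n≤o⇒m≤o M N MN≤n))) ⟩
    A ℚ.* ((½ ℚ.* ε) ℚ.* reciprocal A) ℚ.+ B ℚ.* ((½ ℚ.* ε) ℚ.* reciprocal B)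
      ≡⟨ cong₂ ℚ._+_ (cancel 0<A) (cancel 0<B) ⟩
    ½ ℚ.* ε ℚ.+ ½ ℚ.* ε ≡⟨ ½*ε+½*ε≡ε ε ⟩
    ε ∎
  where open ℚ.≤-Reasoning
        open +-*-Solver

#0⇒bounded-away : ∀ {x} → x #ᴿ 0ᴿ →
                  ∃[ δ ] 0ℚ ℚ.< δ × Eventually (λ n → δ ℚ.≤ ℚ.∣ seq x n ∣)
#0⇒bounded-away {x} (inj₁ (δ , 0<δ , N , p)) = δ , 0<δ , N , λ n N≤n → begin
  δ                       ≡⟨ solve 2 (λ d a → d := (a :+ d) :+ (:- a)) refl δ (seq x n) ⟩
  (seq x n ℚ.+ δ) ℚ.- seq x n ≤⟨ ℚ.+-monoˡ-≤ (ℚ.- seq x n) (p n N≤n) ⟩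
  0ℚ ℚ.- seq x n          ≡⟨ ℚ.+-identityˡ (ℚ.- seq x n) ⟩
  ℚ.- seq x n             ≤⟨ p≤∣p∣ (ℚ.- seq x n) ⟩
  ℚ.∣ ℚ.- seq x n ∣       ≡⟨ ℚ.∣-p∣≡∣p∣ (seq x n) ⟩
  ℚ.∣ seq x n ∣           ∎
  where
  open ℚ.≤-Reasoning
  open +-*-Solver
  p≤∣p∣ : ∀ r → r ℚ.≤ ℚ.∣ r ∣
  p≤∣p∣ r with ℚ.≤-total 0ℚ r
  ... | inj₁ 0≤r = ℚ.≤-reflexive (sym (ℚ.0≤p⇒∣p∣≡p 0≤r))
  ... | inj₂ r≤0 = ℚ.≤-trans r≤0 (ℚ.0≤∣p∣ r)
#0⇒bounded-away {x} (inj₂ (δ , 0<δ , N , p)) = δ , 0<δ , N , λ n N≤n →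
  let δ≤xₙ = subst (ℚ._≤ seq x n) (ℚ.+-identityˡ δ) (p n N≤n)
  in ℚ.≤-trans δ≤xₙ
       (ℚ.≤-reflexive (sym (ℚ.0≤p⇒∣p∣≡p (ℚ.≤-trans (ℚ.<⇒≤ 0<δ) δ≤xₙ))))

inverse : (x : ℝ) → x #ᴿ 0ᴿ → ℝ
inverse x x#0 = mkℝ (λ n → reciprocal (seq x n)) λ {ε} 0<ε →
  let (δ , 0<δ , K , lb) = #0⇒bounded-away {x} x#0
      (N , p) = cauchy x (*-pos 0<ε (*-pos 0<δ 0<δ))
      r = reciprocal δ
      0<r = reciprocal-pos 0<δ
      nonzero : ∀ n → K ℕ.≤ n → seq x n ≢ 0ℚ
      nonzero n K≤n xₙ≡0 = ℚ.<⇒≢ (ℚ.<-≤-trans 0<δ (lb n K≤n)) (sym (cong ℚ.∣_∣ xₙ≡0))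
      bound : ∀ n → K ℕ.≤ n → ℚ.∣ reciprocal (seq x n) ∣ ℚ.≤ r
      bound n K≤n = let a = seq x n ; a⁻¹ = reciprocal a in begin
        ℚ.∣ a⁻¹ ∣                         ≡⟨ ℚ.*-identityʳ ℚ.∣ a⁻¹ ∣ ⟨
        ℚ.∣ a⁻¹ ∣ ℚ.* 1ℚ                  ≡⟨ cong (ℚ.∣ a⁻¹ ∣ ℚ.*_) (reciprocal-inverseʳ (ℚ.<⇒≢ 0<δ ∘ sym)) ⟨
        ℚ.∣ a⁻¹ ∣ ℚ.* (δ ℚ.* r)           ≤⟨ ℚ.*-monoˡ-≤-nonNeg ℚ.∣ a⁻¹ ∣ {{ℚ.∣-∣-nonNeg a⁻¹}}
                                               (ℚ.*-monoʳ-≤-nonNeg r {{ℚ.nonNegative (ℚ.<⇒≤ 0<r)}} (lb n K≤n)) ⟩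
        ℚ.∣ a⁻¹ ∣ ℚ.* (ℚ.∣ a ∣ ℚ.* r)     ≡⟨ solve 3 (λ u v w → u :* (v :* w) := (v :* u) :* w)
                                               refl ℚ.∣ a⁻¹ ∣ ℚ.∣ a ∣ r ⟩
        (ℚ.∣ a ∣ ℚ.* ℚ.∣ a⁻¹ ∣) ℚ.* r     ≡⟨ cong (ℚ._* r) (ℚ.∣p*q∣≡∣p∣*∣q∣ a a⁻¹) ⟨
        ℚ.∣ a ℚ.* a⁻¹ ∣ ℚ.* r             ≡⟨ cong (λ t → ℚ.∣ t ∣ ℚ.* r) (reciprocal-inverseʳ (nonzero n K≤n)) ⟩
        1ℚ ℚ.* r                          ≡⟨ ℚ.*-identityˡ r ⟩
        r                                 ∎
  in K ⊔ N , λ m n K⊔N≤m K⊔N≤n →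
    let K≤m = ℕ.m⊔n≤o⇒m≤o K N K⊔N≤m
        K≤n = ℕ.m⊔n≤o⇒m≤o K N K⊔N≤n
        a = seq x m ; a⁻¹ = reciprocal a
        b = seq x n ; b⁻¹ = reciprocal b
    in begin
    ℚ.∣ a⁻¹ ℚ.- b⁻¹ ∣
      ≡⟨ cong ℚ.∣_∣ (cong₂ ℚ._-_
           (trans (sym (ℚ.*-identityʳ a⁻¹)) (cong (a⁻¹ ℚ.*_) (sym (reciprocal-inverseʳ (nonzero n K≤n)))))
           (trans (sym (ℚ.*-identityʳ b⁻¹)) (cong (b⁻¹ ℚ.*_) (sym (reciprocal-inverseʳ (nonzero m K≤m)))))) ⟩
    ℚ.∣ a⁻¹ ℚ.* (b ℚ.* b⁻¹) ℚ.- b⁻¹ ℚ.* (a ℚ.* a⁻¹) ∣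
      ≡⟨ cong ℚ.∣_∣ (solve 4 (λ s s′ t t′ → s′ :* (t :* t′) :- t′ :* (s :* s′) := (t :- s) :* (s′ :* t′))
                      refl a a⁻¹ b b⁻¹) ⟩
    ℚ.∣ (b ℚ.- a) ℚ.* (a⁻¹ ℚ.* b⁻¹) ∣
      ≡⟨ trans (ℚ.∣p*q∣≡∣p∣*∣q∣ (b ℚ.- a) (a⁻¹ ℚ.* b⁻¹))
               (cong (ℚ.∣ b ℚ.- a ∣ ℚ.*_) (ℚ.∣p*q∣≡∣p∣*∣q∣ a⁻¹ b⁻¹)) ⟩
    ℚ.∣ b ℚ.- a ∣ ℚ.* (ℚ.∣ a⁻¹ ∣ ℚ.* ℚ.∣ b⁻¹ ∣)
      ≤⟨ *-mono-≤-nonNeg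
           (ℚ.nonNegative⁻¹ _ {{ℚ.nonNeg*nonNeg⇒nonNeg ℚ.∣ a⁻¹ ∣ {{ℚ.∣-∣-nonNeg a⁻¹}}
                                                        ℚ.∣ b⁻¹ ∣ {{ℚ.∣-∣-nonNeg b⁻¹}}}})
           (ℚ.<⇒≤ (*-pos 0<ε (*-pos 0<δ 0<δ)))
           (p n m (ℕ.m⊔n≤o⇒n≤o K N K⊔N≤n) (ℕ.m⊔n≤o⇒n≤o K N K⊔N≤m))
           (*-mono-≤-nonNeg (ℚ.0≤∣p∣ b⁻¹) (ℚ.<⇒≤ 0<r) (bound m K≤m) (bound n K≤n)) ⟩
    (ε ℚ.* (δ ℚ.* δ)) ℚ.* (r ℚ.* r)
      ≡⟨ solve 3 (λ e d s → (e :* (d :* d)) :* (s :* s) := (e :* (d :* s)) :* (d :* s)) refl ε δ r ⟩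
    (ε ℚ.* (δ ℚ.* r)) ℚ.* (δ ℚ.* r)
      ≡⟨ cong (λ t → (ε ℚ.* t) ℚ.* t) (reciprocal-inverseʳ (ℚ.<⇒≢ 0<δ ∘ sym)) ⟩
    (ε ℚ.* 1ℚ) ℚ.* 1ℚ
      ≡⟨ trans (ℚ.*-identityʳ _) (ℚ.*-identityʳ ε) ⟩
    ε ∎
  where open ℚ.≤-Reasoning
        open +-*-Solver

_÷ᴿ_[_] : ℝ → (y : ℝ) → y #ᴿ 0ᴿ → ℝ
x ÷ᴿ y [ y#0 ] = x *ᴿ inverse y y#0

+ᴿ-rawMonoid : RawMonoid 0ℓ 0ℓ
+ᴿ-rawMonoid = record { Carrier = ℝ ; _≈_ = _≃_ ; _∙_ = _+ᴿ_ ; ε = 0ᴿ }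

open RawMonoidDefinitions +ᴿ-rawMonoid public using () renaming (sum to sumᴿ)

Matrix : ℕ → Set
Matrix n = Fin n → Fin n → ℝ

_*ᵛ_ : ∀ {n} → Matrix n → Vector ℝ n → Vector ℝ n
(A *ᵛ u) i = sumᴿ λ j → A i j *ᴿ u j

IsEigenvalue : ∀ {n} → Matrix n → ℝ → Set
IsEigenvalue {n} A γ =
  Σ[ u ∈ Vector ℝ n ] (∃[ i ] u i #ᴿ 0ᴿ) × (∀ i → (A *ᵛ u) i ≃ γ *ᴿ u i)

IsMinimumEigenvalue : ∀ {n} → Matrix n → ℝ → Set
IsMinimumEigenvalue A γ = IsEigenvalue A γ × (∀ μ → IsEigenvalue A μ → γ ≤ᴿ μ)

record Graph : Set₁ where
  field
    order    : ℕ
    _~_      : Rel (Fin order) 0ℓ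
    _~?_     : Decidable _~_
    ~-sym    : Symmetric _~_
    ~-irrefl : Irreflexive _≡_ _~_

  degree : Fin order → ℕ
  degree i = length (filter (i ~?_) (allFin order))

  commonNeighbours : Fin order → Fin order → ℕ
  commonNeighbours i j = length (filter (λ l → (i ~? l) ×-dec (j ~? l)) (allFin order))

  adjacencyMatrix : Matrix order
  adjacencyMatrix i j = if does (i ~? j) then 1ᴿ else 0ᴿ

IsEdgeRegular : Graph → ℕ → ℕ → ℕ → Set
IsEdgeRegular Γ v k λ′ =
  order ≡ v × (∀ i → degree i ≡ k) × (∀ i j → i ~ j → commonNeighbours i j ≡ λ′)
  where open Graph Γ

cliqueAdjacencyPolynomial : (v k λ′ : ℕ) (x s : ℤ.ℤ) → ℤ.ℤ
cliqueAdjacencyPolynomial v k λ′ x s =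
      x * (x + + 1) * (+ v - s)
    - + 2 * x * s * (+ k - s + + 1)
    + s * (s - + 1) * (+ λ′ - s + + 2)
  where open import Data.Integer.Base using (_+_; _-_; _*_; +_)

RulesOutCliques : (v k λ′ s : ℕ) → Set
RulesOutCliques v k λ′ s = ∃[ x ] cliqueAdjacencyPolynomial v k λ′ x (ℤ.+ s) ℤ.< ℤ.+ 0

-- The bound is s - 1 for the least admissible s, so here c = s - 1.
IsCAPBound : Graph → ℕ → Set
IsCAPBound Γ c = ∃[ v ] ∃[ k ] ∃[ λ′ ]
  IsEdgeRegular Γ v k λ′ ×
  (2 ℕ.≤ suc c × RulesOutCliques v k λ′ (suc c)) ×
  (∀ s → 2 ℕ.≤ s → RulesOutCliques v k λ′ s → suc c ℕ.≤ s)

IsRegular : Graph → ℕ → Set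
IsRegular Γ k = ∀ i → Graph.degree Γ i ≡ k

delsarteBound : (k : ℕ) (γ : ℝ) → γ #ᴿ 0ᴿ → ℝ
delsarteBound k γ γ#0 = 1ᴿ -ᴿ fromℕ k ÷ᴿ γ [ γ#0 ]

module IntegerSolver (R : CommutativeRing 0ℓ 0ℓ) where
  open CommutativeRing R hiding (trans; sym; refl)
  open CommutativeRing R using () renaming (refl to ≈-refl; sym to ≈-sym; trans to ≈-trans)
  open RingProperties ring
  open Mult semiring renaming (_×_ to _×ⁿ_)

  fromℤ : ℤ.ℤ → Carrier
  fromℤ (ℤ.+ n)      = n ×ⁿ 1#
  fromℤ (ℤ.-[1+ n ]) = - (suc n ×ⁿ 1#)

  ⊖-homo : ∀ m n → fromℤ (m ℤ.⊖ n) ≈ m ×ⁿ 1# - n ×ⁿ 1#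
  ⊖-homo zero    zero    = ≈-sym (-‿inverseʳ 0#)
  ⊖-homo zero    (suc n) = ≈-sym (+-identityˡ _)
  ⊖-homo (suc m) zero    = ≈-sym (≈-trans (+-congˡ -0#≈0#) (+-identityʳ _))
  ⊖-homo (suc m) (suc n) = begin
    fromℤ (suc m ℤ.⊖ suc n)          ≡⟨ cong fromℤ (ℤ.[1+m]⊖[1+n]≡m⊖n m n) ⟩
    fromℤ (m ℤ.⊖ n)                  ≈⟨ ⊖-homo m n ⟩
    M - N                            ≈⟨ +-congʳ (xyx⁻¹≈y 1# M) ⟨
    (1# + M - 1#) - N                ≈⟨ +-assoc (1# + M) (- 1#) (- N) ⟩
    (1# + M) + (- 1# - N)            ≈⟨ +-congˡ (-‿+-comm 1# N) ⟩
    (1# + M) - (1# + N)              ∎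
    where
    open import Relation.Binary.Reasoning.Setoid setoid
    M = m ×ⁿ 1#
    N = n ×ⁿ 1#

  -‿homo′ : ∀ i → fromℤ (ℤ.- i) ≈ - fromℤ i
  -‿homo′ (ℤ.+ zero)   = ≈-sym -0#≈0#
  -‿homo′ ℤ.+[1+ n ]   = ≈-refl
  -‿homo′ ℤ.-[1+ n ]   = ≈-sym (-‿involutive _)

  +-homo′ : ∀ i j → fromℤ (i ℤ.+ j) ≈ fromℤ i + fromℤ j
  +-homo′ (ℤ.+ m)    (ℤ.+ n)    = ×-homo-+ 1# m n
  +-homo′ (ℤ.+ m)    ℤ.-[1+ n ] = ⊖-homo m (suc n)
  +-homo′ ℤ.-[1+ m ] (ℤ.+ n)    = ≈-trans (⊖-homo n (suc m)) (+-comm _ _)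
  +-homo′ ℤ.-[1+ m ] ℤ.-[1+ n ] = ≈-trans
    (-‿cong (≈-trans (reflexive (cong (_×ⁿ 1#) (cong suc (sym (ℕ.+-suc m n)))))
      (×-homo-+ 1# (suc m) (suc n)))) (≈-sym (-‿+-comm _ _))

  *-homo⁺ : ∀ m j → fromℤ (ℤ.+ m ℤ.* j) ≈ fromℤ (ℤ.+ m) * fromℤ j
  *-homo⁺ m (ℤ.+ n) = ≈-trans (reflexive (cong fromℤ (sym (ℤ.pos-* m n)))) (×1-homo-* m n)
  *-homo⁺ m ℤ.-[1+ n ] = ≈-trans
    (reflexive (cong fromℤ (sym (ℤ.neg-distribʳ-* (ℤ.+ m) (ℤ.+ suc n)))))
    (≈-trans (-‿homo′ (ℤ.+ m ℤ.* ℤ.+ suc n))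
    (≈-trans (-‿cong (*-homo⁺ m (ℤ.+ suc n))) (-‿distribʳ-* _ _)))

  *-homo′ : ∀ i j → fromℤ (i ℤ.* j) ≈ fromℤ i * fromℤ j
  *-homo′ (ℤ.+ m) j = *-homo⁺ m j
  *-homo′ ℤ.-[1+ m ] j = ≈-trans
    (reflexive (cong fromℤ (sym (ℤ.neg-distribˡ-* (ℤ.+ suc m) j))))
    (≈-trans (-‿homo′ (ℤ.+ suc m ℤ.* j))
    (≈-trans (-‿cong (*-homo⁺ (suc m) j)) (-‿distribˡ-* _ _)))

  morphism : ℤ.+-*-rawRing ACR.-Raw-AlmostCommutative⟶ ACR.fromCommutativeRing R
  morphism = record
    { ⟦_⟧    = fromℤ
    ; +-homo = +-homo′
    ; *-homo = *-homo′
    ; -‿homo = -‿homo′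
    ; 0-homo = ≈-refl
    ; 1-homo = +-identityʳ 1#
    }

  open RingSolver ℤ.+-*-rawRing (ACR.fromCommutativeRing R) morphism
    (λ i j → Maybe.map (reflexive ∘ cong fromℤ) (dec⇒maybe (i ℤ.≟ j)))
    public using (solve; _:+_; _:*_; _:-_; :-_; _:=_; con; Polynomial)

module Search (S : Setoid 0ℓ 0ℓ) {xs : List (Setoid.Carrier S)} (complete : IsEnumeration S xs) where
  open Setoid S using (Carrier; _≈_) renaming (sym to ≈-sym)

  ∃? : ∀ {P : Pred Carrier 0ℓ} → (∀ {x y} → x ≈ y → P x → P y) → Decidable₁ P → Dec (∃ P)
  ∃? resp P? = map′ Any.satisfied
    (λ (x , px) → Any.map (λ x≈y → resp x≈y px) (complete x)) (Any.any? P? xs)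

  ∀? : ∀ {P : Pred Carrier 0ℓ} → (∀ {x y} → x ≈ y → P x → P y) → Decidable₁ P → Dec (∀ x → P x)
  ∀? resp P? = map′
    (λ ¬∃¬ x → decidable-stable (P? x) λ ¬px → ¬∃¬ (x , ¬px))
    (λ ∀p (x , ¬px) → ¬px (∀p x))
    (¬? (∃? (λ x≈y ¬px py → ¬px (resp (≈-sym x≈y) py)) (¬? ∘ P?)))

module Restrict (S : Setoid 0ℓ 0ℓ) {P : Pred (Setoid.Carrier S) 0ℓ}
  (resp : ∀ {x y} → Setoid._≈_ S x y → P x → P y) (P? : Decidable₁ P) where
  open Setoid S using (Carrier; _≈_)

  restrictedSetoid : Setoid 0ℓ 0ℓ
  restrictedSetoid = On.setoid {B = Σ Carrier P} S proj₁

  restrict : List Carrier → List (Σ Carrier P)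
  restrict []       = []
  restrict (x ∷ xs) with P? x
  ... | yes px = (x , px) ∷ restrict xs
  ... | no  _  = restrict xs

  restrict⁺ : ∀ {xs} → IsEnumeration S xs → IsEnumeration restrictedSetoid (restrict xs)
  restrict⁺ complete (x , px) = go (complete x)
    where
    go : ∀ {ys} → Any (x ≈_) ys → Any (λ y → x ≈ proj₁ y) (restrict ys)
    go {y ∷ ys} (here x≈y) with P? y
    ... | yes _   = here x≈y
    ... | no  ¬py = contradiction (resp x≈y px) ¬py
    go {y ∷ ys} (there p) with P? y
    ... | yes _ = there (go p)
    ... | no  _ = go p

HasOrder : HeytingField 0ℓ 0ℓ 0ℓ → ℕ → Set
HasOrder F q = Inverse (HeytingField.setoid F) (≡.setoid (Fin q))

module PG2 (F : HeytingField 0ℓ 0ℓ 0ℓ) {q : ℕ} (∣F∣≡q : HasOrder F q) where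

  open HeytingField F renaming (refl to ≈-refl; sym to ≈-sym; trans to ≈-trans)
  open AP heytingCommutativeRing using (x-0≈x; x#0y#0→xy#0; #-congʳ; #-congˡ; 1#0)

  _≟_ : Decidable _≈_
  _≟_ = via-injection (Inverse⇒Injection ∣F∣≡q) Fin._≟_

  elements : List Carrier
  elements = map (Inverse.from ∣F∣≡q) (allFin q)

  elements-complete : IsEnumeration setoid elements
  elements-complete x = Any.map⁺ (Any.map
    (λ { refl → ≈-sym (Inverse.strictlyInverseʳ ∣F∣≡q x) }) (∈-allFin (Inverse.to ∣F∣≡q x)))

  _#?_ : Decidable _#_
  x #? y = map′ invertible⇒# #⇒invertible (Search.∃? setoid elements-complete
    (λ z≈w (zu , uz) → ≈-trans (*-congʳ (≈-sym z≈w)) zu , ≈-trans (*-congˡ (≈-sym z≈w)) uz)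
    (λ z → ((z * (x - y)) ≟ 1#) ×-dec (((x - y) * z) ≟ 1#)))

  module FieldSolver = IntegerSolver (HeytingCommutativeRing.commutativeRing heytingCommutativeRing)

  #0⇒inverse : ∀ {t} → t # 0# → ∃[ s ] s # 0# × s * t ≈ 1#
  #0⇒inverse {t} t#0 = let (s , st , ts) = #⇒invertible t#0 in
    s ,
    invertible⇒# (t , ≈-trans (*-congˡ (x-0≈x s)) (ts′ ts)
                    , ≈-trans (*-congʳ (x-0≈x s)) (st′ st)) ,
    st′ st
    where
    st′ : ∀ {s} → s * (t - 0#) ≈ 1# → s * t ≈ 1#
    st′ = ≈-trans (*-congˡ (≈-sym (x-0≈x t)))
    ts′ : ∀ {s} → (t - 0#) * s ≈ 1# → t * s ≈ 1#
    ts′ = ≈-trans (*-congʳ (≈-sym (x-0≈x t)))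

  #0-cancelˡ : ∀ {t x} → t # 0# → t * x ≈ 0# → x ≈ 0#
  #0-cancelˡ {t} {x} t#0 tx≈0 = let (s , _ , st≈1) = #0⇒inverse t#0 in
    ≈-trans (≈-sym (*-identityˡ x)) (≈-trans (*-congʳ (≈-sym st≈1))
      (≈-trans (*-assoc s t x) (≈-trans (*-congˡ tx≈0) (zeroʳ s))))

  Triple : Set
  Triple = Carrier × Carrier × Carrier

  tripleSetoid : Setoid 0ℓ 0ℓ
  tripleSetoid = setoid ×ₛ (setoid ×ₛ setoid)

  open Setoid tripleSetoid public using () renaming (_≈_ to _≈₃_)

  infixl 7 _∙_ _•_

  _∙_ : Triple → Triple → Carrier
  (x , y , z) ∙ (x′ , y′ , z′) = x * x′ + y * y′ + z * z′

  _•_ : Carrier → Triple → Triple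
  t • (x , y , z) = t * x , t * y , t * z

  NonZero : Triple → Set
  NonZero (x , y , z) = x # 0# ⊎ y # 0# ⊎ z # 0#

  _∼_ : Rel Triple 0ℓ
  u ∼ v = ∃[ t ] t # 0# × u ≈₃ t • v

  -- A point is given by homogeneous coordinates, and a line by the coefficients of its equation.

  Point Line : Set
  Point = Σ Triple NonZero
  Line  = Σ Triple NonZero

  _≋_ : Rel (Σ Triple NonZero) 0ℓ
  _≋_ = _∼_ on proj₁

  _∈_ : Point → Line → Set
  P ∈ ℓ = proj₁ P ∙ proj₁ ℓ ≈ 0#

  •-cong : ∀ {t t′ u u′} → t ≈ t′ → u ≈₃ u′ → (t • u) ≈₃ (t′ • u′)
  •-cong t≈t′ (x , y , z) = *-cong t≈t′ x , *-cong t≈t′ y , *-cong t≈t′ z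

  •-assoc : ∀ s t u → ((s * t) • u) ≈₃ (s • (t • u))
  •-assoc s t (x , y , z) = *-assoc s t x , *-assoc s t y , *-assoc s t z

  •-identity : ∀ u → (1# • u) ≈₃ u
  •-identity (x , y , z) = *-identityˡ x , *-identityˡ y , *-identityˡ z

  ∙-cong : ∀ {u u′ v v′} → u ≈₃ u′ → v ≈₃ v′ → u ∙ v ≈ u′ ∙ v′
  ∙-cong (x , y , z) (x′ , y′ , z′) = +-cong (+-cong (*-cong x x′) (*-cong y y′)) (*-cong z z′)

  ∙-comm : ∀ u v → u ∙ v ≈ v ∙ u
  ∙-comm (x , y , z) (x′ , y′ , z′) =
    +-cong (+-cong (*-comm x x′) (*-comm y y′)) (*-comm z z′)

  •-∙ : ∀ t u v → (t • u) ∙ v ≈ t * (u ∙ v)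
  •-∙ t (x , y , z) (x′ , y′ , z′) = solve 7
    (λ t x y z x′ y′ z′ → (t :* x) :* x′ :+ (t :* y) :* y′ :+ (t :* z) :* z′
                        := t :* (x :* x′ :+ y :* y′ :+ z :* z′))
    ≈-refl t x y z x′ y′ z′
    where open FieldSolver

  ∙-• : ∀ t u v → u ∙ (t • v) ≈ t * (u ∙ v)
  ∙-• t u v = ≈-trans (∙-comm u (t • v)) (≈-trans (•-∙ t v u) (*-congˡ (∙-comm v u)))

  ≈₃⇒∼ : ∀ {u v} → u ≈₃ v → u ∼ v
  ≈₃⇒∼ {v = v} u≈v = 1# , 1#0 , T.trans u≈v (T.sym (•-identity v))
    where module T = Setoid tripleSetoid

  ∼-refl : ∀ {u} → u ∼ u
  ∼-refl = ≈₃⇒∼ (Setoid.refl tripleSetoid)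

  ∼-sym : ∀ {u v} → u ∼ v → v ∼ u
  ∼-sym {u} {v} (t , t#0 , u≈tv) = let (s , s#0 , st≈1) = #0⇒inverse t#0 in
    s , s#0 , T.sym (T.trans (•-cong ≈-refl u≈tv)
                    (T.trans (T.sym (•-assoc s t v))
                    (T.trans (•-cong st≈1 T.refl) (•-identity v))))
    where module T = Setoid tripleSetoid

  ∼-trans : ∀ {u v w} → u ∼ v → v ∼ w → u ∼ w
  ∼-trans {w = w} (s , s#0 , u≈sv) (t , t#0 , v≈tw) =
    s * t , x#0y#0→xy#0 s#0 t#0 ,
    T.trans u≈sv (T.trans (•-cong ≈-refl v≈tw) (T.sym (•-assoc s t w)))
    where module T = Setoid tripleSetoid

  _≟₃_ : Decidable _≈₃_
  (x , y , z) ≟₃ (x′ , y′ , z′) = (x ≟ x′) ×-dec ((y ≟ y′) ×-dec (z ≟ z′))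

  _∼?_ : Decidable _∼_
  u ∼? v = Search.∃? setoid elements-complete
    (λ s≈t (s#0 , u≈sv) → #-congʳ s≈t s#0 , T.trans u≈sv (•-cong s≈t T.refl))
    (λ t → (t #? 0#) ×-dec (u ≟₃ (t • v)))
    where module T = Setoid tripleSetoid

  nonZero? : Decidable₁ NonZero
  nonZero? (x , y , z) = (x #? 0#) ⊎-dec ((y #? 0#) ⊎-dec (z #? 0#))

  nonZero-resp : ∀ {u v} → u ≈₃ v → NonZero u → NonZero v
  nonZero-resp (x≈ , _ , _) (inj₁ x#0)        = inj₁ (#-congʳ x≈ x#0)
  nonZero-resp (_ , y≈ , _) (inj₂ (inj₁ y#0)) = inj₂ (inj₁ (#-congʳ y≈ y#0))
  nonZero-resp (_ , _ , z≈) (inj₂ (inj₂ z#0)) = inj₂ (inj₂ (#-congʳ z≈ z#0))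

  ¬nonZero⇒≈0 : ∀ {u} → ¬ NonZero u → u ≈₃ (0# , 0# , 0#)
  ¬nonZero⇒≈0 ¬nz = proj₁ (tight _ _) (¬nz ∘ inj₁) ,
                    proj₁ (tight _ _) (¬nz ∘ inj₂ ∘ inj₁) ,
                    proj₁ (tight _ _) (¬nz ∘ inj₂ ∘ inj₂)

  NonZero⇒≉0 : ∀ {u} → NonZero u → ¬ (u ≈₃ (0# , 0# , 0#))
  NonZero⇒≉0 (inj₁ x#0)        (x≈0 , _ , _) = proj₂ (tight _ _) x≈0 x#0
  NonZero⇒≉0 (inj₂ (inj₁ y#0)) (_ , y≈0 , _) = proj₂ (tight _ _) y≈0 y#0
  NonZero⇒≉0 (inj₂ (inj₂ z#0)) (_ , _ , z≈0) = proj₂ (tight _ _) z≈0 z#0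

  -- Points and lines share their representation, so the following serve for both.

  projectiveSetoid : Setoid 0ℓ 0ℓ
  projectiveSetoid = record
    { Carrier       = Σ Triple NonZero
    ; _≈_           = _≋_
    ; isEquivalence = record { refl = ∼-refl ; sym = ∼-sym ; trans = ∼-trans }
    }

  private module R = Restrict tripleSetoid nonZero-resp nonZero?

  projectives : List (Σ Triple NonZero)
  projectives = R.restrict (cartesianProduct elements (cartesianProduct elements elements))

  projectives-complete : IsEnumeration projectiveSetoid projectives
  projectives-complete P = Any.map ≈₃⇒∼ (R.restrict⁺
    (Enumerates.cartesianProduct⁺ setoid (setoid ×ₛ setoid) elements-complete
      (Enumerates.cartesianProduct⁺ setoid setoid elements-complete elements-complete)) P)

  open Search projectiveSetoid projectives-complete public

  ∈-resp : ∀ {P P′ ℓ ℓ′} → P ≋ P′ → ℓ ≋ ℓ′ → P ∈ ℓ → P′ ∈ ℓ′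
  ∈-resp {P} {P′} {ℓ} {ℓ′} (s , s#0 , P≈sP′) (t , t#0 , ℓ≈tℓ′) P∈ℓ =
    #0-cancelˡ t#0 (#0-cancelˡ s#0 (≈-trans (≈-sym
      (≈-trans (∙-cong P≈sP′ ℓ≈tℓ′)
      (≈-trans (•-∙ s (proj₁ P′) (t • proj₁ ℓ′)) (*-congˡ (∙-• t (proj₁ P′) (proj₁ ℓ′)))))) P∈ℓ))

  -- The conic a x² + b y² + c z² + 2f yz + 2g zx + 2h xy = 0, with invertible Gram matrix.
  -- When q is odd, every ternary quadratic form is of this shape.

  record NonDegenerateConic : Set where
    field
      a b c f g h   : Carrier
      nonDegenerate : a * b * c + f * g * h + f * g * h - a * (f * f) - b * (g * g) - c * (h * h) # 0#

    discriminant : Carrier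
    discriminant = a * b * c + f * g * h + f * g * h - a * (f * f) - b * (g * g) - c * (h * h)

    -- Multiplication by the Gram matrix, so that B(u , v) = u ∙ gram v.
    gram : Triple → Triple
    gram (x , y , z) = a * x + h * y + g * z , h * x + b * y + f * z , g * x + f * y + c * z

    adjugate : Triple → Triple
    adjugate (x , y , z) =
      (b * c - f * f) * x + (f * g - c * h) * y + (f * h - b * g) * z ,
      (f * g - c * h) * x + (a * c - g * g) * y + (g * h - a * f) * z ,
      (f * h - b * g) * x + (g * h - a * f) * y + (a * b - h * h) * z

  module _ (𝓞 : NonDegenerateConic) where
    open NonDegenerateConic 𝓞

    OnConic : Point → Set
    OnConic P = proj₁ P ∙ gram (proj₁ P) ≈ 0#

    IsSecant : Line → Set
    IsSecant ℓ = ∃₂ λ P Q →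
      ¬ (P ≋ Q) × (P ∈ ℓ × OnConic P) × (Q ∈ ℓ × OnConic Q) ×
      (∀ R → R ∈ ℓ × OnConic R → R ≋ P ⊎ R ≋ Q)

    -- The polar line of P = (x , y , z) consists of the points R with B(R , P) = 0, i.e. it has
    -- coefficients gram (x , y , z).
    IsPole : Point → Line → Set
    IsPole P ℓ = gram (proj₁ P) ∼ proj₁ ℓ

    Conjugate : Rel Line 0ℓ
    Conjugate ℓ m = ∃[ P ] IsPole P ℓ × P ∈ m

    gram-cong : ∀ {u v} → u ≈₃ v → gram u ≈₃ gram v
    gram-cong u≈v = ∙-cong r u≈v , ∙-cong r u≈v , ∙-cong r u≈v
      where r = Setoid.refl tripleSetoid

    gram-• : ∀ t u → gram (t • u) ≈₃ (t • gram u)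
    gram-• t u = ∙-• t _ u , ∙-• t _ u , ∙-• t _ u

    gram-∙ : ∀ u v → gram u ∙ v ≈ u ∙ gram v
    gram-∙ (x , y , z) (x′ , y′ , z′) = solve 12
      (λ a b c f g h x y z x′ y′ z′ →
           (a :* x :+ h :* y :+ g :* z) :* x′ :+ (h :* x :+ b :* y :+ f :* z) :* y′
             :+ (g :* x :+ f :* y :+ c :* z) :* z′
        := x :* (a :* x′ :+ h :* y′ :+ g :* z′) :+ y :* (h :* x′ :+ b :* y′ :+ f :* z′)
             :+ z :* (g :* x′ :+ f :* y′ :+ c :* z′))
      ≈-refl a b c f g h x y z x′ y′ z′
      where open FieldSolver

    gram-adjugate : ∀ u → gram (adjugate u) ≈₃ (discriminant • u)
    gram-adjugate (x , y , z) =
      solve 9 (λ a b c f g h x y z →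
          a :* X a b c f g h x y z :+ h :* Y a b c f g h x y z :+ g :* Z a b c f g h x y z
          := Δ a b c f g h :* x) ≈-refl a b c f g h x y z ,
      solve 9 (λ a b c f g h x y z →
          h :* X a b c f g h x y z :+ b :* Y a b c f g h x y z :+ f :* Z a b c f g h x y z
          := Δ a b c f g h :* y) ≈-refl a b c f g h x y z ,
      solve 9 (λ a b c f g h x y z →
          g :* X a b c f g h x y z :+ f :* Y a b c f g h x y z :+ c :* Z a b c f g h x y z
          := Δ a b c f g h :* z) ≈-refl a b c f g h x y z
      where
      open FieldSolver
      X Y Z : ∀ {n} (a b c f g h x y z : Polynomial n) → Polynomial n
      X a b c f g h x y z = (b :* c :- f :* f) :* x :+ (f :* g :- c :* h) :* y :+ (f :* h :- b :* g) :* z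
      Y a b c f g h x y z = (f :* g :- c :* h) :* x :+ (a :* c :- g :* g) :* y :+ (g :* h :- a :* f) :* z
      Z a b c f g h x y z = (f :* h :- b :* g) :* x :+ (g :* h :- a :* f) :* y :+ (a :* b :- h :* h) :* z
      Δ : ∀ {n} (a b c f g h : Polynomial n) → Polynomial n
      Δ a b c f g h = a :* b :* c :+ f :* g :* h :+ f :* g :* h
                      :- a :* (f :* f) :- b :* (g :* g) :- c :* (h :* h)

    onConic-resp : ∀ {P Q} → P ≋ Q → OnConic P → OnConic Q
    onConic-resp {P} {Q} (t , t#0 , P≈tQ) P∈𝓞 = #0-cancelˡ t#0 (#0-cancelˡ t#0
      (≈-trans (≈-sym (≈-trans (∙-cong P≈tQ (T.trans (gram-cong P≈tQ) (gram-• t (proj₁ Q))))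
        (≈-trans (•-∙ t (proj₁ Q) (t • gram (proj₁ Q))) (*-congˡ (∙-• t (proj₁ Q) (gram (proj₁ Q)))))))
      P∈𝓞))
      where module T = Setoid tripleSetoid

    isPole-resp : ∀ {P Q ℓ} → P ≋ Q → IsPole P ℓ → IsPole Q ℓ
    isPole-resp {P} {Q} (t , t#0 , P≈tQ) pole =
      ∼-trans (∼-sym (t , t#0 , T.trans (gram-cong P≈tQ) (gram-• t (proj₁ Q)))) pole
      where module T = Setoid tripleSetoid

    conjugate-sym : Symmetric Conjugate
    conjugate-sym {ℓ} {m} (P , (t , t#0 , MP≈tℓ) , P∈m) = R , R-pole , R∈ℓ
      where
      module T = Setoid tripleSetoid
      r = adjugate (proj₁ m)

      r-nonZero : NonZero r
      r-nonZero = decidable-stable (nonZero? r) λ r≈0 →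
        let dm≈0 = T.trans (T.sym (gram-adjugate (proj₁ m)))
                           (gram-cong (¬nonZero⇒≈0 r≈0))
            z = ∙-zero
        in NonZero⇒≉0 (proj₂ m)
             ( #0-cancelˡ nonDegenerate (≈-trans (proj₁ dm≈0) (z _))
             , #0-cancelˡ nonDegenerate (≈-trans (proj₁ (proj₂ dm≈0)) (z _))
             , #0-cancelˡ nonDegenerate (≈-trans (proj₂ (proj₂ dm≈0)) (z _)))
        where
        ∙-zero : ∀ u → u ∙ (0# , 0# , 0#) ≈ 0#
        ∙-zero (x , y , z) = ≈-trans (+-cong (+-cong (zeroʳ x) (zeroʳ y)) (zeroʳ z))
                                     (≈-trans (+-identityʳ _) (+-identityʳ 0#))

      R : Point
      R = r , r-nonZero

      R-pole : IsPole R m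
      R-pole = discriminant , nonDegenerate , gram-adjugate (proj₁ m)

      R∈ℓ : R ∈ ℓ
      R∈ℓ = #0-cancelˡ t#0 (≈-trans (≈-sym (∙-• t r (proj₁ ℓ)))
        (≈-trans (∙-cong (T.refl {r}) (T.sym MP≈tℓ))
        (≈-trans (≈-sym (gram-∙ r (proj₁ P)))
        (≈-trans (∙-cong (gram-adjugate (proj₁ m)) (T.refl {proj₁ P}))
        (≈-trans (•-∙ discriminant (proj₁ m) (proj₁ P))
        (≈-trans (*-congˡ (≈-trans (∙-comm (proj₁ m) (proj₁ P)) P∈m)) (zeroʳ discriminant)))))))

    isSecant-resp : ∀ {ℓ m} → ℓ ≋ m → IsSecant ℓ → IsSecant m
    isSecant-resp {ℓ} {m} ℓ≋m (P , Q , P≄Q , (P∈ℓ , P∈𝓞) , (Q∈ℓ , Q∈𝓞) , only) =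
      P , Q , P≄Q ,
      (∈-resp {P} {P} {ℓ} {m} ∼-refl ℓ≋m P∈ℓ , P∈𝓞) ,
      (∈-resp {Q} {Q} {ℓ} {m} ∼-refl ℓ≋m Q∈ℓ , Q∈𝓞) ,
      λ R (R∈m , R∈𝓞) → only R (∈-resp {R} {R} {m} {ℓ} ∼-refl (∼-sym ℓ≋m) R∈m , R∈𝓞)

    isSecant? : Decidable₁ IsSecant
    isSecant? ℓ = ∃?
      (λ {P} {P′} P≋P′ (Q , P≄Q , P∈ , Q∈ , only) →
        Q , P≄Q ∘ ∼-trans P≋P′ , on-resp {P} {P′} P≋P′ P∈ , Q∈ ,
        λ R R∈ → Sum.map₁ (λ R≋P → ∼-trans R≋P P≋P′) (only R R∈))
      λ P → ∃?
        (λ {Q} {Q′} Q≋Q′ (P≄Q , P∈ , Q∈ , only) →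
          (λ P≋Q′ → P≄Q (∼-trans P≋Q′ (∼-sym Q≋Q′))) , P∈ , on-resp {Q} {Q′} Q≋Q′ Q∈ ,
          λ R R∈ → Sum.map₂ (λ R≋Q → ∼-trans R≋Q Q≋Q′) (only R R∈))
        λ Q → ¬? (proj₁ P ∼? proj₁ Q) ×-dec (on? P ×-dec (on? Q ×-dec ∀?
          (λ {R} {R′} R≋R′ R→ R′∈ → Sum.map (∼-trans (∼-sym R≋R′)) (∼-trans (∼-sym R≋R′))
            (R→ (on-resp {R′} {R} (∼-sym R≋R′) R′∈)))
          λ R → on? R →-dec ((proj₁ R ∼? proj₁ P) ⊎-dec (proj₁ R ∼? proj₁ Q))))
      where
      on? : Decidable₁ λ P → P ∈ ℓ × OnConic P
      on? P = (_ ≟ _) ×-dec (_ ≟ _)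
      on-resp : ∀ {P Q} → P ≋ Q → P ∈ ℓ × OnConic P → Q ∈ ℓ × OnConic Q
      on-resp {P} {Q} P≋Q (P∈ℓ , P∈𝓞) =
        ∈-resp {P} {Q} {ℓ} {ℓ} P≋Q ∼-refl P∈ℓ , onConic-resp {P} {Q} P≋Q P∈𝓞

    conjugate? : Decidable Conjugate
    conjugate? ℓ m = ∃?
      (λ {P} {Q} P≋Q (pole , P∈m) →
        isPole-resp {P} {Q} {ℓ} P≋Q pole , ∈-resp {P} {Q} {m} {m} P≋Q ∼-refl P∈m)
      λ P → (gram (proj₁ P) ∼? proj₁ ℓ) ×-dec (_ ≟ _)

    SecantLine : Set
    SecantLine = Σ Line IsSecant

    private module S = Restrict projectiveSetoid (λ {ℓ} {m} → isSecant-resp {ℓ} {m}) isSecant?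

    secantDecSetoid : DecSetoid 0ℓ 0ℓ
    secantDecSetoid = record
      { Carrier          = SecantLine
      ; _≈_              = _≋_ on proj₁
      ; isDecEquivalence = record
        { isEquivalence = Setoid.isEquivalence S.restrictedSetoid
        ; _≟_           = λ ℓ m → proj₁ (proj₁ ℓ) ∼? proj₁ (proj₁ m)
        }
      }

    -- Every secant line is listed exactly once up to proportionality.

    secantLines : List SecantLine
    secantLines = deduplicate (DecSetoid._≟_ secantDecSetoid) (S.restrict projectives)

    secantLines-complete : IsEnumeration (DecSetoid.setoid secantDecSetoid) secantLines
    secantLines-complete =
      Enumerates.deduplicate⁺ secantDecSetoid (S.restrict⁺ projectives-complete)

    secantLines-unique : Unique secantDecSetoid secantLines
    secantLines-unique = deduplicate-! secantDecSetoid (S.restrict projectives)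

    secantGraph : Graph
    secantGraph = record
      { order    = length secantLines
      ; _~_      = λ i j → ¬ (line i ≋ line j) × Conjugate (line i) (line j)
      ; _~?_     = λ i j → ¬? (proj₁ (line i) ∼? proj₁ (line j)) ×-dec conjugate? (line i) (line j)
      ; ~-sym    = λ {i} {j} (i≄j , conj) → i≄j ∘ ∼-sym , conjugate-sym {line i} {line j} conj
      ; ~-irrefl = λ { refl (i≄i , _) → i≄i ∼-refl }
      }
      where
      line : Fin (length secantLines) → Line
      line i = proj₁ (lookup secantLines i)

IsOddPrimePower : ℕ → Set
IsOddPrimePower q = (∃₂ λ p n → Prime p × 1 ℕ.≤ n × q ≡ p ℕ.^ n) × 2 ∤ q

{-# OPTIONS --safe #-}
module Submission where

-- For q = 11^(2N+1) the graph Γ of secants has no triangles: a self-polar triangle of secants would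
-- exhibit -1 as a square, but q ≡ 3 (mod 4).  So λ = 0, and CA(0 , 3) = -6 < 0 shows that the CAP bound
-- is at most 2.  The Delsarte bound 1 - k/γ exceeds 2 iff -k < γ < 0.
--
-- For γ < 0, let P be a point of the conic.  The neighbours of a secant ℓ are the secants through its
-- pole, and exactly one of them contains P, unless P ∈ ℓ and the line from the pole to P is tangent.
-- Hence the number of neighbours of ℓ containing P is 1 - [P ∈ ℓ], and for a second point Q the
-- function [P ∈ ℓ] - [Q ∈ ℓ] is an eigenvector for -1.
--
-- For γ > -k, an eigenvector for -k would change sign along each edge at a vertex of maximal modulus,
-- which is impossible if this vertex lies on a pentagon.  Identifying the conic with the projective
-- line so that the given secant becomes {0 , ∞}, adjacent secants are harmonic pairs, and a pentagon
-- of harmonic pairs through {0 , ∞} exists already over the prime field of 11 elements.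
-- Propagating approximate instead of exact values around it yields a gap between -k and γ.

open import Defs
open import Algebra.Apartness.Bundles using (HeytingCommutativeRing; HeytingField)
import Algebra.Apartness.Properties.HeytingCommutativeRing as AP
open import Algebra.Bundles using (CommutativeMonoid; CommutativeRing)
import Algebra.Properties.CommutativeMonoid.Sum as Sum
import Algebra.Properties.Ring as RingProperties
import Algebra.Properties.Semiring.Exp as Exp
import Algebra.Properties.Semiring.Mult as Mult
import Algebra.Properties.Semiring.Sum as SemiringSum
open import Data.Bool.Base using (true; false; if_then_else_)
open import Data.Empty using (⊥; ⊥-elim)
open import Data.Fin.Base using (Fin; zero; suc; punchIn)
open import Data.Fin.Permutation using (Permutation′; permutation; _⟨$⟩ʳ_)
import Data.Fin.Properties as Fin
import Data.Integer.Base as ℤ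
import Data.Integer.Properties as ℤ
open import Data.List.Base using (List; _∷_; lookup; length; filter; tabulate; allFin)
open import Data.List.Membership.Propositional.Properties using (∈-lookup)
open import Data.List.Properties using (filter-none)
import Data.List.Relation.Unary.All as All
open import Data.List.Relation.Unary.AllPairs using (_∷_)
open import Data.List.Relation.Unary.Any as Any using (Any)
import Data.List.Relation.Unary.Any.Properties as Any
open import Data.List.Relation.Unary.Unique.DecSetoid using (Unique)
open import Data.Nat.Base as ℕ using (ℕ; zero; suc; _<_; z≤n; s≤s; _⊔_)
import Data.Nat.Coprimality as ℕ
open import Data.Nat.Divisibility using (_∤_; _∣?_; divides; ∣m+n∣m⇒∣n)
open import Data.Nat.Primality using (prime?)
import Data.Nat.Properties as ℕ
import Data.Nat.Solver as ℕSolver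
open import Data.Product.Base using (∃₂; ∃-syntax; Σ-syntax; _×_; _,_; proj₁; proj₂)
open import Data.Rational.Base as ℚ using (ℚ; mkℚ; 0ℚ; 1ℚ; ½)
import Data.Rational.Properties as ℚ
open import Data.Rational.Solver using (module +-*-Solver)
open import Data.Sum.Base as ⊎ using (_⊎_; inj₁; inj₂)
open import Data.Vec.Functional using (Vector; replicate; removeAt)
open import Function.Base using (_∘_; id)
open import Function.Bundles using (Inverse)
open import Level using (0ℓ)
open import Relation.Binary.Bundles using (Setoid; DecSetoid)
open import Relation.Binary.PropositionalEquality
  using (_≡_; _≢_; refl; sym; trans; cong; cong₂; subst; subst₂; module ≡-Reasoning)
open import Relation.Nullary using (¬_; Dec; yes; no; does; contradiction)
open import Relation.Nullary.Decidable
  using (dec-true; dec-false; decidable-stable; from-yes; from-no; _×-dec_)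
open import Relation.Unary using (Pred) renaming (Decidable to Decidable₁)

module _ (M : CommutativeMonoid 0ℓ 0ℓ) where
  open CommutativeMonoid M
  open Sum M

  sum-supported-at : ∀ {n} (t : Vector Carrier n) i → (∀ j → j ≢ i → t j ≈ ε) → sum t ≈ t i
  sum-supported-at {suc n} t i off = begin
    sum t                          ≈⟨ sum-remove {i = i} t ⟩
    t i ∙ sum (removeAt t i)       ≈⟨ ∙-congˡ (sum-cong-≋ (λ j → off (punchIn i j) (Fin.punchInᵢ≢i i j))) ⟩
    t i ∙ sum (replicate n ε)      ≈⟨ ∙-congˡ (sum-replicate-zero n) ⟩
    t i ∙ ε                        ≈⟨ identityʳ (t i) ⟩
    t i                            ∎
    where open import Relation.Binary.Reasoning.Setoid setoid

-- Finite fields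

module FiniteField (F : HeytingField 0ℓ 0ℓ 0ℓ) {q : ℕ} (∣F∣≡q : HasOrder F q) where
  open PG2 F ∣F∣≡q using (_≟_; _#?_; #0⇒inverse; #0-cancelˡ; module FieldSolver)
  open FieldSolver using (fromℤ; solve; con; _:+_; _:*_; _:-_; _:=_)
  open HeytingField F hiding (zero) renaming (refl to ≈-refl; sym to ≈-sym; trans to ≈-trans)
  open AP (HeytingField.heytingCommutativeRing F) using (1#0)

  commutativeRing : CommutativeRing 0ℓ 0ℓ
  commutativeRing = HeytingCommutativeRing.commutativeRing (HeytingField.heytingCommutativeRing F)

  open CommutativeRing commutativeRing using (ring; semiring; +-commutativeMonoid; *-commutativeMonoid)
  open RingProperties ring using (+-cancelˡ; +-cancelʳ; -1*x≈-x; -‿involutive)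
  open Mult semiring renaming (_×_ to _×ⁿ_) using (×1-homo-*)
  open Exp semiring using (_^_; ^-homo-*; ^-assocʳ)
  open Inverse ∣F∣≡q using (to; from; to-cong; strictlyInverseˡ; strictlyInverseʳ)
  open import Relation.Binary.Reasoning.Setoid setoid

  ≉0⇒#0 : ∀ {x} → ¬ (x ≈ 0#) → x # 0#
  ≉0⇒#0 {x} x≉0 with x #? 0#
  ... | yes x#0 = x#0
  ... | no ¬x#0 = contradiction (proj₁ (tight x 0#) ¬x#0) x≉0

  #0⇒≉0 : ∀ {x} → x # 0# → ¬ (x ≈ 0#)
  #0⇒≉0 {x} x#0 x≈0 = proj₂ (tight x 0#) x≈0 x#0

  1≉0 : ¬ (1# ≈ 0#)
  1≉0 = #0⇒≉0 1#0

  *-≉0 : ∀ {x y} → ¬ (x ≈ 0#) → ¬ (y ≈ 0#) → ¬ (x * y ≈ 0#)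
  *-≉0 x≉0 y≉0 xy≈0 = y≉0 (#0-cancelˡ (≉0⇒#0 x≉0) xy≈0)

  from-injective : ∀ {i j} → from i ≈ from j → i ≡ j
  from-injective {i} {j} fi≈fj = trans (sym (strictlyInverseˡ i)) (trans (to-cong fi≈fj) (strictlyInverseˡ j))

  module _ (f g : Carrier → Carrier) (f-cong : ∀ {x y} → x ≈ y → f x ≈ f y)
           (g-cong : ∀ {x y} → x ≈ y → g x ≈ g y)
           (f∘g : ∀ x → f (g x) ≈ x) (g∘f : ∀ x → g (f x) ≈ x) where

    bijection⇒permutation : Permutation′ q
    bijection⇒permutation = permutation (to ∘ f ∘ from) (to ∘ g ∘ from)
      (λ i → from-injective (begin
        from (to (f (from (to (g (from i)))))) ≈⟨ strictlyInverseʳ _ ⟩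
        f (from (to (g (from i))))             ≈⟨ f-cong (strictlyInverseʳ _) ⟩
        f (g (from i))                         ≈⟨ f∘g _ ⟩
        from i                                 ∎))
      (λ i → from-injective (begin
        from (to (g (from (to (f (from i)))))) ≈⟨ strictlyInverseʳ _ ⟩
        g (from (to (f (from i))))             ≈⟨ g-cong (strictlyInverseʳ _) ⟩
        g (f (from i))                         ≈⟨ g∘f _ ⟩
        from i                                 ∎))

  -- Translation by 1 permutes the field, so it does not change the sum of all elements.
  order-annihilates : q ×ⁿ 1# ≈ 0#
  order-annihilates = +-cancelˡ (sum from) _ _ (begin
    sum from + q ×ⁿ 1#                  ≈⟨ +-congˡ (sum-replicate q) ⟨
    sum from + sum (replicate q 1#)     ≈⟨ ∑-distrib-+ from (replicate q 1#) ⟨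
    sum (λ i → from i + 1#)             ≈⟨ sum-cong-≋ (λ i → ≈-sym (strictlyInverseʳ (from i + 1#))) ⟩
    sum (λ i → from (π ⟨$⟩ʳ i))         ≈⟨ sum-permute from π ⟨
    sum from                            ≈⟨ +-identityʳ _ ⟨
    sum from + 0#                       ∎)
    where
    open Sum +-commutativeMonoid
    π = bijection⇒permutation (_+ 1#) (_- 1#) +-congʳ +-congʳ
      (λ x → ≈-trans (+-assoc x _ _) (≈-trans (+-congˡ (-‿inverseˡ 1#)) (+-identityʳ x)))
      (λ x → ≈-trans (+-assoc x _ _) (≈-trans (+-congˡ (-‿inverseʳ 1#)) (+-identityʳ x)))

  -- If `p ×ⁿ 1#` were nonzero, it could be cancelled from the power one factor at a time, ending in
  -- `1# ≈ 0#`.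
  p^m×1≈0⇒p×1≈0 : ∀ p m → (p ℕ.^ m) ×ⁿ 1# ≈ 0# → p ×ⁿ 1# ≈ 0#
  p^m×1≈0⇒p×1≈0 p zero    1≈0 = contradiction (≈-trans (≈-sym (+-identityʳ 1#)) 1≈0) 1≉0
  p^m×1≈0⇒p×1≈0 p (suc m) pp^m≈0 with (p ×ⁿ 1#) ≟ 0#
  ... | yes p≈0 = p≈0
  ... | no  p≉0 = p^m×1≈0⇒p×1≈0 p m
    (#0-cancelˡ (≉0⇒#0 p≉0) (≈-trans (≈-sym (×1-homo-* p (p ℕ.^ m))) pp^m≈0))

  characteristic : ∀ {p} m → q ≡ p ℕ.^ m → fromℤ (ℤ.+ p) ≈ 0#
  characteristic {p} m refl = p^m×1≈0⇒p×1≈0 p m order-annihilates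

  -- Fermat's little theorem

  module _ where
    open Sum *-commutativeMonoid renaming (sum to ∏; sum-permute to ∏-permute; sum-cong-≋ to ∏-cong;
      ∑-distrib-+ to ∏-distrib-*; sum-replicate to ∏-replicate)

    -- Changing the values at 0 restricts products over the whole field to its nonzero elements.
    at-0 : (c : Carrier) (f : Carrier → Carrier) → Carrier → Carrier
    at-0 c f x with x ≟ 0#
    ... | yes _ = c
    ... | no  _ = f x

    at-0-≈0 : ∀ c f {x} → x ≈ 0# → at-0 c f x ≈ c
    at-0-≈0 c f {x} x≈0 with x ≟ 0#
    ... | yes _   = ≈-refl
    ... | no  x≉0 = contradiction x≈0 x≉0

    at-0-≉0 : ∀ c f {x} → ¬ (x ≈ 0#) → at-0 c f x ≈ f x
    at-0-≉0 c f {x} x≉0 with x ≟ 0#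
    ... | yes x≈0 = contradiction x≈0 x≉0
    ... | no  _   = ≈-refl

    ∏-≉0 : ∀ {n} (t : Vector Carrier n) → (∀ i → ¬ (t i ≈ 0#)) → ¬ (∏ t ≈ 0#)
    ∏-≉0 {zero}  t t≉0 = 1≉0
    ∏-≉0 {suc n} t t≉0 = *-≉0 (t≉0 zero) (∏-≉0 (t ∘ suc) (t≉0 ∘ suc))

    *-cancelˡ-≉0 : ∀ {x y z} → ¬ (x ≈ 0#) → x * y ≈ x * z → y ≈ z
    *-cancelˡ-≉0 {x} {y} {z} x≉0 xy≈xz = let (w , _ , wx≈1) = #0⇒inverse (≉0⇒#0 x≉0) in begin
      y            ≈⟨ *-identityˡ y ⟨
      1# * y       ≈⟨ *-congʳ wx≈1 ⟨
      w * x * y    ≈⟨ *-assoc w x y ⟩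
      w * (x * y)  ≈⟨ *-congˡ xy≈xz ⟩
      w * (x * z)  ≈⟨ *-assoc w x z ⟨
      w * x * z    ≈⟨ *-congʳ wx≈1 ⟩
      1# * z       ≈⟨ *-identityˡ z ⟩
      z            ∎

    -- Multiplication by a permutes the nonzero elements, so the product of (q - 1) copies of a is 1.
    fermat : ∀ {a} → ¬ (a ≈ 0#) → a ^ q ≈ a
    fermat {a} a≉0 = begin
      a ^ q                                            ≈⟨ ∏-replicate q ⟨
      ∏ (replicate q a)                                ≈⟨ ∏-cong (λ i → split (from i)) ⟩
      ∏ (λ i → scale (from i) * at-zero (from i))      ≈⟨ ∏-distrib-* (scale ∘ from) (at-zero ∘ from) ⟩
      ∏ (scale ∘ from) * ∏ (at-zero ∘ from)            ≈⟨ *-cong ∏scale≈1 ∏at-zero≈a ⟩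
      1# * a                                           ≈⟨ *-identityˡ a ⟩
      a                                                ∎
      where
      -- The constant `a` is split pointwise: `scale` carries it at the nonzero elements and
      -- `at-zero` at 0. The first product is 1 and the second is `a`, which accounts for the
      -- exponent `q` instead of `q - 1`.
      unit scale at-zero : Carrier → Carrier
      unit    = at-0 1# (λ x → x)
      scale   = at-0 1# (λ _ → a)
      at-zero = at-0 a (λ _ → 1#)

      split : ∀ x → a ≈ scale x * at-zero x
      split x with x ≟ 0#
      ... | yes _ = ≈-sym (*-identityˡ a)
      ... | no  _ = ≈-sym (*-identityʳ a)

      ∏at-zero≈a : ∏ (at-zero ∘ from) ≈ a
      ∏at-zero≈a = begin
        ∏ (at-zero ∘ from)     ≈⟨ sum-supported-at *-commutativeMonoid (at-zero ∘ from) (to 0#)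
                                    (λ j j≢0 → at-0-≉0 _ _ (λ j≈0 → j≢0 (from-injective
                                      (≈-trans j≈0 (≈-sym (strictlyInverseʳ 0#)))))) ⟩
        at-zero (from (to 0#)) ≈⟨ at-0-≈0 _ _ (strictlyInverseʳ 0#) ⟩
        a                      ∎

      a⁻¹ = proj₁ (#0⇒inverse (≉0⇒#0 a≉0))
      a⁻¹a≈1 : a⁻¹ * a ≈ 1#
      a⁻¹a≈1 = proj₂ (proj₂ (#0⇒inverse (≉0⇒#0 a≉0)))

      π = bijection⇒permutation (a *_) (a⁻¹ *_) *-congˡ *-congˡ
        (λ x → ≈-trans (≈-sym (*-assoc a a⁻¹ x))
                 (≈-trans (*-congʳ (≈-trans (*-comm a a⁻¹) a⁻¹a≈1)) (*-identityˡ x)))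
        (λ x → ≈-trans (≈-sym (*-assoc a⁻¹ a x)) (≈-trans (*-congʳ a⁻¹a≈1) (*-identityˡ x)))

      unit≉0 : ∀ x → ¬ (unit x ≈ 0#)
      unit≉0 x with x ≟ 0#
      ... | yes _   = 1≉0
      ... | no  x≉0 = x≉0

      scale-unit : ∀ i → unit (from (π ⟨$⟩ʳ i)) ≈ unit (from i) * scale (from i)
      scale-unit i with from i ≟ 0#
      ... | yes i≈0 = ≈-trans
        (at-0-≈0 _ _ (≈-trans (strictlyInverseʳ _) (≈-trans (*-congˡ i≈0) (zeroʳ a))))
        (≈-sym (*-identityˡ 1#))
      ... | no  i≉0 = ≈-trans
        (at-0-≉0 _ _ (λ ai≈0 → *-≉0 a≉0 i≉0 (≈-trans (≈-sym (strictlyInverseʳ _)) ai≈0)))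
        (≈-trans (strictlyInverseʳ _) (*-comm a (from i)))

      ∏scale≈1 : ∏ (scale ∘ from) ≈ 1#
      ∏scale≈1 = *-cancelˡ-≉0 (∏-≉0 (unit ∘ from) (unit≉0 ∘ from)) (begin
        ∏ (unit ∘ from) * ∏ (scale ∘ from)            ≈⟨ ∏-distrib-* (unit ∘ from) (scale ∘ from) ⟨
        ∏ (λ i → unit (from i) * scale (from i))      ≈⟨ ∏-cong scale-unit ⟨
        ∏ (λ i → unit (from (π ⟨$⟩ʳ i)))              ≈⟨ ∏-permute (unit ∘ from) π ⟨
        ∏ (unit ∘ from)                               ≈⟨ *-identityʳ _ ⟨
        ∏ (unit ∘ from) * 1#                          ∎)

  module _ (2≉0 : ¬ (fromℤ (ℤ.+ 2) ≈ 0#)) {m : ℕ} (q≡4m+3 : q ≡ 4 ℕ.* m ℕ.+ 3) where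

    -- A square root i of -1 would satisfy i = i^q = i³ = - i by Fermat's little theorem.
    -1-nonsquare : ∀ i → ¬ (i * i + 1# ≈ 0#)
    -1-nonsquare i i²+1≈0 = *-≉0 2≉0 i≉0 (begin
      fromℤ (ℤ.+ 2) * i    ≈⟨ solve 1 (λ i → con (ℤ.+ 2) :* i := i :+ i) ≈-refl i ⟩
      i + i                ≈⟨ +-congʳ i³≈i ⟨
      i * (i * i) + i      ≈⟨ +-congˡ (*-identityʳ i) ⟨
      i * (i * i) + i * 1# ≈⟨ distribˡ i (i * i) 1# ⟨
      i * (i * i + 1#)     ≈⟨ *-congˡ i²+1≈0 ⟩
      i * 0#               ≈⟨ zeroʳ i ⟩
      0#                   ∎)
      where
      i≉0 : ¬ (i ≈ 0#)
      i≉0 i≈0 = 1≉0 (begin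
        1#            ≈⟨ +-identityˡ 1# ⟨
        0# + 1#       ≈⟨ +-congʳ (≈-trans (*-congˡ i≈0) (zeroʳ i)) ⟨
        i * i + 1#    ≈⟨ i²+1≈0 ⟩
        0#            ∎)

      i²≈-1 : i * i ≈ - 1#
      i²≈-1 = +-cancelʳ 1# _ _ (≈-trans i²+1≈0 (≈-sym (-‿inverseˡ 1#)))

      i⁴≈1 : i ^ 4 ≈ 1#
      i⁴≈1 = begin
        i * (i * (i * (i * 1#)))  ≈⟨ *-congˡ (*-congˡ (*-congˡ (*-identityʳ i))) ⟩
        i * (i * (i * i))         ≈⟨ *-assoc i i (i * i) ⟨
        i * i * (i * i)           ≈⟨ *-cong i²≈-1 i²≈-1 ⟩
        - 1# * - 1#               ≈⟨ -1*x≈-x (- 1#) ⟩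
        - - 1#                    ≈⟨ -‿involutive 1# ⟩
        1#                        ∎

      [i⁴]ⁿ≈1 : ∀ n → (i ^ 4) ^ n ≈ 1#
      [i⁴]ⁿ≈1 zero    = ≈-refl
      [i⁴]ⁿ≈1 (suc n) = ≈-trans (*-cong i⁴≈1 ([i⁴]ⁿ≈1 n)) (*-identityˡ 1#)

      i³≈i : i * (i * i) ≈ i
      i³≈i = begin
        i * (i * i)             ≈⟨ *-congˡ (*-congˡ (*-identityʳ i)) ⟨
        i ^ 3                   ≈⟨ *-identityˡ (i ^ 3) ⟨
        1# * i ^ 3              ≈⟨ *-congʳ ([i⁴]ⁿ≈1 m) ⟨
        (i ^ 4) ^ m * i ^ 3     ≈⟨ *-congʳ (^-assocʳ i 4 m) ⟩
        i ^ (4 ℕ.* m) * i ^ 3   ≈⟨ ^-homo-* i (4 ℕ.* m) 3 ⟨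
        i ^ (4 ℕ.* m ℕ.+ 3)     ≡⟨ cong (i ^_) q≡4m+3 ⟨
        i ^ q                   ≈⟨ fermat i≉0 ⟩
        i                       ∎

    -- For nonzero `y` the quotient of `x` by `y` would be a square root of -1.
    anisotropic : ∀ x y → x * x + y * y ≈ 0# → y ≈ 0#
    anisotropic x y x²+y²≈0 with y ≟ 0#
    ... | yes y≈0 = y≈0
    ... | no  y≉0 = let (w , _ , wy≈1) = #0⇒inverse (≉0⇒#0 y≉0) in
      contradiction (begin
        x * w * (x * w) + 1#
          -- The unit is passed as the variable `o`, because the solver's constant 1 denotes
          -- `fromℤ (ℤ.+ 1)`, that is `1# + 0#`.
          ≈⟨ solve 4 (λ x y w o → x :* w :* (x :* w) :+ o
                      := w :* w :* (x :* x :+ y :* y) :+ (o :- w :* y :* (w :* y))) ≈-refl x y w 1# ⟩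
        w * w * (x * x + y * y) + (1# - w * y * (w * y))
          ≈⟨ +-cong (≈-trans (*-congˡ x²+y²≈0) (zeroʳ _))
                    (+-congˡ (-‿cong (≈-trans (*-cong wy≈1 wy≈1) (*-identityˡ 1#)))) ⟩
        0# + (1# - 1#)
          ≈⟨ ≈-trans (+-identityˡ _) (-‿inverseʳ 1#) ⟩
        0# ∎) (-1-nonsquare (x * w))

-- Conics over a finite field of odd characteristic

module Conic (F : HeytingField 0ℓ 0ℓ 0ℓ) {q : ℕ} (∣F∣≡q : HasOrder F q)
             (𝓞 : PG2.NonDegenerateConic F ∣F∣≡q) where
  open PG2 F ∣F∣≡q
  open NonDegenerateConic 𝓞 using (gram; adjugate; discriminant; nonDegenerate)
  open HeytingField F hiding (zero) renaming (refl to ≈-refl; sym to ≈-sym; trans to ≈-trans)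
  open FiniteField F ∣F∣≡q using (commutativeRing; ≉0⇒#0; #0⇒≉0; 1≉0; *-≉0)
  open CommutativeRing commutativeRing using (ring)
  open RingProperties ring using (-0#≈0#; -‿involutive; x∙y⁻¹≈ε⇒x≈y)
  open FieldSolver
  open import Relation.Binary.Reasoning.Setoid setoid
  private module T = Setoid tripleSetoid

  -- Cross products of coordinate triples

  0₃ : Triple
  0₃ = 0# , 0# , 0#

  infixl 7 _⨯_
  _⨯_ : Triple → Triple → Triple
  (x , y , z) ⨯ (x′ , y′ , z′) = y * z′ - z * y′ , z * x′ - x * z′ , x * y′ - y * x′

  -- The bilinear forms of the conic and of its dual: two lines are conjugate iff D vanishes on them.
  B D : Triple → Triple → Carrier
  B u v = u ∙ gram v
  D ℓ m = ℓ ∙ adjugate m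

  ∙-zeroʳ : ∀ u → u ∙ 0₃ ≈ 0#
  ∙-zeroʳ (x , y , z) = begin
    x * 0# + y * 0# + z * 0# ≈⟨ +-cong (+-cong (zeroʳ x) (zeroʳ y)) (zeroʳ z) ⟩
    0# + 0# + 0#             ≈⟨ ≈-trans (+-identityʳ _) (+-identityʳ 0#) ⟩
    0#                       ∎

  ∙-zeroˡ : ∀ u → 0₃ ∙ u ≈ 0#
  ∙-zeroˡ u = ≈-trans (∙-comm 0₃ u) (∙-zeroʳ u)

  ∙≉0⇒nonZero : ∀ {u v} → ¬ (u ∙ v ≈ 0#) → NonZero u
  ∙≉0⇒nonZero {u} {v} uv≉0 = decidable-stable (nonZero? u) λ u≈0 →
    uv≉0 (≈-trans (∙-cong (¬nonZero⇒≈0 u≈0) (T.refl {v})) (∙-zeroˡ v))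

  ⨯-orthogonalˡ : ∀ u v → u ∙ (u ⨯ v) ≈ 0#
  ⨯-orthogonalˡ (x , y , z) (x′ , y′ , z′) = solve 6 (λ x y z x′ y′ z′ →
    x :* (y :* z′ :- z :* y′) :+ y :* (z :* x′ :- x :* z′) :+ z :* (x :* y′ :- y :* x′) := con (ℤ.+ 0))
    ≈-refl x y z x′ y′ z′

  ⨯-orthogonalʳ : ∀ u v → v ∙ (u ⨯ v) ≈ 0#
  ⨯-orthogonalʳ (x , y , z) (x′ , y′ , z′) = solve 6 (λ x y z x′ y′ z′ →
    x′ :* (y :* z′ :- z :* y′) :+ y′ :* (z :* x′ :- x :* z′) :+ z′ :* (x :* y′ :- y :* x′) := con (ℤ.+ 0))
    ≈-refl x y z x′ y′ z′

  binet-cauchy : ∀ a b u v → (a ⨯ b) ∙ (u ⨯ v) ≈ (a ∙ u) * (b ∙ v) - (a ∙ v) * (b ∙ u)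
  binet-cauchy (a₁ , a₂ , a₃) (b₁ , b₂ , b₃) (u₁ , u₂ , u₃) (v₁ , v₂ , v₃) =
    solve 12 (λ a₁ a₂ a₃ b₁ b₂ b₃ u₁ u₂ u₃ v₁ v₂ v₃ →
      (a₂ :* b₃ :- a₃ :* b₂) :* (u₂ :* v₃ :- u₃ :* v₂)
        :+ (a₃ :* b₁ :- a₁ :* b₃) :* (u₃ :* v₁ :- u₁ :* v₃)
        :+ (a₁ :* b₂ :- a₂ :* b₁) :* (u₁ :* v₂ :- u₂ :* v₁)
      := (a₁ :* u₁ :+ a₂ :* u₂ :+ a₃ :* u₃) :* (b₁ :* v₁ :+ b₂ :* v₂ :+ b₃ :* v₃)
        :- (a₁ :* v₁ :+ a₂ :* v₂ :+ a₃ :* v₃) :* (b₁ :* u₁ :+ b₂ :* u₂ :+ b₃ :* u₃))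
    ≈-refl a₁ a₂ a₃ b₁ b₂ b₃ u₁ u₂ u₃ v₁ v₂ v₃

  -- The vanishing minors say that all coordinates have the same ratio; it is computed at whichever
  -- coordinate of `u` is invertible.
  ⨯≈0⇒multiple : ∀ {u v} → NonZero u → (u ⨯ v) ≈₃ 0₃ → ∃[ t ] v ≈₃ (t • u)
  ⨯≈0⇒multiple {u} {v} nonZero (yz≈zy , zx≈xz , xy≈yx) = go nonZero
    where
    x  = proj₁ u ; y  = proj₁ (proj₂ u) ; z  = proj₂ (proj₂ u)
    x′ = proj₁ v ; y′ = proj₁ (proj₂ v) ; z′ = proj₂ (proj₂ v)

    divide : ∀ {s k a b c} → s * k ≈ 1# → k * b ≈ a * c → b ≈ s * c * a
    divide {s} {k} {a} {b} {c} sk≈1 kb≈ac = begin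
      b            ≈⟨ *-identityˡ b ⟨
      1# * b       ≈⟨ *-congʳ sk≈1 ⟨
      s * k * b    ≈⟨ *-assoc s k b ⟩
      s * (k * b)  ≈⟨ *-congˡ (≈-trans kb≈ac (*-comm a c)) ⟩
      s * (c * a)  ≈⟨ *-assoc s c a ⟨
      s * c * a    ∎

    equal : ∀ {a b} → a - b ≈ 0# → a ≈ b
    equal = x∙y⁻¹≈ε⇒x≈y _ _

    go : NonZero u → ∃[ t ] v ≈₃ (t • u)
    go (inj₁ x#0) = let (s , _ , sx≈1) = #0⇒inverse x#0 in s * x′ ,
      divide sx≈1 ≈-refl , divide sx≈1 (equal xy≈yx) , divide sx≈1 (≈-sym (equal zx≈xz))
    go (inj₂ (inj₁ y#0)) = let (s , _ , sy≈1) = #0⇒inverse y#0 in s * y′ ,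
      divide sy≈1 (≈-sym (equal xy≈yx)) , divide sy≈1 ≈-refl , divide sy≈1 (equal yz≈zy)
    go (inj₂ (inj₂ z#0)) = let (s , _ , sz≈1) = #0⇒inverse z#0 in s * z′ ,
      divide sz≈1 (equal zx≈xz) , divide sz≈1 (≈-sym (equal yz≈zy)) , divide sz≈1 ≈-refl

  multiple⇒∼ : ∀ {u v t} → NonZero u → u ≈₃ (t • v) → u ∼ v
  multiple⇒∼ {u} {v} {t} nonZero u≈tv = t , ≉0⇒#0 (λ t≈0 → NonZero⇒≉0 nonZero
    (T.trans u≈tv (T.trans (•-cong t≈0 T.refl) (zeroˡ _ , zeroˡ _ , zeroˡ _)))) , u≈tv

  ¬∼⇒⨯-nonZero : ∀ {u v} → NonZero u → NonZero v → ¬ (u ∼ v) → NonZero (u ⨯ v)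
  ¬∼⇒⨯-nonZero {u} {v} u≉0 v≉0 u≁v = decidable-stable (nonZero? (u ⨯ v)) λ uv≈0 →
    u≁v (∼-sym (multiple⇒∼ v≉0 (proj₂ (⨯≈0⇒multiple u≉0 (¬nonZero⇒≈0 uv≈0)))))

  ⨯-cong : ∀ {u u′ v v′} → u ≈₃ u′ → v ≈₃ v′ → (u ⨯ v) ≈₃ (u′ ⨯ v′)
  ⨯-cong (x , y , z) (x′ , y′ , z′) =
    +-cong (*-cong y z′) (-‿cong (*-cong z y′)) ,
    +-cong (*-cong z x′) (-‿cong (*-cong x z′)) ,
    +-cong (*-cong x y′) (-‿cong (*-cong y x′))

  ⨯-multiples : ∀ s t u → ((s • u) ⨯ (t • u)) ≈₃ 0₃
  ⨯-multiples s t (x , y , z) = law y z , law z x , law x y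
    where
    law : ∀ y z → (s * y) * (t * z) - (s * z) * (t * y) ≈ 0#
    law y z = solve 4 (λ s t y z → (s :* y) :* (t :* z) :- (s :* z) :* (t :* y) := con (ℤ.+ 0))
      ≈-refl s t y z

  -- By the triple product expansion, `(v ⨯ w) ⨯ u` is `w` times `u ∙ v` minus `v` times `u ∙ w`.
  orthogonal⇒⨯≈0 : ∀ {u v w} → u ∙ v ≈ 0# → u ∙ w ≈ 0# → ((v ⨯ w) ⨯ u) ≈₃ 0₃
  orthogonal⇒⨯≈0 {u₁ , u₂ , u₃} {v₁ , v₂ , v₃} {w₁ , w₂ , w₃} uv≈0 uw≈0 =
    law (solve 9 (λ u₁ u₂ u₃ v₁ v₂ v₃ w₁ w₂ w₃ →
      (v₃ :* w₁ :- v₁ :* w₃) :* u₃ :- (v₁ :* w₂ :- v₂ :* w₁) :* u₂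
      := w₁ :* (u₁ :* v₁ :+ u₂ :* v₂ :+ u₃ :* v₃) :- v₁ :* (u₁ :* w₁ :+ u₂ :* w₂ :+ u₃ :* w₃))
      ≈-refl u₁ u₂ u₃ v₁ v₂ v₃ w₁ w₂ w₃) ,
    law (solve 9 (λ u₁ u₂ u₃ v₁ v₂ v₃ w₁ w₂ w₃ →
      (v₁ :* w₂ :- v₂ :* w₁) :* u₁ :- (v₂ :* w₃ :- v₃ :* w₂) :* u₃
      := w₂ :* (u₁ :* v₁ :+ u₂ :* v₂ :+ u₃ :* v₃) :- v₂ :* (u₁ :* w₁ :+ u₂ :* w₂ :+ u₃ :* w₃))
      ≈-refl u₁ u₂ u₃ v₁ v₂ v₃ w₁ w₂ w₃) ,
    law (solve 9 (λ u₁ u₂ u₃ v₁ v₂ v₃ w₁ w₂ w₃ →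
      (v₂ :* w₃ :- v₃ :* w₂) :* u₂ :- (v₃ :* w₁ :- v₁ :* w₃) :* u₁
      := w₃ :* (u₁ :* v₁ :+ u₂ :* v₂ :+ u₃ :* v₃) :- v₃ :* (u₁ :* w₁ :+ u₂ :* w₂ :+ u₃ :* w₃))
      ≈-refl u₁ u₂ u₃ v₁ v₂ v₃ w₁ w₂ w₃)
    where
    law : ∀ {x a b} → x ≈ a * ((u₁ * v₁) + (u₂ * v₂) + (u₃ * v₃)) - b * ((u₁ * w₁) + (u₂ * w₂) + (u₃ * w₃)) → x ≈ 0#
    law {x} {a} {b} eq = begin
      x                                           ≈⟨ eq ⟩
      a * (u₁ * v₁ + u₂ * v₂ + u₃ * v₃) - b * (u₁ * w₁ + u₂ * w₂ + u₃ * w₃)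
                                                  ≈⟨ +-cong (*-congˡ uv≈0) (-‿cong (*-congˡ uw≈0)) ⟩
      a * 0# - b * 0#
        ≈⟨ solve 2 (λ a b → a :* con (ℤ.+ 0) :- b :* con (ℤ.+ 0) := con (ℤ.+ 0)) ≈-refl a b ⟩
      0#                                          ∎

  ⨯-anticomm≈0 : ∀ {u v} → (u ⨯ v) ≈₃ 0₃ → (v ⨯ u) ≈₃ 0₃
  ⨯-anticomm≈0 (x≈0 , y≈0 , z≈0) = law x≈0 , law y≈0 , law z≈0
    where
    law : ∀ {a b c d} → a * b - c * d ≈ 0# → d * c - b * a ≈ 0#
    law {a} {b} {c} {d} eq = begin
      d * c - b * a
        ≈⟨ solve 4 (λ a b c d → d :* c :- b :* a := :- (a :* b :- c :* d)) ≈-refl a b c d ⟩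
      - (a * b - c * d)    ≈⟨ -‿cong eq ⟩
      - 0#                 ≈⟨ -0#≈0# ⟩
      0#                   ∎

  orthogonal⇒multiple : ∀ {u v w} → NonZero (v ⨯ w) → u ∙ v ≈ 0# → u ∙ w ≈ 0# → ∃[ t ] u ≈₃ (t • (v ⨯ w))
  orthogonal⇒multiple vw≉0 uv≈0 uw≈0 = ⨯≈0⇒multiple vw≉0 (orthogonal⇒⨯≈0 uv≈0 uw≈0)

  -- The variant of `orthogonal⇒multiple` for a nonzero `u`; here `v ⨯ w`, and with it the scalar,
  -- may vanish.
  ⨯-multiple-of-orthogonal : ∀ {u v w} → NonZero u → u ∙ v ≈ 0# → u ∙ w ≈ 0# → ∃[ t ] (v ⨯ w) ≈₃ (t • u)
  ⨯-multiple-of-orthogonal {u} {v} {w} u≉0 uv≈0 uw≈0 =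
    ⨯≈0⇒multiple u≉0 (⨯-anticomm≈0 {v ⨯ w} {u} (orthogonal⇒⨯≈0 {u} {v} {w} uv≈0 uw≈0))

  -- The cofactor identity: the cofactor matrix maps a cross product to the cross product of the
  -- images, and for the symmetric Gram matrix it coincides with the adjugate.
  adjugate-⨯ : ∀ u v → adjugate (u ⨯ v) ≈₃ (gram u ⨯ gram v)
  adjugate-⨯ (x , y , z) (x′ , y′ , z′) =
    solve 12 (λ a b c f g h x y z x′ y′ z′ →
      let X = y :* z′ :- z :* y′ ; Y = z :* x′ :- x :* z′ ; Z = x :* y′ :- y :* x′ in
      (b :* c :- f :* f) :* X :+ (f :* g :- c :* h) :* Y :+ (f :* h :- b :* g) :* Z
      := (h :* x :+ b :* y :+ f :* z) :* (g :* x′ :+ f :* y′ :+ c :* z′)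
         :- (g :* x :+ f :* y :+ c :* z) :* (h :* x′ :+ b :* y′ :+ f :* z′))
      ≈-refl a b c f g h x y z x′ y′ z′ ,
    solve 12 (λ a b c f g h x y z x′ y′ z′ →
      let X = y :* z′ :- z :* y′ ; Y = z :* x′ :- x :* z′ ; Z = x :* y′ :- y :* x′ in
      (f :* g :- c :* h) :* X :+ (a :* c :- g :* g) :* Y :+ (g :* h :- a :* f) :* Z
      := (g :* x :+ f :* y :+ c :* z) :* (a :* x′ :+ h :* y′ :+ g :* z′)
         :- (a :* x :+ h :* y :+ g :* z) :* (g :* x′ :+ f :* y′ :+ c :* z′))
      ≈-refl a b c f g h x y z x′ y′ z′ ,
    solve 12 (λ a b c f g h x y z x′ y′ z′ →
      let X = y :* z′ :- z :* y′ ; Y = z :* x′ :- x :* z′ ; Z = x :* y′ :- y :* x′ in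
      (f :* h :- b :* g) :* X :+ (g :* h :- a :* f) :* Y :+ (a :* b :- h :* h) :* Z
      := (a :* x :+ h :* y :+ g :* z) :* (h :* x′ :+ b :* y′ :+ f :* z′)
         :- (h :* x :+ b :* y :+ f :* z) :* (a :* x′ :+ h :* y′ :+ g :* z′))
      ≈-refl a b c f g h x y z x′ y′ z′
    where open NonDegenerateConic 𝓞 using (a; b; c; f; g; h)

  adjugate-gram : ∀ u → adjugate (gram u) ≈₃ (discriminant • u)
  adjugate-gram (x , y , z) =
    solve 9 (λ a b c f g h x y z →
      let X = a :* x :+ h :* y :+ g :* z ; Y = h :* x :+ b :* y :+ f :* z ; Z = g :* x :+ f :* y :+ c :* z in
      (b :* c :- f :* f) :* X :+ (f :* g :- c :* h) :* Y :+ (f :* h :- b :* g) :* Z := Δ a b c f g h :* x)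
      ≈-refl a b c f g h x y z ,
    solve 9 (λ a b c f g h x y z →
      let X = a :* x :+ h :* y :+ g :* z ; Y = h :* x :+ b :* y :+ f :* z ; Z = g :* x :+ f :* y :+ c :* z in
      (f :* g :- c :* h) :* X :+ (a :* c :- g :* g) :* Y :+ (g :* h :- a :* f) :* Z := Δ a b c f g h :* y)
      ≈-refl a b c f g h x y z ,
    solve 9 (λ a b c f g h x y z →
      let X = a :* x :+ h :* y :+ g :* z ; Y = h :* x :+ b :* y :+ f :* z ; Z = g :* x :+ f :* y :+ c :* z in
      (f :* h :- b :* g) :* X :+ (g :* h :- a :* f) :* Y :+ (a :* b :- h :* h) :* Z := Δ a b c f g h :* z)
      ≈-refl a b c f g h x y z
    where
    open NonDegenerateConic 𝓞 using (a; b; c; f; g; h)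
    Δ : ∀ {n} (a b c f g h : Polynomial n) → Polynomial n
    Δ a b c f g h = a :* b :* c :+ f :* g :* h :+ f :* g :* h
                    :- a :* (f :* f) :- b :* (g :* g) :- c :* (h :* h)

  B-comm : ∀ u v → B u v ≈ B v u
  B-comm u v = ≈-trans (≈-sym (gram-∙ 𝓞 u v)) (∙-comm (gram u) v)

  -- This reduces computations with joins to values of `B` on points: `adjugate-⨯` leaves an inner
  -- product of two cross products, which `binet-cauchy` expands.
  D-⨯ : ∀ a b c d → D (a ⨯ b) (c ⨯ d) ≈ B a c * B b d - B a d * B b c
  D-⨯ a b c d = ≈-trans (∙-cong (T.refl {a ⨯ b}) (adjugate-⨯ c d)) (binet-cauchy a b (gram c) (gram d))

  B-adjugate : ∀ ℓ m → B (adjugate ℓ) (adjugate m) ≈ discriminant * D m ℓ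
  B-adjugate ℓ m = begin
    adjugate ℓ ∙ gram (adjugate m)   ≈⟨ ∙-cong (T.refl {adjugate ℓ}) (gram-adjugate 𝓞 m) ⟩
    adjugate ℓ ∙ (discriminant • m)   ≈⟨ ∙-• discriminant (adjugate ℓ) m ⟩
    discriminant * (adjugate ℓ ∙ m)  ≈⟨ *-congˡ (∙-comm (adjugate ℓ) m) ⟩
    discriminant * D m ℓ             ∎

  adjugate-cong : ∀ {u v} → u ≈₃ v → adjugate u ≈₃ adjugate v
  adjugate-cong u≈v = ∙-cong r u≈v , ∙-cong r u≈v , ∙-cong r u≈v
    where r = T.refl

  adjugate-• : ∀ t u → adjugate (t • u) ≈₃ (t • adjugate u)
  adjugate-• t u = ∙-• t _ u , ∙-• t _ u , ∙-• t _ u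

  D-cong : ∀ {u u′ v v′} → u ≈₃ u′ → v ≈₃ v′ → D u v ≈ D u′ v′
  D-cong u≈u′ v≈v′ = ∙-cong u≈u′ (adjugate-cong v≈v′)

  D-• : ∀ s t u v → D (s • u) (t • v) ≈ s * t * D u v
  D-• s t u v = begin
    (s • u) ∙ adjugate (t • v)    ≈⟨ ∙-cong (T.refl {s • u}) (adjugate-• t v) ⟩
    (s • u) ∙ (t • adjugate v)    ≈⟨ •-∙ s u (t • adjugate v) ⟩
    s * (u ∙ (t • adjugate v))    ≈⟨ *-congˡ (∙-• t u (adjugate v)) ⟩
    s * (t * D u v)               ≈⟨ *-assoc s t (D u v) ⟨
    s * t * D u v                 ∎

  D-resp-≈0 : ∀ {u u′ v v′} → u ∼ u′ → v ∼ v′ → D u′ v′ ≈ 0# → D u v ≈ 0#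
  D-resp-≈0 {u} {u′} {v} {v′} (s , _ , u≈su′) (t , _ , v≈tv′) D≈0 = begin
    D u v              ≈⟨ D-cong u≈su′ v≈tv′ ⟩
    D (s • u′) (t • v′) ≈⟨ D-• s t u′ v′ ⟩
    s * t * D u′ v′    ≈⟨ *-congˡ D≈0 ⟩
    s * t * 0#         ≈⟨ zeroʳ (s * t) ⟩
    0#                 ∎

  Δ≉0 : ¬ (discriminant ≈ 0#)
  Δ≉0 = #0⇒≉0 nonDegenerate

  D-comm : ∀ u v → D u v ≈ D v u
  -- Only the symmetry of the adjugate matrix matters, so its six entries enter as variables.
  D-comm (x , y , z) (x′ , y′ , z′) = solve 12 (λ A B C F G H x y z x′ y′ z′ →
    x :* (A :* x′ :+ H :* y′ :+ G :* z′) :+ y :* (H :* x′ :+ B :* y′ :+ F :* z′) :+ z :* (G :* x′ :+ F :* y′ :+ C :* z′)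
    := x′ :* (A :* x :+ H :* y :+ G :* z) :+ y′ :* (H :* x :+ B :* y :+ F :* z) :+ z′ :* (G :* x :+ F :* y :+ C :* z))
    ≈-refl (b * c - f * f) (a * c - g * g) (a * b - h * h) (g * h - a * f) (f * h - b * g) (f * g - c * h)
    x y z x′ y′ z′
    where open NonDegenerateConic 𝓞 using (a; b; c; f; g; h)

  -- Applying `adjugate` to the pole equation makes `discriminant • P` equal to `t • adjugate ℓ`, so
  -- the incidence of `P` with `m` becomes the vanishing of `t * D m ℓ`.
  conjugate⇒D≈0 : ∀ ℓ m → Conjugate 𝓞 ℓ m → D (proj₁ m) (proj₁ ℓ) ≈ 0#
  conjugate⇒D≈0 (ℓ , _) (m , _) ((P , _) , (t , t#0 , GP≈tℓ) , P∈m) = #0-cancelˡ t#0 (begin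
    t * (m ∙ adjugate ℓ)          ≈⟨ ∙-• t m (adjugate ℓ) ⟨
    m ∙ (t • adjugate ℓ)          ≈⟨ ∙-cong (T.refl {m}) (adjugate-• t ℓ) ⟨
    m ∙ adjugate (t • ℓ)          ≈⟨ D-cong {m} T.refl GP≈tℓ ⟨
    m ∙ adjugate (gram P)         ≈⟨ ∙-cong (T.refl {m}) (adjugate-gram P) ⟩
    m ∙ (discriminant • P)        ≈⟨ ∙-• discriminant m P ⟩
    discriminant * (m ∙ P)        ≈⟨ *-congˡ (≈-trans (∙-comm m P) P∈m) ⟩
    discriminant * 0#             ≈⟨ zeroʳ discriminant ⟩
    0#                            ∎)

  -- The pole of a line ℓ that is not tangent has coordinates adjugate ℓ.
  D≈0⇒conjugate : ∀ ℓ m → ¬ (D (proj₁ ℓ) (proj₁ ℓ) ≈ 0#) → D (proj₁ m) (proj₁ ℓ) ≈ 0# → Conjugate 𝓞 ℓ m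
  D≈0⇒conjugate (ℓ , _) (m , _) Dℓℓ≉0 Dmℓ≈0 =
    (adjugate ℓ , ∙≉0⇒nonZero {adjugate ℓ} {ℓ} (Dℓℓ≉0 ∘ ≈-trans (∙-comm ℓ (adjugate ℓ)))) ,
    (discriminant , nonDegenerate , gram-adjugate 𝓞 ℓ) ,
    ≈-trans (∙-comm (adjugate ℓ) m) Dmℓ≈0

  -- Points of the conic and chords

  B-cong : ∀ {u u′ v v′} → u ≈₃ u′ → v ≈₃ v′ → B u v ≈ B u′ v′
  B-cong u≈u′ v≈v′ = ∙-cong u≈u′ (gram-cong 𝓞 v≈v′)

  B-•ˡ : ∀ t u v → B (t • u) v ≈ t * B u v
  B-•ˡ t u v = •-∙ t u (gram v)

  Isotropic : Triple → Set
  Isotropic p = B p p ≈ 0#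

  isotropic-∼⇒B≈0 : ∀ {p r} → Isotropic r → p ∼ r → B p r ≈ 0#
  isotropic-∼⇒B≈0 {p} {r} Brr≈0 (t , _ , p≈tr) = begin
    B p r        ≈⟨ B-cong p≈tr (T.refl {r}) ⟩
    B (t • r) r  ≈⟨ B-•ˡ t r r ⟩
    t * B r r    ≈⟨ *-congˡ Brr≈0 ⟩
    t * 0#       ≈⟨ zeroʳ t ⟩
    0#           ∎

  -- Otherwise the line joining p and r would be the tangent at p as well as the tangent at r.
  isotropic-B≈0⇒∼ : ∀ {p r} → NonZero p → NonZero r → Isotropic p → Isotropic r → B p r ≈ 0# → p ∼ r
  isotropic-B≈0⇒∼ {p} {r} p≉0 r≉0 Bpp≈0 Brr≈0 Bpr≈0 with p ∼? r
  ... | yes p∼r = p∼r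
  ... | no  p≁r = contradiction pr≈0 (NonZero⇒≉0 pr≉0)
    where
    u = p ⨯ r
    pr≉0 = ¬∼⇒⨯-nonZero p≉0 r≉0 p≁r

    s,Gp≈su = orthogonal⇒multiple {gram p} {p} {r} pr≉0
      (≈-trans (∙-comm (gram p) p) Bpp≈0) (≈-trans (gram-∙ 𝓞 p r) Bpr≈0)
    t,Gr≈tu = orthogonal⇒multiple {gram r} {p} {r} pr≉0
      (≈-trans (∙-comm (gram r) p) Bpr≈0) (≈-trans (∙-comm (gram r) r) Brr≈0)

    -- `gram p` and `gram r` are multiples of the same `u`, so their cross product `adjugate u`
    -- vanishes, and non-degeneracy makes `u` vanish too.
    adj≈0 : adjugate u ≈₃ 0₃
    adj≈0 = T.trans (adjugate-⨯ p r) (T.trans (⨯-cong (proj₂ s,Gp≈su) (proj₂ t,Gr≈tu))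
      (⨯-multiples (proj₁ s,Gp≈su) (proj₁ t,Gr≈tu) u))

    Δu≈0 : (discriminant • u) ≈₃ 0₃
    Δu≈0 = T.trans (T.sym (gram-adjugate 𝓞 u)) (T.trans (gram-cong 𝓞 adj≈0) (∙-zeroʳ _ , ∙-zeroʳ _ , ∙-zeroʳ _))

    pr≈0 : u ≈₃ 0₃
    pr≈0 = #0-cancelˡ nonDegenerate (proj₁ Δu≈0) ,
           #0-cancelˡ nonDegenerate (proj₁ (proj₂ Δu≈0)) ,
           #0-cancelˡ nonDegenerate (proj₂ (proj₂ Δu≈0))

  -- A secant presented by its two points on the conic. For nonzero isotropic vectors `Bpr≉0` is
  -- equivalent to the points being distinct; it also forces both vectors to be nonzero.
  record Chord : Set where
    field
      p r  : Triple
      p∈𝓞  : Isotropic p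
      r∈𝓞  : Isotropic r
      Bpr≉0 : ¬ (B p r ≈ 0#)

    coefficients : Triple
    coefficients = p ⨯ r

    p≉0 : NonZero p
    p≉0 = ∙≉0⇒nonZero {p} {gram r} Bpr≉0

    r≉0 : NonZero r
    r≉0 = ∙≉0⇒nonZero {r} {gram p} (Bpr≉0 ∘ ≈-trans (B-comm p r))

    -- A Gram determinant with zero diagonal. The norm of a secant is thus the negative of a nonzero
    -- square, which is how -1 enters the argument about triangles.
    D≈-B² : D coefficients coefficients ≈ - (B p r * B p r)
    D≈-B² = begin
      D (p ⨯ r) (p ⨯ r)                  ≈⟨ D-⨯ p r p r ⟩
      B p p * B r r - B p r * B r p      ≈⟨ +-cong (*-cong p∈𝓞 r∈𝓞) (-‿cong (*-congˡ (B-comm r p))) ⟩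
      0# * 0# - B p r * B p r
        ≈⟨ solve 1 (λ w → con (ℤ.+ 0) :* con (ℤ.+ 0) :- w :* w := :- (w :* w)) ≈-refl (B p r) ⟩
      - (B p r * B p r)                  ∎

    p≁r : ¬ (p ∼ r)
    p≁r p∼r = Bpr≉0 (isotropic-∼⇒B≈0 r∈𝓞 p∼r)

    line : Line
    line = coefficients , ¬∼⇒⨯-nonZero p≉0 r≉0 p≁r

    -- Coplanar vectors p, r, x have proportional cross products, whence
    -- D(p ⨯ r , p ⨯ r) D(r ⨯ x , p ⨯ x) = D(r ⨯ x , p ⨯ r) D(p ⨯ x , p ⨯ r).
    isotropic-on-line : ¬ (fromℤ (ℤ.+ 2) ≈ 0#) → ∀ {x} → Isotropic x → x ∙ coefficients ≈ 0# →
                        B x p ≈ 0# ⊎ B x r ≈ 0#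
    isotropic-on-line 2≉0 {x} x∈𝓞 x∈line with B x p ≟ 0# | B x r ≟ 0#
    ... | yes Bxp≈0 | _         = inj₁ Bxp≈0
    ... | no  _     | yes Bxr≈0 = inj₂ Bxr≈0
    ... | no  Bxp≉0 | no  Bxr≉0 = contradiction 2w²yz≈0 (*-≉0 (*-≉0 2≉0 (*-≉0 Bpr≉0 Bpr≉0)) (*-≉0 Bxp≉0 Bxr≉0))
      where
      u = coefficients
      w = B p r ; y = B x p ; z = B x r
      u≉0 = proj₂ line

      β,rx≈βu = ⨯-multiple-of-orthogonal {u} {r} {x} u≉0
        (≈-trans (∙-comm u r) (⨯-orthogonalʳ p r)) (≈-trans (∙-comm u x) x∈line)
      γ,px≈γu = ⨯-multiple-of-orthogonal {u} {p} {x} u≉0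
        (≈-trans (∙-comm u p) (⨯-orthogonalˡ p r)) (≈-trans (∙-comm u x) x∈line)
      β = proj₁ β,rx≈βu
      γ = proj₁ γ,px≈γu

      proportional : D u u * D (r ⨯ x) (p ⨯ x) ≈ D (r ⨯ x) u * D (p ⨯ x) u
      proportional = begin
        D u u * D (r ⨯ x) (p ⨯ x)          ≈⟨ *-congˡ (D-cong (proj₂ β,rx≈βu) (proj₂ γ,px≈γu)) ⟩
        D u u * D (β • u) (γ • u)          ≈⟨ *-congˡ (D-• β γ u u) ⟩
        D u u * (β * γ * D u u)
          ≈⟨ solve 3 (λ d β γ → d :* (β :* γ :* d) := (β :* d) :* (γ :* d)) ≈-refl (D u u) β γ ⟩
        (β * D u u) * (γ * D u u)          ≈⟨ *-cong (•-∙ β u (adjugate u)) (•-∙ γ u (adjugate u)) ⟨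
        D (β • u) u * D (γ • u) u
          ≈⟨ *-cong (D-cong (proj₂ β,rx≈βu) (T.refl {u})) (D-cong (proj₂ γ,px≈γu) (T.refl {u})) ⟨
        D (r ⨯ x) u * D (p ⨯ x) u          ∎

      -- Expanded by `D-⨯`, the two sides of `proportional` involve only `w`, `y`, `z`, since `p`,
      -- `r` and `x` are isotropic; their difference is `2 w² y z`.
      2w²yz≈0 : fromℤ (ℤ.+ 2) * (w * w) * (y * z) ≈ 0#
      2w²yz≈0 = begin
        fromℤ (ℤ.+ 2) * (w * w) * (y * z)
          ≈⟨ solve 3 (λ w y z → con (ℤ.+ 2) :* (w :* w) :* (y :* z)
               := (:- (w :* w)) :* (w :* con (ℤ.+ 0) :- z :* y)
                  :- (w :* z :- con (ℤ.+ 0) :* y) :* (con (ℤ.+ 0) :* z :- w :* y)) ≈-refl w y z ⟩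
        (- (w * w)) * (w * 0# - z * y) - (w * z - 0# * y) * (0# * z - w * y)
          ≈⟨ +-cong (*-cong D≈-B² (+-cong (*-cong (B-comm r p) x∈𝓞) (-‿cong (*-cong (B-comm r x) ≈-refl))))
               (-‿cong (*-cong (+-cong (*-cong (B-comm r p) ≈-refl) (-‿cong (*-congʳ r∈𝓞)))
                               (+-congʳ (*-congʳ p∈𝓞)))) ⟨
        D u u * (B r p * B x x - B r x * B x p)
          - (B r p * B x r - B r r * B x p) * (B p p * B x r - B p r * B x p)
          ≈⟨ +-cong (*-congˡ (D-⨯ r x p x)) (-‿cong (*-cong (D-⨯ r x p r) (D-⨯ p x p r))) ⟨
        D u u * D (r ⨯ x) (p ⨯ x) - D (r ⨯ x) u * D (p ⨯ x) u
          ≈⟨ +-congʳ proportional ⟩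
        D (r ⨯ x) u * D (p ⨯ x) u - D (r ⨯ x) u * D (p ⨯ x) u
          ≈⟨ -‿inverseʳ _ ⟩
        0# ∎

    isSecant : ¬ (fromℤ (ℤ.+ 2) ≈ 0#) → IsSecant 𝓞 line
    isSecant 2≉0 = (p , p≉0) , (r , r≉0) , p≁r ,
      (⨯-orthogonalˡ p r , p∈𝓞) , (⨯-orthogonalʳ p r , r∈𝓞) , only
      where
      only : ∀ R → R ∈ line × OnConic 𝓞 R → R ≋ (p , p≉0) ⊎ R ≋ (r , r≉0)
      only (x , x≉0) (x∈line , x∈𝓞) = ⊎.map
        (isotropic-B≈0⇒∼ x≉0 p≉0 x∈𝓞 p∈𝓞) (isotropic-B≈0⇒∼ x≉0 r≉0 x∈𝓞 r∈𝓞) (isotropic-on-line 2≉0 x∈𝓞 x∈line)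

  isSecant⇒chord : ∀ ℓ → IsSecant 𝓞 ℓ → ∃[ C ] proj₁ ℓ ∼ Chord.coefficients C
  isSecant⇒chord (ℓ , ℓ≉0) ((p , p≉0) , (r , r≉0) , p≁r , (p∈ℓ , p∈𝓞) , (r∈ℓ , r∈𝓞) , _) =
    record { p = p ; r = r ; p∈𝓞 = p∈𝓞 ; r∈𝓞 = r∈𝓞
           ; Bpr≉0 = p≁r ∘ isotropic-B≈0⇒∼ p≉0 r≉0 p∈𝓞 r∈𝓞 } ,
    multiple⇒∼ ℓ≉0 (proj₂ (orthogonal⇒multiple {ℓ} {p} {r} (¬∼⇒⨯-nonZero p≉0 r≉0 p≁r)
      (≈-trans (∙-comm ℓ p) p∈ℓ) (≈-trans (∙-comm ℓ r) r∈ℓ)))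

  ∼chord⇒D≈-square : ∀ (C : Chord) {u} → u ∼ Chord.coefficients C →
                     ∃[ w ] ¬ (w ≈ 0#) × D u u ≈ - (w * w)
  ∼chord⇒D≈-square C {u} (s , s#0 , u≈sv) = s * w , *-≉0 (#0⇒≉0 s#0) Bpr≉0 , (begin
    D u u                 ≈⟨ D-cong u≈sv u≈sv ⟩
    D (s • v) (s • v)     ≈⟨ D-• s s v v ⟩
    s * s * D v v         ≈⟨ *-congˡ D≈-B² ⟩
    s * s * - (w * w)
      ≈⟨ solve 2 (λ s w → s :* s :* (:- (w :* w)) := :- (s :* w :* (s :* w))) ≈-refl s w ⟩
    - (s * w * (s * w))   ∎)
    where
    open Chord C
    w = B p r
    v = coefficients

  isSecant⇒D≈-square : ∀ ℓ → IsSecant 𝓞 ℓ → ∃[ w ] ¬ (w ≈ 0#) × D (proj₁ ℓ) (proj₁ ℓ) ≈ - (w * w)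
  isSecant⇒D≈-square ℓ sec = ∼chord⇒D≈-square (proj₁ (isSecant⇒chord ℓ sec)) (proj₂ (isSecant⇒chord ℓ sec))

  -x²≉0 : ∀ {d w} → ¬ (w ≈ 0#) → d ≈ - (w * w) → ¬ (d ≈ 0#)
  -x²≉0 {d} {w} w≉0 d≈-w² d≈0 = *-≉0 w≉0 w≉0 (begin
    w * w          ≈⟨ -‿involutive (w * w) ⟨
    - - (w * w)    ≈⟨ -‿cong (≈-trans (≈-sym d≈-w²) d≈0) ⟩
    - 0#           ≈⟨ -0#≈0# ⟩
    0#             ∎)

  isSecant⇒D≉0 : ∀ ℓ → IsSecant 𝓞 ℓ → ¬ (D (proj₁ ℓ) (proj₁ ℓ) ≈ 0#)
  isSecant⇒D≉0 ℓ sec = let (w , w≉0 , eq) = isSecant⇒D≈-square ℓ sec in -x²≉0 w≉0 eq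

  -- Self-polar triangles

  NegatedSquare : Carrier → Set
  NegatedSquare d = ∃[ w ] ¬ (w ≈ 0#) × d ≈ - (w * w)

  -- The meet of the second and third line is the pole of the first one, so that D u u D v v D w w
  -- is a square; if all three factors are negatives of squares, then so is -1.
  no-self-polar-triangle : (∀ x y → x * x + y * y ≈ 0# → y ≈ 0#) → ∀ {u v w} →
    NegatedSquare (D u u) → NegatedSquare (D v v) → NegatedSquare (D w w) →
    D u v ≈ 0# → D u w ≈ 0# → D w v ≈ 0# → ⊥
  no-self-polar-triangle anisotropic {u} {v} {w} (x , x≉0 , Duu) (y , y≉0 , Dvv) (z , z≉0 , Dww) Duv Duw Dwv =
    -- `D n n` is minus the square of `t * x` by `lhs` and the square of `discriminant * y * z` by
    -- `rhs`, so these two squares sum to 0.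
    *-≉0 (*-≉0 Δ≉0 y≉0) z≉0 (anisotropic (t * x) (discriminant * y * z) (begin
      t * x * (t * x) + discriminant * y * z * (discriminant * y * z)
        ≈⟨ solve 5 (λ t x δ y z → t :* x :* (t :* x) :+ δ :* y :* z :* (δ :* y :* z)
             := :- (t :* t :* (:- (x :* x)))
                :+ ((δ :* (:- (y :* y))) :* (δ :* (:- (z :* z))) :- (δ :* con (ℤ.+ 0)) :* (δ :* con (ℤ.+ 0))))
             ≈-refl t x discriminant y z ⟩
      - (t * t * - (x * x)) +
        ((discriminant * - (y * y)) * (discriminant * - (z * z)) - (discriminant * 0#) * (discriminant * 0#))
        ≈⟨ +-cong (-‿cong (≈-trans lhs (*-congˡ Duu))) (≈-trans rhs (+-cong
             (*-cong (*-congˡ Dvv) (*-congˡ Dww))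
             (-‿cong (*-cong (*-congˡ Dwv) (*-congˡ (≈-trans (D-comm v w) Dwv)))))) ⟨
      - D n n + D n n
        ≈⟨ -‿inverseˡ (D n n) ⟩
      0# ∎))
    where
    n = adjugate v ⨯ adjugate w

    u≉0 : NonZero u
    u≉0 = ∙≉0⇒nonZero {u} {adjugate u} (-x²≉0 x≉0 Duu)

    t,n≈tu = ⨯-multiple-of-orthogonal {u} {adjugate v} {adjugate w} u≉0 Duv Duw
    t = proj₁ t,n≈tu

    lhs : D n n ≈ t * t * D u u
    lhs = ≈-trans (D-cong (proj₂ t,n≈tu) (proj₂ t,n≈tu)) (D-• t t u u)

    rhs : D n n ≈ (discriminant * D v v) * (discriminant * D w w)
                  - (discriminant * D w v) * (discriminant * D v w)
    rhs = ≈-trans (D-⨯ (adjugate v) (adjugate w) (adjugate v) (adjugate w))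
      (+-cong (*-cong (B-adjugate v v) (B-adjugate w w)) (-‿cong (*-cong (B-adjugate v w) (B-adjugate w v))))

  -- Lines joining a point of the conic to a pole

  B-adjugateʳ : ∀ p u → B p (adjugate u) ≈ discriminant * (p ∙ u)
  B-adjugateʳ p u = ≈-trans (∙-cong (T.refl {p}) (gram-adjugate 𝓞 u)) (∙-• discriminant p u)

  -- The line through p and the pole of u is the tangent at p.
  tangent-at-common-point : ∀ {p u v} → NonZero p → Isotropic p → ¬ (D u u ≈ 0#) → ¬ (D v v ≈ 0#) →
    p ∙ u ≈ 0# → D v u ≈ 0# → ¬ (p ∙ v ≈ 0#)
  tangent-at-common-point {p} {u} {v} p≉0 p∈𝓞 Duu≉0 Dvv≉0 pu≈0 Dvu≈0 pv≈0 = Dvv≉0 (D-resp-≈0 v∼Gp v∼Gp (begin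
    D (gram p) (gram p)               ≈⟨ ∙-cong (T.refl {gram p}) (adjugate-gram p) ⟩
    gram p ∙ (discriminant • p)       ≈⟨ ∙-• discriminant (gram p) p ⟩
    discriminant * (gram p ∙ p)       ≈⟨ *-congˡ Gp∙p≈0 ⟩
    discriminant * 0#                 ≈⟨ zeroʳ discriminant ⟩
    0#                                ∎))
    where
    n = adjugate u

    Bnn≉0 : ¬ (B n n ≈ 0#)
    Bnn≉0 Bnn≈0 = *-≉0 Δ≉0 Duu≉0 (≈-trans (≈-sym (B-adjugate u u)) Bnn≈0)

    Bnp≈0 : B n p ≈ 0#
    Bnp≈0 = ≈-trans (B-comm n p) (≈-trans (B-adjugateʳ p u) (≈-trans (*-congˡ pu≈0) (zeroʳ discriminant)))

    Gp∙p≈0 : gram p ∙ p ≈ 0#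
    Gp∙p≈0 = ≈-trans (∙-comm (gram p) p) p∈𝓞

    n≁p : ¬ (n ∼ p)
    n≁p (s , _ , n≈sp) = Bnn≉0 (begin
      B n n         ≈⟨ B-cong n≈sp (T.refl {n}) ⟩
      B (s • p) n   ≈⟨ B-•ˡ s p n ⟩
      s * B p n     ≈⟨ *-congˡ (≈-trans (B-comm p n) Bnp≈0) ⟩
      s * 0#        ≈⟨ zeroʳ s ⟩
      0#            ∎)

    pn≉0 : NonZero (p ⨯ n)
    pn≉0 = ¬∼⇒⨯-nonZero p≉0 (∙≉0⇒nonZero {n} {gram n} Bnn≉0) (n≁p ∘ ∼-sym)

    v≉0 : NonZero v
    v≉0 = ∙≉0⇒nonZero {v} {adjugate v} Dvv≉0

    -- Both `v` and `gram p` are orthogonal to the independent vectors `p` and `n`, hence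
    -- proportional to `p ⨯ n`. So `v` is the tangent at `p`, which has norm 0.
    v∼pn : v ∼ (p ⨯ n)
    v∼pn = multiple⇒∼ v≉0 (proj₂ (orthogonal⇒multiple {v} {p} {n} pn≉0 (≈-trans (∙-comm v p) pv≈0) Dvu≈0))

    Gp≉0 : NonZero (gram p)
    Gp≉0 = decidable-stable (nonZero? (gram p)) λ Gp≈0 → NonZero⇒≉0 p≉0 (Δp≈0⇒p≈0 (
      T.trans (T.sym (adjugate-gram p)) (T.trans (adjugate-cong (¬nonZero⇒≈0 Gp≈0))
        (∙-zeroʳ _ , ∙-zeroʳ _ , ∙-zeroʳ _))))
      where
      Δp≈0⇒p≈0 : (discriminant • p) ≈₃ 0₃ → p ≈₃ 0₃
      Δp≈0⇒p≈0 (x , y , z) = #0-cancelˡ nonDegenerate x , #0-cancelˡ nonDegenerate y , #0-cancelˡ nonDegenerate z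

    v∼Gp : v ∼ gram p
    v∼Gp = ∼-trans v∼pn (∼-sym (multiple⇒∼ Gp≉0 (proj₂ (orthogonal⇒multiple {gram p} {p} {n} pn≉0 Gp∙p≈0
      (≈-trans (∙-comm (gram p) n) Bnp≈0)))))

  infixl 6 _⊕_
  _⊕_ : Triple → Triple → Triple
  (x , y , z) ⊕ (x′ , y′ , z′) = x + x′ , y + y′ , z + z′

  ⊕-∙ : ∀ u v w → (u ⊕ v) ∙ w ≈ u ∙ w + v ∙ w
  ⊕-∙ (x , y , z) (x′ , y′ , z′) (a , b , c) = solve 9 (λ x y z x′ y′ z′ a b c →
    (x :+ x′) :* a :+ (y :+ y′) :* b :+ (z :+ z′) :* c
    := (x :* a :+ y :* b :+ z :* c) :+ (x′ :* a :+ y′ :* b :+ z′ :* c)) ≈-refl x y z x′ y′ z′ a b c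

  combination-∙ : ∀ α u β v w → ((α • u) ⊕ (β • v)) ∙ w ≈ α * (u ∙ w) + β * (v ∙ w)
  combination-∙ α u β v w = ≈-trans (⊕-∙ (α • u) (β • v) w) (+-cong (•-∙ α u w) (•-∙ β v w))

  -- The second intersection with the conic of the line through p and the pole of u is the
  -- image of p under the reflection fixing the points of u.
  module _ (2≉0 : ¬ (fromℤ (ℤ.+ 2) ≈ 0#)) {p u : Triple} (p∈𝓞 : Isotropic p) (p∉u : ¬ (p ∙ u ≈ 0#))
           (Duu≉0 : ¬ (D u u ≈ 0#)) where
    private
      n = adjugate u
      κ = B p n
      β = B n n
      2# = fromℤ (ℤ.+ 2)

      -- The usual formula for the reflection along `n`, multiplied by `B n n` to avoid a division.
      r : Triple
      r = (β • p) ⊕ ((- (2# * κ)) • n)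

      B-r : ∀ v → B r v ≈ β * B p v + - (2# * κ) * B n v
      B-r v = combination-∙ β p (- (2# * κ)) n (gram v)

      κ≉0 : ¬ (κ ≈ 0#)
      κ≉0 κ≈0 = *-≉0 Δ≉0 p∉u (≈-trans (≈-sym (B-adjugateʳ p u)) κ≈0)

      Brp : B r p ≈ - (2# * (κ * κ))
      Brp = begin
        B r p                                  ≈⟨ B-r p ⟩
        β * B p p + - (2# * κ) * B n p         ≈⟨ +-cong (*-congˡ p∈𝓞) (*-congˡ (B-comm n p)) ⟩
        β * 0# + - (2# * κ) * κ                ≈⟨ solve 2 (λ β κ → β :* con (ℤ.+ 0) :+ (:- (con (ℤ.+ 2) :* κ)) :* κ
                                                    := :- (con (ℤ.+ 2) :* (κ :* κ))) ≈-refl β κ ⟩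
        - (2# * (κ * κ))                       ∎

      r∈𝓞 : Isotropic r
      r∈𝓞 = begin
        B r r                                  ≈⟨ B-r r ⟩
        β * B p r + - (2# * κ) * B n r         ≈⟨ +-cong (*-congˡ (≈-trans (B-comm p r) Brp))
                                                    (*-congˡ (≈-trans (B-comm n r) (B-r n))) ⟩
        β * - (2# * (κ * κ)) + - (2# * κ) * (β * κ + - (2# * κ) * β)
          ≈⟨ solve 2 (λ β κ → β :* (:- (con (ℤ.+ 2) :* (κ :* κ)))
               :+ (:- (con (ℤ.+ 2) :* κ)) :* (β :* κ :+ (:- (con (ℤ.+ 2) :* κ)) :* β) := con (ℤ.+ 0)) ≈-refl β κ ⟩
        0#                                     ∎

      chord : Chord
      chord = record
        { p = p ; r = r ; p∈𝓞 = p∈𝓞 ; r∈𝓞 = r∈𝓞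
        ; Bpr≉0 = λ Bpr≈0 → *-≉0 2≉0 (*-≉0 κ≉0 κ≉0) (begin
            2# * (κ * κ)       ≈⟨ -‿involutive _ ⟨
            - - (2# * (κ * κ)) ≈⟨ -‿cong (≈-trans (≈-sym Brp) (≈-trans (B-comm r p) Bpr≈0)) ⟩
            - 0#               ≈⟨ -0#≈0# ⟩
            0#                 ∎) }

      n∈pr : D (p ⨯ r) u ≈ 0#
      -- In the expansion of `(p ⨯ r) ∙ r`, which is 0, the term with `p` vanishes as well, and what
      -- remains is a multiple of the claim by `2# * κ`.
      n∈pr = #0-cancelˡ (≉0⇒#0 (*-≉0 2≉0 κ≉0)) (begin
        2# * κ * ((p ⨯ r) ∙ n)
          ≈⟨ solve 4 (λ k x y b → k :* x := b :* y :- (b :* y :+ (:- k) :* x)) ≈-refl (2# * κ) ((p ⨯ r) ∙ n) ((p ⨯ r) ∙ p) β ⟩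
        β * ((p ⨯ r) ∙ p) - (β * ((p ⨯ r) ∙ p) + - (2# * κ) * ((p ⨯ r) ∙ n))
          ≈⟨ +-cong (*-congˡ (≈-trans (∙-comm (p ⨯ r) p) (⨯-orthogonalˡ p r)))
               (-‿cong (≈-trans (+-cong (*-congˡ (∙-comm (p ⨯ r) p)) (*-congˡ (∙-comm (p ⨯ r) n)))
                 (≈-trans (≈-sym (combination-∙ β p (- (2# * κ)) n (p ⨯ r))) (⨯-orthogonalʳ p r)))) ⟩
        β * 0# - 0#
          ≈⟨ solve 1 (λ b → b :* con (ℤ.+ 0) :- con (ℤ.+ 0) := con (ℤ.+ 0)) ≈-refl β ⟩
        0# ∎)

    secant-through-pole : ∃[ C ] Chord.p C ≡ p × D (Chord.coefficients C) u ≈ 0# ×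
      (∀ {v} → NonZero v → p ∙ v ≈ 0# → D v u ≈ 0# → v ∼ Chord.coefficients C)
    -- For uniqueness: `r` is a combination of `p` and the pole `n`, so a line through both contains
    -- `r`.
    secant-through-pole = chord , refl , n∈pr , λ {v} v≉0 p∈v n∈v →
      multiple⇒∼ v≉0 (proj₂ (orthogonal⇒multiple {v} {p} {r} (proj₂ (Chord.line chord))
        (≈-trans (∙-comm v p) p∈v) (begin
          v ∙ r                                     ≈⟨ ∙-comm v r ⟩
          r ∙ v                                     ≈⟨ combination-∙ β p (- (2# * κ)) n v ⟩
          β * (p ∙ v) + - (2# * κ) * (n ∙ v)
            ≈⟨ +-cong (*-congˡ p∈v) (*-congˡ (≈-trans (∙-comm n v) n∈v)) ⟩
          β * 0# + - (2# * κ) * 0#                  ≈⟨ +-cong (zeroʳ β) (zeroʳ (- (2# * κ))) ⟩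
          0# + 0#                                   ≈⟨ +-identityʳ 0# ⟩
          0#                                        ∎)))

  -- Harmonic pairs and the pentagon in characteristic 11

  module _ (11≈0 : fromℤ (ℤ.+ 11) ≈ 0#) where

    fromℤ1≈1 : fromℤ (ℤ.+ 1) ≈ 1#
    fromℤ1≈1 = +-identityʳ 1#

    -- The arguments `y` and `z` certify that `x` is invertible modulo 11; for integer constants the
    -- solver checks the certificate.
    unit≉0 : ∀ {x} y z → x * y ≈ fromℤ (ℤ.+ 1) + fromℤ (ℤ.+ 11) * z → ¬ (x ≈ 0#)
    unit≉0 {x} y z xy≈1 x≈0 = 1≉0 (begin
      1#                                        ≈⟨ fromℤ1≈1 ⟨
      fromℤ (ℤ.+ 1)                             ≈⟨ +-identityʳ _ ⟨
      fromℤ (ℤ.+ 1) + 0#                        ≈⟨ +-congˡ (≈-trans (*-congʳ 11≈0) (zeroˡ z)) ⟨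
      fromℤ (ℤ.+ 1) + fromℤ (ℤ.+ 11) * z        ≈⟨ xy≈1 ⟨
      x * y                                     ≈⟨ *-congʳ x≈0 ⟩
      0# * y                                    ≈⟨ zeroˡ y ⟩
      0#                                        ∎)

    2≉0 : ¬ (fromℤ (ℤ.+ 2) ≈ 0#)
    2≉0 = unit≉0 (fromℤ (ℤ.+ 6)) (fromℤ (ℤ.+ 1))
      (solve 0 (con (ℤ.+ 2) :* con (ℤ.+ 6) := con (ℤ.+ 1) :+ con (ℤ.+ 11) :* con (ℤ.+ 1)) ≈-refl)

    multiple-of-11 : ∀ {x} y → x ≈ fromℤ (ℤ.+ 11) * y → x ≈ 0#
    multiple-of-11 y x≈11y = ≈-trans x≈11y (≈-trans (*-congʳ 11≈0) (zeroˡ y))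

    module _ (C : Chord) where
      open Chord C
      private
        u = coefficients
        n = adjugate u
        w = B p r
        2# = fromℤ (ℤ.+ 2)

        Bpn≈0 : B p n ≈ 0#
        Bpn≈0 = ≈-trans (B-adjugateʳ p u) (≈-trans (*-congˡ (⨯-orthogonalˡ p r)) (zeroʳ discriminant))

        Brn≈0 : B r n ≈ 0#
        Brn≈0 = ≈-trans (B-adjugateʳ r u) (≈-trans (*-congˡ (⨯-orthogonalʳ p r)) (zeroʳ discriminant))

        Bnn≈-Δw² : B n n ≈ discriminant * - (w * w)
        Bnn≈-Δw² = ≈-trans (B-adjugate u u) (*-congˡ D≈-B²)

      -- Parametrisation of the conic by s ∈ F ∪ {∞}, with p at s = 0 and r at s = ∞, for which
      -- B (θ s) (θ t) is a constant times (s - t)².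
      θ : Carrier → Triple
      θ s = ((2# • p) ⊕ ((2# * s) • n)) ⊕ ((s * s * discriminant * w) • r)

      θ-∙ : ∀ s v → θ s ∙ v ≈ 2# * (p ∙ v) + 2# * s * (n ∙ v) + s * s * discriminant * w * (r ∙ v)
      θ-∙ s v = ≈-trans (⊕-∙ ((2# • p) ⊕ ((2# * s) • n)) ((s * s * discriminant * w) • r) v)
        (+-cong (combination-∙ 2# p (2# * s) n v) (•-∙ (s * s * discriminant * w) r v))

      κ : Carrier
      κ = 2# * discriminant * (w * w)

      κ≉0 : ¬ (κ ≈ 0#)
      κ≉0 = *-≉0 (*-≉0 2≉0 Δ≉0) (*-≉0 Bpr≉0 Bpr≉0)

      B-θ-p : ∀ s → B (θ s) p ≈ s * s * discriminant * w * w
      B-θ-p s = begin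
        B (θ s) p
          ≈⟨ θ-∙ s (gram p) ⟩
        2# * B p p + 2# * s * B n p + s * s * discriminant * w * B r p
          ≈⟨ +-cong (+-cong (*-congˡ p∈𝓞) (*-congˡ (≈-trans (B-comm n p) Bpn≈0))) (*-congˡ (B-comm r p)) ⟩
        2# * 0# + 2# * s * 0# + s * s * discriminant * w * w
          ≈⟨ solve 3 (λ s δ w → con (ℤ.+ 2) :* con (ℤ.+ 0) :+ con (ℤ.+ 2) :* s :* con (ℤ.+ 0) :+ s :* s :* δ :* w :* w
               := s :* s :* δ :* w :* w) ≈-refl s discriminant w ⟩
        s * s * discriminant * w * w ∎

      B-θ-r : ∀ s → B (θ s) r ≈ 2# * w
      B-θ-r s = begin
        B (θ s) r
          ≈⟨ θ-∙ s (gram r) ⟩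
        2# * B p r + 2# * s * B n r + s * s * discriminant * w * B r r
          ≈⟨ +-cong (+-congˡ (*-congˡ (≈-trans (B-comm n r) Brn≈0))) (*-congˡ r∈𝓞) ⟩
        2# * w + 2# * s * 0# + s * s * discriminant * w * 0#
          ≈⟨ solve 3 (λ s δ w → con (ℤ.+ 2) :* w :+ con (ℤ.+ 2) :* s :* con (ℤ.+ 0)
                 :+ s :* s :* δ :* w :* con (ℤ.+ 0)
               := con (ℤ.+ 2) :* w) ≈-refl s discriminant w ⟩
        2# * w ∎

      B-θ-n : ∀ s → B (θ s) n ≈ 2# * s * (discriminant * - (w * w))
      B-θ-n s = begin
        B (θ s) n
          ≈⟨ θ-∙ s (gram n) ⟩
        2# * B p n + 2# * s * B n n + s * s * discriminant * w * B r n
          ≈⟨ +-cong (+-cong (*-congˡ Bpn≈0) (*-congˡ Bnn≈-Δw²)) (*-congˡ Brn≈0) ⟩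
        2# * 0# + 2# * s * (discriminant * - (w * w)) + s * s * discriminant * w * 0#
          ≈⟨ solve 3 (λ s δ w → con (ℤ.+ 2) :* con (ℤ.+ 0) :+ con (ℤ.+ 2) :* s :* (δ :* (:- (w :* w)))
                 :+ s :* s :* δ :* w :* con (ℤ.+ 0)
               := con (ℤ.+ 2) :* s :* (δ :* (:- (w :* w)))) ≈-refl s discriminant w ⟩
        2# * s * (discriminant * - (w * w)) ∎

      -- `B p r` contributes the squares of `s` and `t`, and `B n n` the mixed term; the
      -- coefficients in `θ` are chosen so that these complete a square.
      B-θ-θ : ∀ s t → B (θ s) (θ t) ≈ κ * ((s - t) * (s - t))
      B-θ-θ s t = begin
        B (θ s) (θ t)
          ≈⟨ θ-∙ s (gram (θ t)) ⟩
        2# * B p (θ t) + 2# * s * B n (θ t) + s * s * discriminant * w * B r (θ t)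
          ≈⟨ +-cong (+-cong (*-congˡ (≈-trans (B-comm p (θ t)) (B-θ-p t)))
                            (*-congˡ (≈-trans (B-comm n (θ t)) (B-θ-n t))))
                    (*-congˡ (≈-trans (B-comm r (θ t)) (B-θ-r t))) ⟩
        2# * (t * t * discriminant * w * w) + 2# * s * (2# * t * (discriminant * - (w * w)))
          + s * s * discriminant * w * (2# * w)
          ≈⟨ solve 4 (λ s t δ w →
               con (ℤ.+ 2) :* (t :* t :* δ :* w :* w) :+ con (ℤ.+ 2) :* s :* (con (ℤ.+ 2) :* t :* (δ :* (:- (w :* w))))
                 :+ s :* s :* δ :* w :* (con (ℤ.+ 2) :* w)
               := con (ℤ.+ 2) :* δ :* (w :* w) :* ((s :- t) :* (s :- t))) ≈-refl s t discriminant w ⟩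
        κ * ((s - t) * (s - t)) ∎

      θ∈𝓞 : ∀ s → Isotropic (θ s)
      θ∈𝓞 s = ≈-trans (B-θ-θ s s) (solve 2 (λ κ s → κ :* ((s :- s) :* (s :- s)) := con (ℤ.+ 0)) ≈-refl κ s)

      θ-chord : ∀ s t → ¬ (s - t ≈ 0#) → Chord
      θ-chord s t s-t≉0 = record
        { p = θ s ; r = θ t ; p∈𝓞 = θ∈𝓞 s ; r∈𝓞 = θ∈𝓞 t
        ; Bpr≉0 = λ B≈0 → *-≉0 κ≉0 (*-≉0 s-t≉0 s-t≉0) (≈-trans (≈-sym (B-θ-θ s t)) B≈0) }

      -- The last factor is a difference of squares. One of its linear factors is
      -- `(a - b) * (c - d)`; the vanishing of the other says that the cross-ratio is -1. Hence
      -- conjugate chords are harmonic pairs.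
      D-θ : ∀ a b c d → D (θ a ⨯ θ b) (θ c ⨯ θ d) ≈
        κ * κ * ((a - c) * (a - c) * ((b - d) * (b - d)) - (a - d) * (a - d) * ((b - c) * (b - c)))
      D-θ a b c d = begin
        D (θ a ⨯ θ b) (θ c ⨯ θ d)
          ≈⟨ D-⨯ (θ a) (θ b) (θ c) (θ d) ⟩
        B (θ a) (θ c) * B (θ b) (θ d) - B (θ a) (θ d) * B (θ b) (θ c)
          ≈⟨ +-cong (*-cong (B-θ-θ a c) (B-θ-θ b d)) (-‿cong (*-cong (B-θ-θ a d) (B-θ-θ b c))) ⟩
        (κ * ((a - c) * (a - c))) * (κ * ((b - d) * (b - d))) - (κ * ((a - d) * (a - d))) * (κ * ((b - c) * (b - c)))
          ≈⟨ solve 5 (λ κ x y z t → (κ :* x) :* (κ :* y) :- (κ :* z) :* (κ :* t) := κ :* κ :* (x :* y :- z :* t)) ≈-refl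
               κ ((a - c) * (a - c)) ((b - d) * (b - d)) ((a - d) * (a - d)) ((b - c) * (b - c)) ⟩
        κ * κ * ((a - c) * (a - c) * ((b - d) * (b - d)) - (a - d) * (a - d) * ((b - c) * (b - c))) ∎

      -- The point `r` is at infinity and not a value of `θ`, so the base pair is treated
      -- separately; pairs of opposite parameters are harmonic to it.
      D-θ-base : ∀ a → D (θ a ⨯ θ (- a)) u ≈ 0#
      D-θ-base a = begin
        D (θ a ⨯ θ (- a)) (p ⨯ r)
          ≈⟨ D-⨯ (θ a) (θ (- a)) p r ⟩
        B (θ a) p * B (θ (- a)) r - B (θ a) r * B (θ (- a)) p
          ≈⟨ +-cong (*-cong (B-θ-p a) (B-θ-r (- a))) (-‿cong (*-cong (B-θ-r a) (B-θ-p (- a)))) ⟩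
        (a * a * discriminant * w * w) * (2# * w) - (2# * w) * (- a * - a * discriminant * w * w)
          ≈⟨ solve 3 (λ a δ w → (a :* a :* δ :* w :* w) :* (con (ℤ.+ 2) :* w)
               :- (con (ℤ.+ 2) :* w) :* ((:- a) :* (:- a) :* δ :* w :* w) := con (ℤ.+ 0)) ≈-refl a discriminant w ⟩
        0# ∎

      third-point : ∃[ x ] Isotropic x × NonZero x × ¬ (x ∙ u ≈ 0#)
      -- The parameter 1 is neither 0 nor infinity; the incidence with `u` evaluates to twice the
      -- norm of `u`.
      third-point = θ 1# , θ∈𝓞 1# , ∙≉0⇒nonZero {θ 1#} {u} θ1∉u , θ1∉u
        where
        θ1∉u : ¬ (θ 1# ∙ u ≈ 0#)
        θ1∉u θ1u≈0 = *-≉0 2≉0 (-x²≉0 Bpr≉0 D≈-B²) (begin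
          2# * (u ∙ n)
            ≈⟨ *-cong (≈-sym (*-identityʳ 2#)) (∙-comm u n) ⟩
          2# * 1# * (n ∙ u)
            ≈⟨ solve 2 (λ x y → x := con (ℤ.+ 2) :* con (ℤ.+ 0) :+ x :+ y :* con (ℤ.+ 0)) ≈-refl
                 (2# * 1# * (n ∙ u)) (1# * 1# * discriminant * w) ⟩
          2# * 0# + 2# * 1# * (n ∙ u) + 1# * 1# * discriminant * w * 0#
            ≈⟨ +-cong (+-congʳ (*-congˡ (⨯-orthogonalˡ p r))) (*-congˡ (⨯-orthogonalʳ p r)) ⟨
          2# * (p ∙ u) + 2# * 1# * (n ∙ u) + 1# * 1# * discriminant * w * (r ∙ u)
            ≈⟨ θ-∙ 1# u ⟨
          θ 1# ∙ u
            ≈⟨ θ1u≈0 ⟩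
          0# ∎)

      num : ℕ → Carrier
      num k = fromℤ (ℤ.+ k)

      -- Harmonic pairs modulo 11: {0, ∞}, {1, -1}, {7, 8}, {3, 5}, {2, -2}, and back to {0, ∞}.
      chord₁ chord₂ chord₃ chord₄ : Chord
      chord₁ = θ-chord (num 1) (- num 1) (unit≉0 (num 6) (num 1)
        (solve 0 ((con (ℤ.+ 1) :- (:- con (ℤ.+ 1))) :* con (ℤ.+ 6) := con (ℤ.+ 1) :+ con (ℤ.+ 11) :* con (ℤ.+ 1)) ≈-refl))
      chord₂ = θ-chord (num 7) (num 8) (unit≉0 (fromℤ (ℤ.- (ℤ.+ 1))) (num 0)
        (solve 0 ((con (ℤ.+ 7) :- con (ℤ.+ 8)) :* con (ℤ.- (ℤ.+ 1)) := con (ℤ.+ 1) :+ con (ℤ.+ 11) :* con (ℤ.+ 0)) ≈-refl))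
      chord₃ = θ-chord (num 3) (num 5) (unit≉0 (num 5) (fromℤ (ℤ.- (ℤ.+ 1)))
        (solve 0 ((con (ℤ.+ 3) :- con (ℤ.+ 5)) :* con (ℤ.+ 5) := con (ℤ.+ 1) :+ con (ℤ.+ 11) :* con (ℤ.- (ℤ.+ 1))) ≈-refl))
      chord₄ = θ-chord (num 2) (- num 2) (unit≉0 (num 3) (num 1)
        (solve 0 ((con (ℤ.+ 2) :- (:- con (ℤ.+ 2))) :* con (ℤ.+ 3) := con (ℤ.+ 1) :+ con (ℤ.+ 11) :* con (ℤ.+ 1)) ≈-refl))

      private
        harmonic : ∀ {a b c d} y →
          (a - c) * (a - c) * ((b - d) * (b - d)) - (a - d) * (a - d) * ((b - c) * (b - c)) ≈ num 11 * y →
          D (θ a ⨯ θ b) (θ c ⨯ θ d) ≈ 0#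
        harmonic {a} {b} {c} {d} y eq = ≈-trans (D-θ a b c d)
          (≈-trans (*-congˡ (multiple-of-11 y eq)) (zeroʳ (κ * κ)))

      D₀₁ : D (Chord.coefficients chord₁) u ≈ 0#
      D₀₁ = D-θ-base (num 1)

      -- Over the integers the difference of squares in `D-θ` is -220 here, and 44 and -176 in the
      -- next two cases.
      D₁₂ : D (Chord.coefficients chord₂) (Chord.coefficients chord₁) ≈ 0#
      D₁₂ = harmonic (fromℤ (ℤ.- (ℤ.+ 20))) (solve 0
        (let a = con (ℤ.+ 7) ; b = con (ℤ.+ 8) ; c = con (ℤ.+ 1) ; d = :- con (ℤ.+ 1) in
         (a :- c) :* (a :- c) :* ((b :- d) :* (b :- d)) :- (a :- d) :* (a :- d) :* ((b :- c) :* (b :- c))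
         := con (ℤ.+ 11) :* con (ℤ.- (ℤ.+ 20))) ≈-refl)

      D₂₃ : D (Chord.coefficients chord₃) (Chord.coefficients chord₂) ≈ 0#
      D₂₃ = harmonic (num 4) (solve 0
        (let a = con (ℤ.+ 3) ; b = con (ℤ.+ 5) ; c = con (ℤ.+ 7) ; d = con (ℤ.+ 8) in
         (a :- c) :* (a :- c) :* ((b :- d) :* (b :- d)) :- (a :- d) :* (a :- d) :* ((b :- c) :* (b :- c))
         := con (ℤ.+ 11) :* con (ℤ.+ 4)) ≈-refl)

      D₃₄ : D (Chord.coefficients chord₄) (Chord.coefficients chord₃) ≈ 0#
      D₃₄ = harmonic (fromℤ (ℤ.- (ℤ.+ 16))) (solve 0
        (let a = con (ℤ.+ 2) ; b = :- con (ℤ.+ 2) ; c = con (ℤ.+ 3) ; d = con (ℤ.+ 5) in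
         (a :- c) :* (a :- c) :* ((b :- d) :* (b :- d)) :- (a :- d) :* (a :- d) :* ((b :- c) :* (b :- c))
         := con (ℤ.+ 11) :* con (ℤ.- (ℤ.+ 16))) ≈-refl)

      D₄₀ : D (Chord.coefficients chord₄) u ≈ 0#
      D₄₀ = D-θ-base (num 2)

-- Approximate eigenvectors of regular graphs

open Sum ℚ.+-0-commutativeMonoid using (sum; sum-cong-≗; ∑-distrib-+; sum-replicate-zero)

*-monoˡ : ∀ {p q r} → 0ℚ ℚ.≤ p → q ℚ.≤ r → p ℚ.* q ℚ.≤ p ℚ.* r
*-monoˡ {p} 0≤p = ℚ.*-monoˡ-≤-nonNeg p {{ℚ.nonNegative 0≤p}}

*-monoʳ : ∀ {p q r} → 0ℚ ℚ.≤ p → q ℚ.≤ r → q ℚ.* p ℚ.≤ r ℚ.* p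
*-monoʳ {p} 0≤p = ℚ.*-monoʳ-≤-nonNeg p {{ℚ.nonNegative 0≤p}}

p≤∣p∣ : ∀ p → p ℚ.≤ ℚ.∣ p ∣
p≤∣p∣ p with ℚ.≤-total 0ℚ p
... | inj₁ 0≤p = ℚ.≤-reflexive (sym (ℚ.0≤p⇒∣p∣≡p 0≤p))
... | inj₂ p≤0 = ℚ.≤-trans p≤0 (ℚ.0≤∣p∣ p)

p-q≤r⇒p≤r+q : ∀ {p q r} → p ℚ.- q ℚ.≤ r → p ℚ.≤ r ℚ.+ q
p-q≤r⇒p≤r+q {p} {q} {r} p-q≤r = ℚ.≤-trans
  (ℚ.≤-reflexive (solve 2 (λ p q → p := p :- q :+ q) refl p q)) (ℚ.+-monoˡ-≤ q p-q≤r)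
  where open +-*-Solver

p+q≤r⇒q-r≤-p : ∀ {p q r} → p ℚ.+ q ℚ.≤ r → q ℚ.- r ℚ.≤ ℚ.- p
p+q≤r⇒q-r≤-p {p} {q} {r} p+q≤r = subst₂ ℚ._≤_
  (solve 3 (λ p q r → p :+ q :+ ((:- p) :- r) := q :- r) refl p q r)
  (solve 2 (λ p r → r :+ ((:- p) :- r) := :- p) refl p r)
  (ℚ.+-monoˡ-≤ (ℚ.- p ℚ.- r) p+q≤r)
  where open +-*-Solver

p-r≤q⇒p-q≤r : ∀ {p q r} → p ℚ.- r ℚ.≤ q → p ℚ.- q ℚ.≤ r
p-r≤q⇒p-q≤r {p} {q} {r} p-r≤q = subst₂ ℚ._≤_
  (solve 3 (λ p q r → p :- r :+ (r :- q) := p :- q) refl p q r)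
  (solve 2 (λ q r → q :+ (r :- q) := r) refl q r)
  (ℚ.+-monoˡ-≤ (r ℚ.- q) p-r≤q)
  where open +-*-Solver

suc/1 : ∀ n → ℤ.+ suc n ℚ./ 1 ≡ 1ℚ ℚ.+ (ℤ.+ n ℚ./ 1)
suc/1 n = begin
  ℤ.+ suc n ℚ./ 1                             ≡⟨ cong (λ z → (ℤ.+ 1 ℤ.+ z) ℚ./ 1) (ℤ.*-identityʳ (ℤ.+ n)) ⟨
  1ℚ ℚ.+ mkℚ (ℤ.+ n) 0 c                      ≡⟨ cong (1ℚ ℚ.+_) (ℚ.normalize-coprime c) ⟨
  1ℚ ℚ.+ (ℤ.+ n ℚ./ 1)                        ∎
  where
  open ≡-Reasoning
  -- Coprimality to the denominator 1 exhibits `mkℚ (ℤ.+ n) 0 c` as the normal form of the quotient,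
  -- on which addition computes.
  c = ℕ.sym (ℕ.1-coprimeTo n)

0≤n/1 : ∀ n → 0ℚ ℚ.≤ ℤ.+ n ℚ./ 1
0≤n/1 n = ℚ.nonNegative⁻¹ (ℤ.+ n ℚ./ 1) {{ℚ.normalize-nonNeg n 1}}

indicator : ∀ {P : Set} → Dec P → ℚ
indicator P? = if does P? then 1ℚ else 0ℚ

0≤indicator : ∀ {P : Set} (P? : Dec P) → 0ℚ ℚ.≤ indicator P?
0≤indicator (yes _) = ℚ.nonNegative⁻¹ 1ℚ
0≤indicator (no  _) = ℚ.≤-refl

indicator-true : ∀ {P : Set} (P? : Dec P) → P → indicator P? ≡ 1ℚ
indicator-true P? p = cong (if_then 1ℚ else 0ℚ) (dec-true P? p)

indicator-false : ∀ {P : Set} (P? : Dec P) → ¬ P → indicator P? ≡ 0ℚ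
indicator-false P? ¬p = cong (if_then 1ℚ else 0ℚ) (dec-false P? ¬p)

-- Stated for `tabulate f` instead of `allFin`, so that the induction can pass to `f ∘ suc`.
sum-indicator : ∀ {A : Set} {P : Pred A 0ℓ} (P? : Decidable₁ P) {n} (f : Fin n → A) →
                sum (indicator ∘ P? ∘ f) ≡ ℤ.+ length (filter P? (tabulate f)) ℚ./ 1
sum-indicator P? {zero}  f = refl
sum-indicator P? {suc n} f with P? (f zero)
... | yes _ = trans (cong (1ℚ ℚ.+_) (sum-indicator P? (f ∘ suc)))
  (sym (suc/1 (length (filter P? (tabulate (f ∘ suc))))))
... | no  _ = trans (ℚ.+-identityˡ _) (sum-indicator P? (f ∘ suc))

sum-nonNeg : ∀ {n} (t : Vector ℚ n) → (∀ i → 0ℚ ℚ.≤ t i) → 0ℚ ℚ.≤ sum t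
sum-nonNeg {zero}  t 0≤t = ℚ.≤-refl
sum-nonNeg {suc n} t 0≤t = ℚ.+-mono-≤ (0≤t zero) (sum-nonNeg (t ∘ suc) (0≤t ∘ suc))

term≤sum : ∀ {n} (t : Vector ℚ n) → (∀ i → 0ℚ ℚ.≤ t i) → ∀ i → t i ℚ.≤ sum t
term≤sum t 0≤t zero    = subst (ℚ._≤ sum t) (ℚ.+-identityʳ (t zero))
  (ℚ.+-monoʳ-≤ (t zero) (sum-nonNeg (t ∘ suc) (0≤t ∘ suc)))
term≤sum t 0≤t (suc i) = subst (ℚ._≤ sum t) (ℚ.+-identityˡ (t (suc i)))
  (ℚ.+-mono-≤ (0≤t zero) (term≤sum (t ∘ suc) (0≤t ∘ suc) i))

sum-neg : ∀ {n} (t : Vector ℚ n) → sum (ℚ.-_ ∘ t) ≡ ℚ.- sum t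
sum-neg {zero}  t = refl
sum-neg {suc n} t = trans (cong (ℚ.- t zero ℚ.+_) (sum-neg (t ∘ suc))) (sym (ℚ.neg-distrib-+ (t zero) _))

argmax : ∀ {n} (f : Fin n → ℚ) → Fin n → ∃[ i ] (∀ j → f j ℚ.≤ f i)
argmax {suc zero}    f _ = zero , λ { zero → ℚ.≤-refl }
argmax {suc (suc n)} f _ with argmax (f ∘ suc) zero
... | i , fj≤fi with ℚ.≤-total (f zero) (f (suc i))
... | inj₁ f0≤fi = suc i , λ { zero → f0≤fi ; (suc j) → fj≤fi j }
... | inj₂ fi≤f0 = zero , λ { zero → ℚ.≤-refl ; (suc j) → ℚ.≤-trans (fj≤fi j) fi≤f0 }

eventually-∀ : ∀ {n} {P : Fin n → Pred ℕ 0ℓ} → (∀ i → Eventually (P i)) → Eventually (λ m → ∀ i → P i m)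
eventually-∀ {zero}  ev = 0 , λ _ _ ()
eventually-∀ {suc n} ev = let (M , p) = ev zero ; (N , q) = eventually-∀ (ev ∘ suc) in
  M ⊔ N , λ m M⊔N≤m → λ
    { zero    → p m (ℕ.m⊔n≤o⇒m≤o M N M⊔N≤m)
    ; (suc i) → q m (ℕ.m⊔n≤o⇒n≤o M N M⊔N≤m) i }

-- The adjacency operator on rational vectors

module Spectrum (Γ : Graph) where
  open Graph Γ using (order; degree; _~_; _~?_)

  weight : Fin order → Fin order → ℚ
  weight i j = indicator (i ~? j)

  action : Vector ℚ order → Vector ℚ order
  action u i = sum λ j → weight i j ℚ.* u j

  seq-sumᴿ : ∀ {n} (t : Vector ℝ n) m → seq (sumᴿ t) m ≡ sum (λ j → seq (t j) m)
  seq-sumᴿ {zero}  t m = refl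
  seq-sumᴿ {suc n} t m = cong (seq (t zero) m ℚ.+_) (seq-sumᴿ (t ∘ suc) m)

  seq-*ᵛ : ∀ {n} (B : Matrix n) (w : Fin n → Fin n → ℚ) → (∀ i j m → seq (B i j) m ≡ w i j) →
           ∀ (u : Vector ℝ n) i m → seq ((B *ᵛ u) i) m ≡ sum (λ j → w i j ℚ.* seq (u j) m)
  seq-*ᵛ B w B≡w u i m = trans (seq-sumᴿ (λ j → B i j *ᴿ u j) m)
    (sum-cong-≗ {_} {λ j → seq (B i j) m ℚ.* seq (u j) m} {λ j → w i j ℚ.* seq (u j) m}
      (λ j → cong (ℚ._* seq (u j) m) (B≡w i j m)))

  seq-adjacencyMatrix : ∀ i j m → seq (Graph.adjacencyMatrix Γ i j) m ≡ weight i j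
  seq-adjacencyMatrix i j m = seq-if (does (i ~? j))
    where
    seq-if : ∀ b → seq (if b then 1ᴿ else 0ᴿ) m ≡ (if b then 1ℚ else 0ℚ)
    seq-if true  = refl
    seq-if false = refl

  seq-action : ∀ (u : Vector ℝ order) i m → seq ((Graph.adjacencyMatrix Γ *ᵛ u) i) m ≡ action (λ j → seq (u j) m) i
  seq-action = seq-*ᵛ (Graph.adjacencyMatrix Γ) weight seq-adjacencyMatrix

  rational-eigenvalue : ∀ (φ : Vector ℚ order) μ i → φ i ≡ 1ℚ → (∀ j → action φ j ≡ μ ℚ.* φ j) →
                        IsEigenvalue (Graph.adjacencyMatrix Γ) (fromℚ μ)
  rational-eigenvalue φ μ i φi≡1 eigen = fromℚ ∘ φ ,
    (i , inj₂ (1ℚ , ℚ.positive⁻¹ 1ℚ , 0 , λ _ _ → ℚ.≤-reflexive (sym φi≡1))) ,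
    λ j {ε} 0<ε → 0 , λ m _ → subst (λ d → ℚ.∣ d ∣ ℚ.≤ ε)
      (sym (trans (cong (ℚ._- (μ ℚ.* φ j)) (trans (seq-action (fromℚ ∘ φ) j m) (eigen j))) (ℚ.+-inverseʳ (μ ℚ.* φ j))))
      (ℚ.<⇒≤ 0<ε)

  action-vanishes : ∀ {φ i} → (∀ j → i ~ j → φ j ≡ 0ℚ) → action φ i ≡ 0ℚ
  action-vanishes {φ} {i} φ≡0 = trans (sum-cong-≗ {_} {λ j → weight i j ℚ.* φ j} {λ _ → 0ℚ} vanish)
                                      (sum-replicate-zero order)
    where
    vanish : ∀ j → weight i j ℚ.* φ j ≡ 0ℚ
    vanish j with i ~? j
    ... | yes i~j = trans (ℚ.*-identityˡ (φ j)) (φ≡0 j i~j)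
    ... | no  _   = ℚ.*-zeroˡ (φ j)

  action-supported-at : ∀ {φ i j} → i ~ j → (∀ l → i ~ l → l ≢ j → φ l ≡ 0ℚ) → action φ i ≡ φ j
  action-supported-at {φ} {i} {j} i~j φ≡0 = trans
    (sum-supported-at ℚ.+-0-commutativeMonoid (λ l → weight i l ℚ.* φ l) j vanish)
    (trans (cong (ℚ._* φ j) (indicator-true (i ~? j) i~j)) (ℚ.*-identityˡ (φ j)))
    where
    vanish : ∀ l → l ≢ j → weight i l ℚ.* φ l ≡ 0ℚ
    vanish l l≢j with i ~? l
    ... | yes i~l = trans (ℚ.*-identityˡ (φ l)) (φ≡0 l i~l l≢j)
    ... | no  _   = ℚ.*-zeroˡ (φ l)

  action-minus : ∀ φ ψ i → action (λ j → φ j ℚ.- ψ j) i ≡ action φ i ℚ.- action ψ i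
  action-minus φ ψ i = begin
    sum (λ j → weight i j ℚ.* (φ j ℚ.- ψ j))
      ≡⟨ sum-cong-≗ {_} {λ j → weight i j ℚ.* (φ j ℚ.- ψ j)} {λ j → weight i j ℚ.* φ j ℚ.+ ℚ.- (weight i j ℚ.* ψ j)}
           (λ j → solve 3 (λ w p q → w :* (p :- q) := w :* p :+ (:- (w :* q))) refl (weight i j) (φ j) (ψ j)) ⟩
    sum (λ j → weight i j ℚ.* φ j ℚ.+ ℚ.- (weight i j ℚ.* ψ j))
      ≡⟨ ∑-distrib-+ (λ j → weight i j ℚ.* φ j) (λ j → ℚ.- (weight i j ℚ.* ψ j)) ⟩
    action φ i ℚ.+ sum (λ j → ℚ.- (weight i j ℚ.* ψ j))
      ≡⟨ cong (action φ i ℚ.+_) (sum-neg (λ j → weight i j ℚ.* ψ j)) ⟩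
    action φ i ℚ.- action ψ i ∎
    where
    open ≡-Reasoning
    open +-*-Solver

  Pentagonal : Set
  Pentagonal = ∀ i → ∃₂ λ j₁ j₂ → ∃₂ λ j₃ j₄ → i ~ j₁ × j₁ ~ j₂ × j₂ ~ j₃ × j₃ ~ j₄ × j₄ ~ i

  total-weight : ∀ i → sum (weight i) ≡ ℤ.+ degree i ℚ./ 1
  total-weight i = sum-indicator (i ~?_) id

  -- A gap between eigenvalues and the negated degree

  module _ {K : ℚ} (total≡K : ∀ i → sum (weight i) ≡ K) (0≤K : 0ℚ ℚ.≤ K) where

    action-shift : ∀ V M i → sum (λ j → weight i j ℚ.* (V j ℚ.+ M)) ≡ action V i ℚ.+ K ℚ.* M
    action-shift V M i = begin
      sum (λ j → weight i j ℚ.* (V j ℚ.+ M))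
        ≡⟨ sum-cong-≗ (λ j → ℚ.*-distribˡ-+ (weight i j) (V j) M) ⟩
      sum (λ j → weight i j ℚ.* V j ℚ.+ weight i j ℚ.* M)
        ≡⟨ ∑-distrib-+ (λ j → weight i j ℚ.* V j) (λ j → weight i j ℚ.* M) ⟩
      action V i ℚ.+ sum (λ j → weight i j ℚ.* M)
        ≡⟨ cong (action V i ℚ.+_) (*-distribʳ-sum M (weight i)) ⟨
      action V i ℚ.+ sum (weight i) ℚ.* M
        ≡⟨ cong (λ s → action V i ℚ.+ s ℚ.* M) (total≡K i) ⟩
      action V i ℚ.+ K ℚ.* M ∎
      where
      open ≡-Reasoning
      open SemiringSum (CommutativeRing.semiring ℚ.+-*-commutativeRing) using (*-distribʳ-sum)

    -- As all M + V l are nonnegative, each of them is bounded by their sum over the neighbours of i,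
    -- which is about (K + G) M and hence small.
    sign-flip : ∀ {V M G ε η x x′ i j} →
      (∀ l → V l ℚ.≤ M) → (∀ l → ℚ.- V l ℚ.≤ M) → action V i ℚ.≤ G ℚ.* V i ℚ.+ ε →
      0ℚ ℚ.≤ M → 0ℚ ℚ.≤ η → G ℚ.≤ η ℚ.- K → ε ℚ.≤ η ℚ.* M → η ℚ.+ η ℚ.≤ x → x ℚ.≤ 1ℚ →
      x′ ≡ (1ℚ ℚ.+ K) ℚ.* x →
      M ℚ.- x ℚ.* M ℚ.≤ V i → i ~ j → M ℚ.- x′ ℚ.* M ℚ.≤ ℚ.- V j
    sign-flip {V} {M} {G} {ε} {η} {x} {_} {i} {j} V≤M -V≤M AV≤ 0≤M 0≤η G≤ ε≤ 2η≤x x≤1 refl near i~j =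
      p+q≤r⇒q-r≤-p (begin
        V j ℚ.+ M
          ≡⟨ ℚ.*-identityˡ (V j ℚ.+ M) ⟨
        1ℚ ℚ.* (V j ℚ.+ M)
          ≡⟨ cong (ℚ._* (V j ℚ.+ M)) (indicator-true (i ~? j) i~j) ⟨
        weight i j ℚ.* (V j ℚ.+ M)
          ≤⟨ term≤sum (λ l → weight i l ℚ.* (V l ℚ.+ M)) (λ l →
               subst (ℚ._≤ weight i l ℚ.* (V l ℚ.+ M)) (ℚ.*-zeroʳ (weight i l)) (*-monoˡ (0≤indicator (i ~? l)) (0≤V+M l))) j ⟩
        sum (λ l → weight i l ℚ.* (V l ℚ.+ M))
          ≡⟨ action-shift V M i ⟩
        action V i ℚ.+ K ℚ.* M
          ≤⟨ ℚ.+-monoˡ-≤ (K ℚ.* M) AV≤ ⟩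
        G ℚ.* V i ℚ.+ ε ℚ.+ K ℚ.* M
          ≤⟨ ℚ.+-monoˡ-≤ (K ℚ.* M) (ℚ.+-mono-≤ (*-monoʳ 0≤Vi G≤) ε≤) ⟩
        (η ℚ.- K) ℚ.* V i ℚ.+ η ℚ.* M ℚ.+ K ℚ.* M
          ≡⟨ solve 4 (λ η K v M → (η :- K) :* v :+ η :* M :+ K :* M := K :* (M :- v) :+ (η :* v :+ η :* M)) refl η K (V i) M ⟩
        K ℚ.* (M ℚ.- V i) ℚ.+ (η ℚ.* V i ℚ.+ η ℚ.* M)
          ≤⟨ ℚ.+-mono-≤ (*-monoˡ 0≤K (p-r≤q⇒p-q≤r {M} near)) (ℚ.+-monoˡ-≤ (η ℚ.* M) (*-monoˡ 0≤η (V≤M i))) ⟩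
        K ℚ.* (x ℚ.* M) ℚ.+ (η ℚ.* M ℚ.+ η ℚ.* M)
          -- One `η ℚ.* M` pays for the slack of `G` above `- K`, the other for `ε`; together they
          -- fit into `x ℚ.* M`.
          ≡⟨ cong (K ℚ.* (x ℚ.* M) ℚ.+_) (ℚ.*-distribʳ-+ M η η) ⟨
        K ℚ.* (x ℚ.* M) ℚ.+ (η ℚ.+ η) ℚ.* M
          ≤⟨ ℚ.+-monoʳ-≤ (K ℚ.* (x ℚ.* M)) (*-monoʳ 0≤M 2η≤x) ⟩
        K ℚ.* (x ℚ.* M) ℚ.+ x ℚ.* M
          ≡⟨ solve 3 (λ K x M → K :* (x :* M) :+ x :* M := (con 1ℚ :+ K) :* x :* M) refl K x M ⟩
        (1ℚ ℚ.+ K) ℚ.* x ℚ.* M ∎)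
      where
      open ℚ.≤-Reasoning
      open +-*-Solver
      0≤V+M : ∀ l → 0ℚ ℚ.≤ V l ℚ.+ M
      0≤V+M l = subst (ℚ._≤ V l ℚ.+ M) (ℚ.+-inverseʳ (V l)) (ℚ.+-monoʳ-≤ (V l) (-V≤M l))
      -- Because `x` is at most 1, `V i` is nonnegative and the upper bound on `G` may be multiplied
      -- by it.
      0≤Vi : 0ℚ ℚ.≤ V i
      0≤Vi = begin
        0ℚ              ≡⟨ ℚ.+-inverseʳ M ⟨
        M ℚ.- M
          ≤⟨ ℚ.+-monoʳ-≤ M (ℚ.neg-antimono-≤ (ℚ.≤-trans (*-monoʳ 0≤M x≤1) (ℚ.≤-reflexive (ℚ.*-identityˡ M)))) ⟩
        M ℚ.- x ℚ.* M   ≤⟨ near ⟩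
        V i             ∎

    module _ {κ : ℚ} (0<κ : 0ℚ ℚ.< κ) ([1+K]κ≡1 : (1ℚ ℚ.+ K) ℚ.* κ ≡ 1ℚ) where

      κ≤1 : κ ℚ.≤ 1ℚ
      κ≤1 = begin
        κ                        ≡⟨ ℚ.+-identityʳ κ ⟨
        κ ℚ.+ 0ℚ
          ≤⟨ ℚ.+-monoʳ-≤ κ (subst (ℚ._≤ K ℚ.* κ) (ℚ.*-zeroˡ κ) (*-monoʳ (ℚ.<⇒≤ 0<κ) 0≤K)) ⟩
        κ ℚ.+ K ℚ.* κ            ≡⟨ solve 2 (λ κ K → κ :+ K :* κ := (con 1ℚ :+ K) :* κ) refl κ K ⟩
        (1ℚ ℚ.+ K) ℚ.* κ         ≡⟨ [1+K]κ≡1 ⟩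
        1ℚ                       ∎
        where
        open ℚ.≤-Reasoning
        open +-*-Solver

      -- Each sign flip enlarges the relative error by the factor `1 + K`, so the admissible errors
      -- are powers of its inverse `κ`.
      κ^ : ℕ → ℚ
      κ^ zero    = 1ℚ
      κ^ (suc s) = κ ℚ.* κ^ s

      0<κ^ : ∀ s → 0ℚ ℚ.< κ^ s
      0<κ^ zero    = ℚ.positive⁻¹ 1ℚ
      0<κ^ (suc s) = *-pos 0<κ (0<κ^ s)

      κ^-antitone : ∀ s t → κ^ (s ℕ.+ t) ℚ.≤ κ^ t
      κ^-antitone zero    t = ℚ.≤-refl
      κ^-antitone (suc s) t = ℚ.≤-trans (*-monoʳ (ℚ.<⇒≤ (0<κ^ (s ℕ.+ t))) κ≤1)
        (subst (ℚ._≤ κ^ t) (sym (ℚ.*-identityˡ (κ^ (s ℕ.+ t)))) (κ^-antitone s t))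

      κ^-step : ∀ s → κ^ s ≡ (1ℚ ℚ.+ K) ℚ.* κ^ (suc s)
      κ^-step s = sym (trans (sym (ℚ.*-assoc (1ℚ ℚ.+ K) κ (κ^ s)))
        (trans (cong (ℚ._* κ^ s) [1+K]κ≡1) (ℚ.*-identityˡ (κ^ s))))

      -- Five flips take the relative error from `κ^ 5` to 1. The half is there because `sign-flip`
      -- spends `η` twice.
      η : ℚ
      η = ½ ℚ.* κ^ 5

      0<η : 0ℚ ℚ.< η
      0<η = ½-pos (0<κ^ 5)

      neg-neg : ∀ p → ℚ.- (ℚ.- p) ≡ p
      neg-neg = solve 1 (λ p → :- (:- p) := p) refl
        where open +-*-Solver

      action-neg : ∀ V j → action (ℚ.-_ ∘ V) j ≡ ℚ.- action V j
      action-neg V j = trans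
        (sum-cong-≗ {_} {λ l → weight j l ℚ.* ℚ.- V l} {λ l → ℚ.- (weight j l ℚ.* V l)}
          (λ l → sym (ℚ.neg-distribʳ-* (weight j l) (V l))))
        (sum-neg (λ l → weight j l ℚ.* V l))

      module _ (pentagonal : Pentagonal) {M G ε : ℚ} (0<M : 0ℚ ℚ.< M) (ε≤ηM : ε ℚ.≤ η ℚ.* M) where

        Bounded AlmostEigenvector : Vector ℚ order → Set
        Bounded V           = ∀ j → ℚ.∣ V j ∣ ℚ.≤ M
        AlmostEigenvector V = ∀ j → ℚ.∣ action V j ℚ.- G ℚ.* V j ∣ ℚ.≤ ε

        bounded-neg : ∀ {V} → Bounded V → Bounded (ℚ.-_ ∘ V)
        bounded-neg {V} bounded j = subst (ℚ._≤ M) (sym (ℚ.∣-p∣≡∣p∣ (V j))) (bounded j)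

        almostEigenvector-neg : ∀ {V} → AlmostEigenvector V → AlmostEigenvector (ℚ.-_ ∘ V)
        almostEigenvector-neg {V} almost j = subst (ℚ._≤ ε)
          (trans (sym (ℚ.∣-p∣≡∣p∣ (action V j ℚ.- G ℚ.* V j))) (cong ℚ.∣_∣ (trans
            (solve 3 (λ a g v → :- (a :- g :* v) := (:- a) :- g :* (:- v)) refl (action V j) G (V j))
            (cong (ℚ._- (G ℚ.* ℚ.- V j)) (sym (action-neg V j))))))
          (almost j)
          where open +-*-Solver

        module _ (G≤η-K : G ℚ.≤ η ℚ.- K) where

          -- The exponent counts the flips still to come. Alternating between `V` and its negative
          -- follows the sign along a walk.
          flip : ∀ s {V i j} → Bounded V → AlmostEigenvector V → κ^ 5 ℚ.≤ κ^ (suc s) →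
                 M ℚ.- κ^ (suc s) ℚ.* M ℚ.≤ V i → i ~ j → M ℚ.- κ^ s ℚ.* M ℚ.≤ ℚ.- V j
          flip s {V} {i} bounded almost κ⁵≤ = sign-flip {V} {M} {G} {ε} {η} {κ^ (suc s)}
            (λ l → ℚ.≤-trans (p≤∣p∣ (V l)) (bounded l))
            (λ l → ℚ.≤-trans (p≤∣p∣ (ℚ.- V l)) (bounded-neg {V} bounded l))
            (subst (action V i ℚ.≤_) (ℚ.+-comm ε (G ℚ.* V i))
              (p-q≤r⇒p≤r+q (ℚ.≤-trans (p≤∣p∣ (action V i ℚ.- G ℚ.* V i)) (almost i))))
            (ℚ.<⇒≤ 0<M) (ℚ.<⇒≤ 0<η) G≤η-K ε≤ηM
            (subst (ℚ._≤ κ^ (suc s)) (sym (½*ε+½*ε≡ε (κ^ 5))) κ⁵≤)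
            (subst (λ t → κ^ t ℚ.≤ 1ℚ) (ℕ.+-identityʳ (suc s)) (κ^-antitone (suc s) 0))
            (κ^-step s)

          -- Five sign flips around a pentagon lead from M at i to a value V i ≤ 0, as the error term
          -- grows from κ⁵ M only to M.
          no-extremum : ∀ {V i} → Bounded V → AlmostEigenvector V → V i ≢ M
          no-extremum {V} {i} bounded almost Vi≡M =
            let (j₁ , j₂ , j₃ , j₄ , i~j₁ , j₁~j₂ , j₂~j₃ , j₃~j₄ , j₄~i) = pentagonal i
                near₁ = flip 4 {V} bounded almost ℚ.≤-refl near₀ i~j₁
                near₂ = flip 3 {ℚ.-_ ∘ V} bounded′ almost′ (κ^-antitone 1 4) near₁ j₁~j₂
                near₃ = flip 2 {V} bounded almost (κ^-antitone 2 3) (unneg near₂) j₂~j₃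
                near₄ = flip 1 {ℚ.-_ ∘ V} bounded′ almost′ (κ^-antitone 3 2) near₃ j₃~j₄
                near₅ = flip 0 {V} bounded almost (κ^-antitone 4 1) (unneg near₄) j₄~i
            in ℚ.<-irrefl refl (ℚ.<-≤-trans 0<M (begin
              M                       ≡⟨ neg-neg M ⟨
              ℚ.- (ℚ.- M)             ≡⟨ cong (λ v → ℚ.- (ℚ.- v)) Vi≡M ⟨
              ℚ.- (ℚ.- V i)           ≤⟨ ℚ.neg-antimono-≤ near₅ ⟩
              ℚ.- (M ℚ.- 1ℚ ℚ.* M)    ≡⟨ solve 1 (λ M → :- (M :- con 1ℚ :* M) := con 0ℚ) refl M ⟩
              0ℚ                      ∎))
            where
            open ℚ.≤-Reasoning
            open +-*-Solver
            bounded′ = bounded-neg {V} bounded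
            almost′  = almostEigenvector-neg {V} almost
            unneg : ∀ {p q} → p ℚ.≤ ℚ.- (ℚ.- q) → p ℚ.≤ q
            unneg {p} {q} = subst (p ℚ.≤_) (neg-neg q)
            near₀ : M ℚ.- κ^ 5 ℚ.* M ℚ.≤ V i
            near₀ = begin
              M ℚ.- κ^ 5 ℚ.* M   ≤⟨ ℚ.+-monoʳ-≤ M (ℚ.neg-antimono-≤ (ℚ.<⇒≤ (*-pos (0<κ^ 5) 0<M))) ⟩
              M ℚ.- 0ℚ           ≡⟨ solve 1 (λ M → M :- con 0ℚ := M) refl M ⟩
              M                  ≡⟨ Vi≡M ⟨
              V i                ∎

        -- The opposite inequality would contradict `no-extremum`, applied to `V` or to its negative
        -- according to the sign of the entry of modulus `M`.
        almostEigenvalue-bound : ∀ {V i} → Bounded V → AlmostEigenvector V → ℚ.∣ V i ∣ ≡ M → η ℚ.- K ℚ.≤ G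
        almostEigenvalue-bound {V} {i} bounded almost ∣Vi∣≡M with ℚ.≤-total (η ℚ.- K) G
        ... | inj₁ η-K≤G = η-K≤G
        ... | inj₂ G≤η-K with ℚ.∣p∣≡p∨∣p∣≡-p (V i)
        ...   | inj₁ ∣Vi∣≡Vi  = ⊥-elim (no-extremum G≤η-K {V} bounded almost (trans (sym ∣Vi∣≡Vi) ∣Vi∣≡M))
        ...   | inj₂ ∣Vi∣≡-Vi = ⊥-elim (no-extremum G≤η-K {ℚ.-_ ∘ V} (bounded-neg {V} bounded)
                                  (almostEigenvector-neg {V} almost) (trans (sym ∣Vi∣≡-Vi) ∣Vi∣≡M))

      -- The argument runs at each large index `m` separately, on the rational vector of `m`-th
      -- terms. Its maximal modulus is at least the `δ` bounding `u i₀` away from 0, so an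
      -- eigenvector error of `η ℚ.* δ` is small enough even though the maximal vertex may vary with
      -- `m`.
      eigenvalue-bound : Pentagonal → ∀ {γ} → IsEigenvalue (Graph.adjacencyMatrix Γ) γ →
                         Eventually (λ m → η ℚ.- K ℚ.≤ seq γ m)
      eigenvalue-bound pentagonal {γ} (u , (i₀ , u#0) , eigen) =
        let (δ , 0<δ , N₁ , away) = #0⇒bounded-away {u i₀} u#0
            (N₂ , almost) = eventually-∀ (λ j → eigen j (*-pos 0<η 0<δ))
        in N₁ ⊔ N₂ , λ m N≤m →
          let U        = λ j → seq (u j) m
              (i , maximal) = argmax (λ j → ℚ.∣ U j ∣) i₀
              δ≤M      = ℚ.≤-trans (away m (ℕ.m⊔n≤o⇒m≤o N₁ N₂ N≤m)) (maximal i₀)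
          in almostEigenvalue-bound pentagonal {ℚ.∣ U i ∣} {seq γ m} {η ℚ.* δ}
               (ℚ.<-≤-trans 0<δ δ≤M) (*-monoˡ (ℚ.<⇒≤ 0<η) δ≤M) {U} {i} maximal
               (λ j → subst (λ a → ℚ.∣ a ℚ.- seq γ m ℚ.* U j ∣ ℚ.≤ η ℚ.* δ) (seq-action u j m)
                        (almost m (ℕ.m⊔n≤o⇒n≤o N₁ N₂ N≤m) j))
               refl

-- The graph of secants

module _ (S : DecSetoid 0ℓ 0ℓ) where
  open DecSetoid S using (Carrier; _≈_) renaming (sym to ≈-sym)

  unique⇒lookup-injective : ∀ {xs : List Carrier} → Unique S xs → ∀ i j → lookup xs i ≈ lookup xs j → i ≡ j
  unique⇒lookup-injective {x ∷ xs} (x≉xs ∷ _)  zero    zero    _     = refl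
  unique⇒lookup-injective {x ∷ xs} (x≉xs ∷ _)  zero    (suc j) x≈xⱼ  =
    contradiction x≈xⱼ (All.lookup x≉xs (∈-lookup j))
  unique⇒lookup-injective {x ∷ xs} (x≉xs ∷ _)  (suc i) zero    xᵢ≈x  =
    contradiction (≈-sym xᵢ≈x) (All.lookup x≉xs (∈-lookup i))
  unique⇒lookup-injective {x ∷ xs} (_ ∷ unique) (suc i) (suc j) xᵢ≈xⱼ =
    cong suc (unique⇒lookup-injective unique i j xᵢ≈xⱼ)

module SecantGraph (F : HeytingField 0ℓ 0ℓ 0ℓ) {q : ℕ} (∣F∣≡q : HasOrder F q)
                   (𝓞 : PG2.NonDegenerateConic F ∣F∣≡q) where
  open PG2 F ∣F∣≡q
  open HeytingField F using (_≈_; 0#; _*_; _+_) renaming (trans to ≈-trans)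
  open FieldSolver using (fromℤ)
  open Conic F ∣F∣≡q 𝓞

  Γ : Graph
  Γ = secantGraph 𝓞

  order : ℕ
  order = Graph.order Γ

  infix 4 _~_
  _~_ : Fin order → Fin order → Set
  _~_ = Graph._~_ Γ

  line : Fin order → Line
  line i = proj₁ (lookup (secantLines 𝓞) i)

  ⟦_⟧ : Fin order → Triple
  ⟦ i ⟧ = proj₁ (line i)

  line-isSecant : ∀ i → IsSecant 𝓞 (line i)
  line-isSecant i = proj₂ (lookup (secantLines 𝓞) i)

  line-injective : ∀ {i j} → line i ≋ line j → i ≡ j
  line-injective {i} {j} = unique⇒lookup-injective (secantDecSetoid 𝓞) (secantLines-unique 𝓞) i j

  line-surjective : ∀ ℓ → IsSecant 𝓞 ℓ → ∃[ i ] ℓ ≋ line i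
  line-surjective ℓ sec = Any.index ℓ∈ , Any.lookup-index ℓ∈
    where
    ℓ∈ : Any (λ m → ℓ ≋ proj₁ m) (secantLines 𝓞)
    ℓ∈ = secantLines-complete 𝓞 (ℓ , sec)

  line-norm : ∀ i → NegatedSquare (D ⟦ i ⟧ ⟦ i ⟧)
  line-norm i = isSecant⇒D≈-square (line i) (line-isSecant i)

  line-norm≉0 : ∀ i → ¬ (D ⟦ i ⟧ ⟦ i ⟧ ≈ 0#)
  line-norm≉0 i = isSecant⇒D≉0 (line i) (line-isSecant i)

  ~⇒D≈0 : ∀ {i j} → i ~ j → D ⟦ j ⟧ ⟦ i ⟧ ≈ 0#
  ~⇒D≈0 {i} {j} (_ , conj) = conjugate⇒D≈0 (line i) (line j) conj

  -- Distinctness is automatic: proportional lines would give `line i` norm 0, but a secant has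
  -- nonzero norm.
  D≈0⇒~ : ∀ {i j} → D ⟦ j ⟧ ⟦ i ⟧ ≈ 0# → i ~ j
  D≈0⇒~ {i} {j} D≈0 =
    (λ i∼j → line-norm≉0 i (D-resp-≈0 i∼j ∼-refl D≈0)) ,
    D≈0⇒conjugate (line i) (line j) (line-norm≉0 i) D≈0

  triangle-free : (∀ x y → x * x + y * y ≈ 0# → y ≈ 0#) → ∀ {i j l} → i ~ j → i ~ l → j ~ l → ⊥
  triangle-free anisotropic {i} {j} {l} i~j i~l j~l =
    no-self-polar-triangle anisotropic (line-norm i) (line-norm j) (line-norm l)
      (≈-trans (D-comm ⟦ i ⟧ ⟦ j ⟧) (~⇒D≈0 i~j)) (≈-trans (D-comm ⟦ i ⟧ ⟦ l ⟧) (~⇒D≈0 i~l)) (~⇒D≈0 j~l)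

  module _ (11≈0 : fromℤ (ℤ.+ 11) ≈ 0#) where
    private
      char≠2 : ¬ (fromℤ (ℤ.+ 2) ≈ 0#)
      char≠2 = 2≉0 11≈0

    chord-index : (C : Chord) → ∃[ i ] Chord.coefficients C ∼ ⟦ i ⟧
    chord-index C = line-surjective (Chord.line C) (Chord.isSecant C char≠2)

    pentagonal : Spectrum.Pentagonal Γ
    pentagonal i =
      let (C₀ , i∼C₀) = isSecant⇒chord (line i) (line-isSecant i)
          (j₁ , C₁∼j₁) = chord-index (chord₁ 11≈0 C₀)
          (j₂ , C₂∼j₂) = chord-index (chord₂ 11≈0 C₀)
          (j₃ , C₃∼j₃) = chord-index (chord₃ 11≈0 C₀)
          (j₄ , C₄∼j₄) = chord-index (chord₄ 11≈0 C₀)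
      in j₁ , j₂ , j₃ , j₄ ,
         D≈0⇒~ (D-resp-≈0 (∼-sym C₁∼j₁) i∼C₀ (D₀₁ 11≈0 C₀)) ,
         D≈0⇒~ (D-resp-≈0 (∼-sym C₂∼j₂) (∼-sym C₁∼j₁) (D₁₂ 11≈0 C₀)) ,
         D≈0⇒~ (D-resp-≈0 (∼-sym C₃∼j₃) (∼-sym C₂∼j₂) (D₂₃ 11≈0 C₀)) ,
         D≈0⇒~ (D-resp-≈0 (∼-sym C₄∼j₄) (∼-sym C₃∼j₃) (D₃₄ 11≈0 C₀)) ,
         Graph.~-sym Γ {i} {j₄} (D≈0⇒~ (D-resp-≈0 (∼-sym C₄∼j₄) i∼C₀ (D₄₀ 11≈0 C₀)))

    incidence : Triple → Vector ℚ order
    incidence x j = indicator ((x ∙ ⟦ j ⟧) ≟ 0#)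

    module _ {x : Triple} (x≉0 : NonZero x) (x∈𝓞 : Isotropic x) where

      -- A neighbour of a line passes through its pole, and there is exactly one secant joining
      -- this pole to x, unless x lies on the line and that join is the tangent at x.
      action-incidence : ∀ i → Spectrum.action Γ (incidence x) i ≡ 1ℚ ℚ.- incidence x i
      action-incidence i = by-cases ((x ∙ ⟦ i ⟧) ≟ 0#) on off
        where
        by-cases : ∀ {P X : Set} → Dec P → (P → X) → (¬ P → X) → X
        by-cases (yes p) f g = f p
        by-cases (no ¬p) f g = g ¬p

        on : x ∙ ⟦ i ⟧ ≈ 0# → Spectrum.action Γ (incidence x) i ≡ 1ℚ ℚ.- incidence x i
        on x∈i = trans
          (Spectrum.action-vanishes Γ {incidence x} {i} λ j i~j → indicator-false ((x ∙ ⟦ j ⟧) ≟ 0#)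
            (tangent-at-common-point {x} {⟦ i ⟧} {⟦ j ⟧} x≉0 x∈𝓞 (line-norm≉0 i) (line-norm≉0 j) x∈i (~⇒D≈0 {i} {j} i~j)))
          (cong (λ t → 1ℚ ℚ.- t) (sym (indicator-true ((x ∙ ⟦ i ⟧) ≟ 0#) x∈i)))

        off : ¬ (x ∙ ⟦ i ⟧ ≈ 0#) → Spectrum.action Γ (incidence x) i ≡ 1ℚ ℚ.- incidence x i
        off x∉i = trans
          (trans (Spectrum.action-supported-at Γ {incidence x} {i} {j} i~j λ l i~l l≢j →
                   indicator-false ((x ∙ ⟦ l ⟧) ≟ 0#) (λ x∈l → l≢j (line-injective {l} {j}
                     (∼-trans (through (proj₂ (line l)) x∈l (~⇒D≈0 {i} {l} i~l)) C∼j))))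
                 (indicator-true ((x ∙ ⟦ j ⟧) ≟ 0#) x∈j))
          (cong (λ t → 1ℚ ℚ.- t) (sym (indicator-false ((x ∙ ⟦ i ⟧) ≟ 0#) x∉i)))
          where
          polar = secant-through-pole char≠2 {x} {⟦ i ⟧} x∈𝓞 x∉i (line-norm≉0 i)
          C = proj₁ polar
          x≡p = proj₁ (proj₂ polar)
          D≈0 = proj₁ (proj₂ (proj₂ polar))
          through : ∀ {v} → NonZero v → x ∙ v ≈ 0# → D v ⟦ i ⟧ ≈ 0# → v ∼ Chord.coefficients C
          through = proj₂ (proj₂ (proj₂ polar))
          j = proj₁ (chord-index C)
          C∼j = proj₂ (chord-index C)
          i~j : i ~ j
          i~j = D≈0⇒~ {i} {j} (D-resp-≈0 (∼-sym C∼j) ∼-refl D≈0)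
          x∈j : x ∙ ⟦ j ⟧ ≈ 0#
          x∈j = ∈-resp {x , x≉0} {x , x≉0} {Chord.line C} {line j} ∼-refl C∼j
            (subst (λ p → p ∙ Chord.coefficients C ≈ 0#) x≡p (⨯-orthogonalˡ (Chord.p C) (Chord.r C)))

    -- The constant 1 in `action-incidence` cancels between two points. Choosing one on `line i` and
    -- one off it makes the difference equal to 1 at `i`.
    -1-eigenvector : ∀ i → ∃[ φ ] φ i ≡ 1ℚ × (∀ j → Spectrum.action Γ φ j ≡ ℚ.- 1ℚ ℚ.* φ j)
    -1-eigenvector i = φ , φi≡1 , eigen
      where
      C    = proj₁ (isSecant⇒chord (line i) (line-isSecant i))
      i∼C  = proj₂ (isSecant⇒chord (line i) (line-isSecant i))
      open Chord C using (p; p≉0; p∈𝓞; coefficients)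

      third = third-point 11≈0 C
      x    = proj₁ third
      x∈𝓞  = proj₁ (proj₂ third)
      x≉0  = proj₁ (proj₂ (proj₂ third))
      x∉C  = proj₂ (proj₂ (proj₂ third))

      p∈i : p ∙ ⟦ i ⟧ ≈ 0#
      p∈i = ∈-resp {p , p≉0} {p , p≉0} {Chord.line C} {line i} ∼-refl (∼-sym i∼C) (⨯-orthogonalˡ p (Chord.r C))

      x∉i : ¬ (x ∙ ⟦ i ⟧ ≈ 0#)
      x∉i x∈i = x∉C (∈-resp {x , x≉0} {x , x≉0} {line i} {Chord.line C} ∼-refl i∼C x∈i)

      φ : Vector ℚ order
      φ j = incidence p j ℚ.- incidence x j

      φi≡1 : φ i ≡ 1ℚ
      φi≡1 = cong₂ ℚ._-_ (indicator-true ((p ∙ ⟦ i ⟧) ≟ 0#) p∈i) (indicator-false ((x ∙ ⟦ i ⟧) ≟ 0#) x∉i)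

      eigen : ∀ j → Spectrum.action Γ φ j ≡ ℚ.- 1ℚ ℚ.* φ j
      eigen j = trans (Spectrum.action-minus Γ (incidence p) (incidence x) j)
        (trans (cong₂ ℚ._-_ (action-incidence {p} p≉0 p∈𝓞 j) (action-incidence {x} x≉0 x∈𝓞 j))
          (solve 2 (λ a b → (con 1ℚ :- a) :- (con 1ℚ :- b) := (:- con 1ℚ) :* (a :- b)) refl (incidence p j) (incidence x j)))
        where open +-*-Solver

-- The clique adjacency bound and the Delsarte bound

disjoint⇒commonNeighbours≡0 : ∀ Γ → let open Graph Γ in
  ∀ {i j} → (∀ l → i ~ l → j ~ l → ⊥) → commonNeighbours i j ≡ 0
disjoint⇒commonNeighbours≡0 Γ {i} {j} disjoint = cong length
  (filter-none (λ l → (i ~? l) ×-dec (j ~? l)) (All.universal (λ l (i~l , j~l) → disjoint l i~l j~l) (allFin order)))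
  where open Graph Γ

-- At x = 0 the clique adjacency polynomial is s (s - 1) (λ - s + 2), which is negative for s = λ + 3.
triangle-free⇒CAP≤2 : ∀ Γ → let open Graph Γ in
  ∀ {i j c} → i ~ j → (∀ l → i ~ l → j ~ l → ⊥) → IsCAPBound Γ c → c ℕ.≤ 2
triangle-free⇒CAP≤2 Γ {i} {j} {c} i~j disjoint (v , k , λ′ , (_ , _ , edgeRegular) , _ , least) =
  ℕ.s≤s⁻¹ (least 3 (s≤s (s≤s z≤n)) (subst (λ λ″ → RulesOutCliques v k λ″ 3) 0≡λ′ (ℤ.+ 0 , ℤ.-<+)))
  where
  0≡λ′ : 0 ≡ λ′
  0≡λ′ = trans (sym (disjoint⇒commonNeighbours≡0 Γ {i} {j} disjoint)) (edgeRegular i j i~j)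

c≤2⇒c/1≤2 : ∀ {c} → c ℕ.≤ 2 → ℤ.+ c ℚ./ 1 ℚ.≤ 1ℚ ℚ.+ 1ℚ
c≤2⇒c/1≤2 {0} _ = from-yes (ℤ.+ 0 ℚ./ 1 ℚ.≤? 1ℚ ℚ.+ 1ℚ)
c≤2⇒c/1≤2 {1} _ = from-yes (ℤ.+ 1 ℚ./ 1 ℚ.≤? 1ℚ ℚ.+ 1ℚ)
c≤2⇒c/1≤2 {2} _ = from-yes (ℤ.+ 2 ℚ./ 1 ℚ.≤? 1ℚ ℚ.+ 1ℚ)
c≤2⇒c/1≤2 {suc (suc (suc _))} (s≤s (s≤s ()))

-- The hypothesis is only a negation, so one good approximation of `γ` is compared with a rational.
-- With `δ` a third of `b - a`, being below `a + 2δ` keeps all later terms below `b`, while being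
-- above it keeps them above `a + δ`, which the hypothesis excludes.
≤ᴿ⇒eventually-≤ : ∀ {γ a b} → γ ≤ᴿ fromℚ a → a ℚ.< b → Eventually (λ m → seq γ m ℚ.≤ b)
≤ᴿ⇒eventually-≤ {γ} {a} {b} γ≤a a<b = conclude (ℚ.≤-total (seq γ N) (a ℚ.+ (δ ℚ.+ δ)))
  where
  open ℚ.≤-Reasoning
  open +-*-Solver

  third : ℚ
  third = ℤ.+ 1 ℚ./ 3

  δ : ℚ
  δ = third ℚ.* (b ℚ.- a)

  0<δ : 0ℚ ℚ.< δ
  0<δ = *-pos {third} (ℚ.positive⁻¹ third)
    (subst (ℚ._< b ℚ.- a) (ℚ.+-inverseʳ a) (ℚ.+-monoˡ-< (ℚ.- a) a<b))

  N = proj₁ (cauchy γ 0<δ)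

  close : ∀ m n → N ℕ.≤ m → N ℕ.≤ n → seq γ m ℚ.≤ δ ℚ.+ seq γ n
  close m n N≤m N≤n = p-q≤r⇒p≤r+q (ℚ.≤-trans (p≤∣p∣ (seq γ m ℚ.- seq γ n)) (proj₂ (cauchy γ 0<δ) m n N≤m N≤n))

  conclude : seq γ N ℚ.≤ a ℚ.+ (δ ℚ.+ δ) ⊎ a ℚ.+ (δ ℚ.+ δ) ℚ.≤ seq γ N → Eventually (λ m → seq γ m ℚ.≤ b)
  conclude (inj₁ γN≤) = N , λ m N≤m → begin
    seq γ m                     ≤⟨ close m N N≤m ℕ.≤-refl ⟩
    δ ℚ.+ seq γ N               ≤⟨ ℚ.+-monoʳ-≤ δ γN≤ ⟩
    δ ℚ.+ (a ℚ.+ (δ ℚ.+ δ))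
      ≡⟨ solve 2 (λ a b → let δ = con third :* (b :- a) in δ :+ (a :+ (δ :+ δ)) := b) refl a b ⟩
    b                           ∎
  conclude (inj₂ ≤γN) = contradiction (δ , 0<δ , N , λ m N≤m → (begin
    a ℚ.+ δ                           ≡⟨ solve 2 (λ a δ → a :+ δ := a :+ (δ :+ δ) :+ (:- δ)) refl a δ ⟩
    a ℚ.+ (δ ℚ.+ δ) ℚ.- δ             ≤⟨ ℚ.+-monoˡ-≤ (ℚ.- δ) (ℚ.≤-trans ≤γN (close N m ℕ.≤-refl N≤m)) ⟩
    δ ℚ.+ seq γ m ℚ.- δ               ≡⟨ solve 2 (λ δ g → δ :+ g :- δ := g) refl δ (seq γ m) ⟩
    seq γ m                           ∎)) γ≤a

module _ {K η κ : ℚ} (0<η : 0ℚ ℚ.< η) (0<κ : 0ℚ ℚ.< κ) ([1+K]κ≡1 : (1ℚ ℚ.+ K) ℚ.* κ ≡ 1ℚ) where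

  -- With `s` the negated reciprocal of `g`, the right-hand side is `1 + s (K + g)`. Here `K + g` is
  -- at least `η`, and `s` is at least `κ` because `- g` is at most `1 + K`.
  ratio-bound : ∀ {g} → η ℚ.- K ℚ.≤ g → g ℚ.< 0ℚ → 1ℚ ℚ.+ κ ℚ.* η ℚ.≤ ℚ.- (K ℚ.* reciprocal g)
  ratio-bound {g} η-K≤g g<0 = begin
    1ℚ ℚ.+ κ ℚ.* η                ≤⟨ ℚ.+-monoʳ-≤ 1ℚ (*-mono-≤-nonNeg (ℚ.<⇒≤ 0<η) 0≤s κ≤s η≤K+g) ⟩
    1ℚ ℚ.+ s ℚ.* (K ℚ.+ g)
      ≡⟨ solve 3 (λ r K g → con 1ℚ :+ (:- r) :* (K :+ g) := :- (K :* r) :+ (con 1ℚ :- g :* r)) refl r K g ⟩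
    ℚ.- (K ℚ.* r) ℚ.+ (1ℚ ℚ.- g ℚ.* r)  ≡⟨ cong (λ t → ℚ.- (K ℚ.* r) ℚ.+ (1ℚ ℚ.- t)) gr≡1 ⟩
    ℚ.- (K ℚ.* r) ℚ.+ (1ℚ ℚ.- 1ℚ)       ≡⟨ ℚ.+-identityʳ (ℚ.- (K ℚ.* r)) ⟩
    ℚ.- (K ℚ.* r)                 ∎
    where
    open ℚ.≤-Reasoning
    open +-*-Solver
    r s : ℚ
    r = reciprocal g
    s = ℚ.- r

    gr≡1 : g ℚ.* r ≡ 1ℚ
    gr≡1 = reciprocal-inverseʳ (ℚ.<⇒≢ g<0)

    [-g]s≡1 : (ℚ.- g) ℚ.* s ≡ 1ℚ
    [-g]s≡1 = trans (solve 2 (λ g r → (:- g) :* (:- r) := g :* r) refl g r) gr≡1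

    0≤-g : 0ℚ ℚ.≤ ℚ.- g
    0≤-g = ℚ.neg-antimono-≤ (ℚ.<⇒≤ g<0)

    0≤s : 0ℚ ℚ.≤ s
    0≤s with ℚ.≤-total 0ℚ s
    ... | inj₁ 0≤s = 0≤s
    ... | inj₂ s≤0 = contradiction (ℚ.<-≤-trans (ℚ.positive⁻¹ 1ℚ) (begin
      1ℚ                ≡⟨ [-g]s≡1 ⟨
      (ℚ.- g) ℚ.* s     ≤⟨ *-monoˡ 0≤-g s≤0 ⟩
      (ℚ.- g) ℚ.* 0ℚ    ≡⟨ ℚ.*-zeroʳ (ℚ.- g) ⟩
      0ℚ                ∎)) (ℚ.<-irrefl refl)

    η≤K+g : η ℚ.≤ K ℚ.+ g
    η≤K+g = subst (η ℚ.≤_) (ℚ.+-comm g K) (p-q≤r⇒p≤r+q η-K≤g)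

    -g≤1+K : ℚ.- g ℚ.≤ 1ℚ ℚ.+ K
    -g≤1+K = begin
      ℚ.- g                       ≤⟨ ℚ.neg-antimono-≤ η-K≤g ⟩
      ℚ.- (η ℚ.- K)               ≡⟨ solve 2 (λ η K → :- (η :- K) := :- η :+ K) refl η K ⟩
      ℚ.- η ℚ.+ K
        ≤⟨ ℚ.+-monoˡ-≤ K (ℚ.≤-trans (ℚ.neg-antimono-≤ (ℚ.<⇒≤ 0<η)) (ℚ.<⇒≤ (ℚ.positive⁻¹ 1ℚ))) ⟩
      1ℚ ℚ.+ K                    ∎

    κ≤s : κ ℚ.≤ s
    κ≤s = begin
      κ                              ≡⟨ ℚ.*-identityˡ κ ⟨
      1ℚ ℚ.* κ                       ≡⟨ cong (ℚ._* κ) [-g]s≡1 ⟨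
      (ℚ.- g) ℚ.* s ℚ.* κ            ≡⟨ solve 3 (λ g s κ → g :* s :* κ := g :* (s :* κ)) refl (ℚ.- g) s κ ⟩
      (ℚ.- g) ℚ.* (s ℚ.* κ)
        ≤⟨ *-monoʳ (subst (ℚ._≤ s ℚ.* κ) (ℚ.*-zeroˡ κ) (*-monoʳ (ℚ.<⇒≤ 0<κ) 0≤s)) -g≤1+K ⟩
      (1ℚ ℚ.+ K) ℚ.* (s ℚ.* κ)
        ≡⟨ solve 3 (λ k s κ → k :* (s :* κ) := k :* κ :* s) refl (1ℚ ℚ.+ K) s κ ⟩
      (1ℚ ℚ.+ K) ℚ.* κ ℚ.* s         ≡⟨ cong (ℚ._* s) [1+K]κ≡1 ⟩
      1ℚ ℚ.* s                       ≡⟨ ℚ.*-identityˡ s ⟩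
      s                              ∎

c<delsarteBound : ∀ {c k κ η γ} → c ℕ.≤ 2 → let K = ℤ.+ k ℚ./ 1 in
  0ℚ ℚ.< η → 0ℚ ℚ.< κ → (1ℚ ℚ.+ K) ℚ.* κ ≡ 1ℚ →
  Eventually (λ m → η ℚ.- K ℚ.≤ seq γ m) → γ ≤ᴿ fromℚ (ℚ.- 1ℚ) →
  Σ[ γ#0 ∈ γ #ᴿ 0ᴿ ] fromℕ c <ᴿ delsarteBound k γ γ#0
c<delsarteBound {c} {k} {κ} {η} {γ} c≤2 0<η 0<κ [1+K]κ≡1 (N₁ , lower) γ≤-1 =
  inj₁ (½ , ℚ.positive⁻¹ ½ , N₂ , λ m N₂≤m → ℚ.+-monoˡ-≤ ½ (upper m N₂≤m)) ,
  κ ℚ.* η , *-pos 0<κ 0<η , N₁ ⊔ N₂ , λ m N≤m → begin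
    ℤ.+ c ℚ./ 1 ℚ.+ κ ℚ.* η           ≤⟨ ℚ.+-monoˡ-≤ (κ ℚ.* η) (c≤2⇒c/1≤2 c≤2) ⟩
    1ℚ ℚ.+ 1ℚ ℚ.+ κ ℚ.* η             ≡⟨ ℚ.+-assoc 1ℚ 1ℚ (κ ℚ.* η) ⟩
    1ℚ ℚ.+ (1ℚ ℚ.+ κ ℚ.* η)           ≤⟨ ℚ.+-monoʳ-≤ 1ℚ (ratio-bound 0<η 0<κ [1+K]κ≡1
                                          (lower m (ℕ.m⊔n≤o⇒m≤o N₁ N₂ N≤m))
                                          (ℚ.≤-<-trans (upper m (ℕ.m⊔n≤o⇒n≤o N₁ N₂ N≤m)) (ℚ.negative⁻¹ (ℚ.- ½)))) ⟩
    1ℚ ℚ.- (ℤ.+ k ℚ./ 1) ℚ.* reciprocal (seq γ m) ∎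
  where
  open ℚ.≤-Reasoning
  -- The bound -1/2 is a choice strictly between -1 and 0. It yields both the apartness of `γ` from
  -- 0 and the negativity required by `ratio-bound`.
  eventually = ≤ᴿ⇒eventually-≤ {γ} {ℚ.- 1ℚ} {ℚ.- ½} γ≤-1 (from-yes (ℚ.- 1ℚ ℚ.<? ℚ.- ½))
  N₂ = proj₁ eventually
  upper = proj₂ eventually

CAP<Delsarte : ∀ Γ → let open Graph Γ using (order; _~_) ; open Spectrum Γ using (Pentagonal; action) in
  Pentagonal → (∀ {i j l} → i ~ j → i ~ l → j ~ l → ⊥) →
  (∀ i → ∃[ φ ] φ i ≡ 1ℚ × (∀ j → action φ j ≡ ℚ.- 1ℚ ℚ.* φ j)) →
  (c : ℕ) → IsCAPBound Γ c → (k : ℕ) → IsRegular Γ k →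
  (γ : ℝ) → IsMinimumEigenvalue (Graph.adjacencyMatrix Γ) γ →
  Σ[ γ#0 ∈ γ #ᴿ 0ᴿ ] fromℕ c <ᴿ delsarteBound k γ γ#0
CAP<Delsarte Γ pentagonal triangle-free -1-eigenvector c capBound k regular γ (eigenvalue , minimum) =
  c<delsarteBound {c} {k} {κ} {_} {γ}
    (triangle-free⇒CAP≤2 Γ {i} {j} i~j (λ l → triangle-free {i} {j} {l} i~j) capBound)
    (Spectrum.0<η Γ total≡K 0≤K 0<κ [1+K]κ≡1) 0<κ [1+K]κ≡1
    (Spectrum.eigenvalue-bound Γ total≡K 0≤K 0<κ [1+K]κ≡1 pentagonal {γ} eigenvalue)
    (minimum (fromℚ (ℚ.- 1ℚ)) (let (φ , φi≡1 , eigen) = -1-eigenvector i in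
      Spectrum.rational-eigenvalue Γ φ (ℚ.- 1ℚ) i φi≡1 eigen))
  where
  -- The nonzero entry of the eigenvector supplies a vertex, and the pentagon through it an edge,
  -- where the common neighbours are counted.
  i : Fin (Graph.order Γ)
  i = proj₁ (proj₁ (proj₂ eigenvalue))

  j : Fin (Graph.order Γ)
  j = proj₁ (pentagonal i)

  i~j : Graph._~_ Γ i j
  i~j = proj₁ (proj₂ (proj₂ (proj₂ (proj₂ (pentagonal i)))))

  K κ : ℚ
  K = ℤ.+ k ℚ./ 1
  κ = reciprocal (1ℚ ℚ.+ K)

  0≤K : 0ℚ ℚ.≤ K
  0≤K = 0≤n/1 k

  total≡K : ∀ l → sum (Spectrum.weight Γ l) ≡ K
  total≡K l = trans (Spectrum.total-weight Γ l) (cong (λ d → ℤ.+ d ℚ./ 1) (regular l))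

  0<1+K : 0ℚ ℚ.< 1ℚ ℚ.+ K
  0<1+K = ℚ.+-mono-<-≤ (ℚ.positive⁻¹ 1ℚ) 0≤K

  0<κ : 0ℚ ℚ.< κ
  0<κ = reciprocal-pos 0<1+K

  [1+K]κ≡1 : (1ℚ ℚ.+ K) ℚ.* κ ≡ 1ℚ
  [1+K]κ≡1 = reciprocal-inverseʳ (λ 1+K≡0 → ℚ.<-irrefl (sym 1+K≡0) 0<1+K)

-- Fields of order an odd power of 11

secantGraph-bound : ∀ {q m t} → q ≡ 11 ℕ.^ m → q ≡ 4 ℕ.* t ℕ.+ 3 →
  (F : HeytingField 0ℓ 0ℓ 0ℓ) (∣F∣≡q : HasOrder F q) (𝓞 : PG2.NonDegenerateConic F ∣F∣≡q) →
  let Γ = PG2.secantGraph F ∣F∣≡q 𝓞 in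
  (c : ℕ) → IsCAPBound Γ c → (k : ℕ) → IsRegular Γ k →
  (γ : ℝ) → IsMinimumEigenvalue (Graph.adjacencyMatrix Γ) γ →
  Σ[ γ#0 ∈ γ #ᴿ 0ᴿ ] fromℕ c <ᴿ delsarteBound k γ γ#0
secantGraph-bound {q} {m} {t} q≡11^m q≡4t+3 F ∣F∣≡q 𝓞 =
  CAP<Delsarte (PG2.secantGraph F ∣F∣≡q 𝓞)
    (SecantGraph.pentagonal F ∣F∣≡q 𝓞 11≈0)
    (λ {i} {j} {l} → SecantGraph.triangle-free F ∣F∣≡q 𝓞 anisotropic {i} {j} {l})
    (SecantGraph.-1-eigenvector F ∣F∣≡q 𝓞 11≈0)
  where
  11≈0 = FiniteField.characteristic F ∣F∣≡q m q≡11^m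
  anisotropic = FiniteField.anisotropic F ∣F∣≡q (Conic.2≉0 F ∣F∣≡q 𝓞 11≈0) {t} q≡4t+3

-- Modulo 4, the square 121 of 11 is 1, so every odd power of 11 is congruent to 11 and hence to 3.
11^[1+2N]≡3mod4 : ∀ N → ∃[ t ] 11 ℕ.^ suc (2 ℕ.* N) ≡ 4 ℕ.* t ℕ.+ 3
11^[1+2N]≡3mod4 N = let (t , eq) = 11²^N≡1mod4 N in 11 ℕ.* t ℕ.+ 2 , (begin
  11 ℕ.* 11 ℕ.^ (2 ℕ.* N)        ≡⟨ cong (11 ℕ.*_) (ℕ.^-*-assoc 11 2 N) ⟨
  11 ℕ.* (11 ℕ.^ 2) ℕ.^ N        ≡⟨ cong (11 ℕ.*_) eq ⟩
  11 ℕ.* (4 ℕ.* t ℕ.+ 1)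
    ≡⟨ solve 1 (λ t → con 11 :* (con 4 :* t :+ con 1) := con 4 :* (con 11 :* t :+ con 2) :+ con 3) refl t ⟩
  4 ℕ.* (11 ℕ.* t ℕ.+ 2) ℕ.+ 3   ∎)
  where
  open ≡-Reasoning
  open ℕSolver.+-*-Solver
  11²^N≡1mod4 : ∀ N → ∃[ t ] (11 ℕ.^ 2) ℕ.^ N ≡ 4 ℕ.* t ℕ.+ 1
  11²^N≡1mod4 zero    = 0 , refl
  11²^N≡1mod4 (suc N) = let (t , eq) = 11²^N≡1mod4 N in 121 ℕ.* t ℕ.+ 30 ,
    trans (cong (121 ℕ.*_) eq)
      (solve 1 (λ t → con 121 :* (con 4 :* t :+ con 1) := con 4 :* (con 121 :* t :+ con 30) :+ con 1) refl t)

4t+3-odd : ∀ t → 2 ∤ 4 ℕ.* t ℕ.+ 3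
4t+3-odd t 2∣4t+3 = from-no (2 ∣? 3) (∣m+n∣m⇒∣n 2∣4t+3 (divides (2 ℕ.* t)
  (solve 1 (λ t → con 4 :* t := con 2 :* t :* con 2) refl t)))
  where open ℕSolver.+-*-Solver

n<11^n : ∀ n → n < 11 ℕ.^ n
n<11^n zero    = s≤s z≤n
n<11^n (suc n) = ℕ.≤-<-trans (n<11^n n) (ℕ.^-monoʳ-< 11 (s≤s (s≤s z≤n)) (ℕ.n<1+n n))

theorem5p4 : (N : ℕ) →
    ∃[ q ] N < q × IsOddPrimePower q ×
    ((F : HeytingField 0ℓ 0ℓ 0ℓ) (∣F∣≡q : HasOrder F q)
    (𝓞 : PG2.NonDegenerateConic F ∣F∣≡q) →
    let Γ = PG2.secantGraph F ∣F∣≡q 𝓞 in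
    (c : ℕ) → IsCAPBound Γ c →
    (k : ℕ) → IsRegular Γ k →
    (γ : ℝ) → IsMinimumEigenvalue (Graph.adjacencyMatrix Γ) γ →
    Σ[ γ#0 ∈ γ #ᴿ 0ᴿ ] fromℕ c <ᴿ delsarteBound k γ γ#0)
theorem5p4 N =
  let (t , q≡4t+3) = 11^[1+2N]≡3mod4 N in
  11 ℕ.^ suc (2 ℕ.* N) ,
  ℕ.≤-<-trans (ℕ.≤-trans (ℕ.m≤n*m N 2) (ℕ.n≤1+n (2 ℕ.* N))) (n<11^n (suc (2 ℕ.* N))) ,
  ((11 , suc (2 ℕ.* N) , from-yes (prime? 11) , s≤s z≤n , refl) , subst (2 ∤_) (sym q≡4t+3) (4t+3-odd t)) ,
  secantGraph-bound {m = suc (2 ℕ.* N)} {t} refl q≡4t+3
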